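{- Let $q$ be a prime or a prime power with $q\equiv 1 \pmod 6$ and $q\neq 13$. Then there exists a regular Fano Kaleidoscope of order $q$ (a regular FK$(q)$).
   Context: For an ordered 7-tuple $B=(b_0,\dots,b_6)$ of distinct points, its $i$-th line is $\ell_i(B)=\{b_i,b_{i+1},b_{i+3}\}$ (indices mod 7), $0\le i\le 6$; the pair $(B,\{\ell_i(B)\})$ is a Fano plane (the unique 2-$(7,3,1)$ design). A Fano Kaleidoscope of order $v$, FK$(v)$, is a set $\mathcal F$ of Fano planes whose points lie in a $v$-set $\mathcal V$, where the seven lines of each plane are colored with seven distinct colors $c_0,\dots,c_6$, such that for any two distinct points $x,y\in\mathcal V$ and any color $c_i$ there is exactly one plane of $\mathcal F$ whose $c_i$-colored line contains $x$ and $y$. For a group $G$ of order $v$, an FK$(v)$ is $G$-regular if $G$ acts sharply transitively on $\mathcal V$ (so $\mathcal V$ is identified with $G$) and $G$ (acting by translation) leaves the collection of colored planes invariant; "regular" means $G$-regular for some group $G$. -}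

module Defs where

open import Data.Nat using (ℕ; suc; _+_; _^_; _%_)
open import Data.Nat.DivMod using (_mod_)
open import Data.Nat.Primality using (Prime)
open import Data.Fin using (Fin; toℕ)
open import Data.Product using (Σ; ∃; ∃-syntax; _×_; _,_)
open import Data.Sum using (_⊎_)
open import Function.Definitions using (Injective)
open import Function.Bundles using (_⇔_)
open import Relation.Binary.PropositionalEquality using (_≡_)
open import Relation.Nullary using (¬_)
open import Algebra.Structures using (IsGroup)

IsPrimePower : ℕ → Set
IsPrimePower q = ∃[ p ] ∃[ k ] (Prime p × q ≡ p ^ suc k)

_⊕₇_ : Fin 7 → ℕ → Fin 7
i ⊕₇ m = (toℕ i + m) mod 7

-- A colored Fano plane on point set Fin v:
--   points : the ordered 7-tuple B = (b_0,…,b_6) of distinct points,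
--   line   : the colouring, colour c ↦ index of the line ℓ_{line c}(B);
--            injective, i.e. the seven lines get seven distinct colours.
record ColoredFano (v : ℕ) : Set where
  field
    points    : Fin 7 → Fin v
    distinct  : Injective _≡_ _≡_ points
    line      : Fin 7 → Fin 7
    line-inj  : Injective _≡_ _≡_ line
open ColoredFano public

OnLine : ∀ {v} → (Fin 7 → Fin v) → Fin 7 → Fin v → Set
OnLine b i x = x ≡ b i ⊎ x ≡ b (i ⊕₇ 1) ⊎ x ≡ b (i ⊕₇ 3)

OnColoredLine : ∀ {v} → ColoredFano v → Fin 7 → Fin v → Set
OnColoredLine P c x = OnLine (points P) (line P c) x

Family : ℕ → ℕ → Set
Family v n = Fin n → ColoredFano v

IsFK : ∀ {v n} → Family v n → Set
IsFK {v} {n} F =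
  (x y : Fin v) → ¬ (x ≡ y) → (c : Fin 7) →
    Σ (Fin n) λ k →
      (OnColoredLine (F k) c x × OnColoredLine (F k) c y) ×
      ((k' : Fin n) → OnColoredLine (F k') c x → OnColoredLine (F k') c y → k' ≡ k)

SameColoredPlane : ∀ {v} → ColoredFano v → ColoredFano v → Set
SameColoredPlane {v} P Q = (c : Fin 7) (x : Fin v) → OnColoredLine P c x ⇔ OnColoredLine Q c x

IsTranslate : ∀ {v} → (Fin v → Fin v → Fin v) → Fin v → ColoredFano v → ColoredFano v → Set
IsTranslate {v} _∙_ g P Q =
  (c : Fin 7) (x : Fin v) → OnColoredLine Q c x ⇔ (∃[ y ] (OnColoredLine P c y × x ≡ g ∙ y))

TranslationInvariant : ∀ {v n} → (Fin v → Fin v → Fin v) → Family v n → Set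
TranslationInvariant {v} {n} _∙_ F =
  (g : Fin v) (k : Fin n) → ∃[ k' ] IsTranslate _∙_ g (F k) (F k')

-- A group structure on the point set Fin v (any group of order v, up to isomorphism)
record GroupOn (v : ℕ) : Set where
  field
    _∙_     : Fin v → Fin v → Fin v
    ε       : Fin v
    _⁻¹     : Fin v → Fin v
    isGroup : IsGroup _≡_ _∙_ ε _⁻¹

-- G-regular FK(v): V identified with G, G acting by (left) translation
RegularFK : ℕ → Set
RegularFK v =
  Σ (GroupOn v) λ G → Σ ℕ λ n → Σ (Family v n) λ F →
    IsFK F × TranslationInvariant (GroupOn._∙_ G) F

{-# OPTIONS --safe #-}
module Submission where

-- Let χ be a cubic character of a finite field K. If the three differences on
-- every line of a plane P ⊂ K have distinct colors χ (a rainbow plane), then the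
-- planes s P, with s running through ker χ modulo ±1, form a difference family,
-- and the translates of its members are an FK. If B runs through a difference
-- family over G and C through one over K, the planes (bᵢ , μᵢ h) and (0 , cᵢ),
-- with h ∈ K and distinct μᵢ ∈ K, form one over G × K. Hence it suffices to treat
-- the fields of order p ≡ 1 and p², p ≡ 5 (mod 6), and of order 13² and 13³.
--
-- Take seven points of ℤ[ω][y] all of whose differences are products of a few
-- generators. Whether they form a rainbow plane depends on the colors of the
-- generators only, so finitely many such planes, found by computer, settle all
-- possibilities. If χ(ω) = 0, counting gives a y with χ(y) = 1 and χ(1 - y) = 2,
-- and factors of y¹² - 1 and y⁴ + 1 serve as generators. If χ(ω) = 1, constants
-- suffice unless χ looks like a cubic character modulo 2 or 13, for which no
-- rainbow plane exists. Then y is chosen where this pattern breaks: as the last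
-- power of 2 with χ(1 - u y) = 0 for all units u, or as the least integer with the
-- wrong color.

-- Constants alone cannot suffice. If χ(ω) = 0, all constants in any given finite list may be cubes,
-- so a variable y whose color is known has to enter. If χ(ω) = 1 and χ agrees on the constants in
-- question with the cubic character of a residue field of ℤ[ω], a rainbow plane built from them
-- would reduce to one over that residue field. The field with four elements has fewer than seven
-- points, and the field with 13 elements has no rainbow plane; these are the two patterns that
-- constants leave open. Where such a pattern breaks for the first time, the elements near y still
-- follow it, so their colors are known, while one color is known to be wrong. In characteristic 13
-- the color of an integer depends only on its residue modulo 13, so integers can never break the
-- second pattern. This is why 13² and 13³ are treated directly; products of their families reach
-- every exponent from 2 on. Products are admissible because regularity asks for some group of order
-- q, not for the additive group of a field in which the construction was made.

open import Defs
open import Algebra.Bundles using (AbelianGroup; CommutativeRing; RawRing)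
import Algebra.Properties.CommutativeSemiring.Exp as Exp
import Algebra.Properties.Ring
import Algebra.Properties.Semiring.Exp
import Algebra.Properties.Semiring.Mult
import Algebra.Solver.Ring
open import Algebra.Solver.Ring.AlmostCommutativeRing using (fromCommutativeRing; _-Raw-AlmostCommutative⟶_)
open import Algebra.Structures using (IsAbelianGroup; IsCommutativeRing)
open import Data.Bool using (Bool; true; false; _∧_; if_then_else_; T)
open import Data.Bool.ListAction using (all; any)
open import Data.Bool.Properties using (T-∧)
open import Data.Empty using (⊥; ⊥-elim)
open import Data.Fin using (Fin; zero; suc; toℕ; fromℕ<; inject≤)
import Data.Fin as Fin
open import Data.Fin.Patterns
import Data.Fin.Properties as Fin
open import Data.List using (List; []; _∷_; _++_; map; foldr; replicate; length; filter; lookup; allFin)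
open import Data.List.Membership.Propositional using (_∈_)
open import Data.List.Membership.Propositional.Properties using (∈-filter⁺; ∈-filter⁻; ∈-allFin; ∈-lookup; ∈-++⁺ˡ; ∈-++⁺ʳ; ∈-map⁺)
open import Data.List.Properties using (length-map; length-tabulate)
import Data.List.Relation.Unary.All as All
open import Data.List.Relation.Unary.All using (All; []; _∷_)
open import Data.List.Relation.Unary.All.Properties using (all⁺)
open import Data.List.Relation.Unary.AllPairs using (_∷_)
import Data.List.Relation.Unary.Any as Any
open import Data.List.Relation.Unary.Any using (here; there)
open import Data.List.Relation.Unary.Any.Properties using (lookup-index)
open import Data.List.Relation.Unary.Unique.Propositional using (Unique)
open import Data.List.Relation.Unary.Unique.Propositional.Properties using (filter⁺; map⁺; allFin⁺)
open import Data.Maybe using (Maybe; just; nothing)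
open import Data.Nat as ℕ using (ℕ; zero; suc; _⊓_; _∸_; _/_; _%_; _≡ᵇ_; _<ᵇ_; _<_; _≤_; s≤s; z≤n; NonZero)
open import Data.Nat.DivMod using (m%n<n; m<n⇒m%n≡m; m%n%n≡m%n; n%n≡0; m≡m%n+[m/n]*n; [m+kn]%n≡m%n; %-distribˡ-+; %-distribˡ-*)
open import Data.Nat.Divisibility using (_∣_; divides; m%n≡0⇒n∣m; n∣m⇒m%n≡0; ∣m+n∣m⇒∣n; ∣m∣n⇒∣m+n; ∣⇒≤; ∣m⇒∣m*n; ∣n⇒∣m*n)
open import Data.Nat.Induction using (<-rec)
open import Data.Nat.Primality using (Prime; prime?; euclidsLemma; prime⇒nonTrivial; prime⇒nonZero; prime⇒irreducible)
import Data.Nat.Properties as ℕ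
open import Data.Product using (Σ; ∃; ∃₂; _×_; _,_; proj₁; proj₂)
open import Data.Product.Function.NonDependent.Propositional using (_×-↔_)
open import Data.Product.Properties using (≡-dec)
open import Data.Sum using (_⊎_; inj₁; inj₂; [_,_]′)
import Data.Sum as Sum
open import Data.Sum.Function.Propositional using (_⊎-↔_)
open import Data.Unit using (⊤; tt)
open import Function.Base using (_∘_)
open import Function.Bundles using (_↔_; _⇔_; Equivalence; Inverse; mk⇔)
open import Function.Construct.Composition using (_↔-∘_)
open import Function.Construct.Identity using (↔-id)
open import Function.Definitions using (Injective)
open import Level using (0ℓ)
open import Relation.Binary.Definitions using (DecidableEquality; tri<; tri≈; tri>)
open import Relation.Binary.PropositionalEquality hiding ([_])
open import Relation.Nullary using (¬_; yes; no; Dec)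
open import Relation.Nullary.Decidable using (from-yes; ¬?; _×-dec_; _→-dec_; _⊎-dec_; map′; decidable-stable; True; toWitness)

-- Difference families

point : Fin 7 → Fin 3 → Fin 7
point i 0F = i
point i 1F = i ⊕₇ 1
point i 2F = i ⊕₇ 3

point-injective : ∀ i → Injective _≡_ _≡_ (point i)
point-injective i {a} {b} = lemma i a b
  where
  lemma : ∀ i a b → point i a ≡ point i b → a ≡ b
  lemma = from-yes (Fin.all? λ i → Fin.all? λ a → Fin.all? λ b →
    (point i a Fin.≟ point i b) →-dec (a Fin.≟ b))

joining-line : ∀ u v → u ≢ v →
  ∃ λ i → ∃ λ a → ∃ λ b → u ≡ point i a × v ≡ point i b
joining-line = from-yes (Fin.all? λ u → Fin.all? λ v → ¬? (u Fin.≟ v) →-dec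
  Fin.any? λ i → Fin.any? λ a → Fin.any? λ b →
    (u Fin.≟ point i a) ×-dec (v Fin.≟ point i b))

record FiniteAbelianGroup (v : ℕ) : Set₁ where
  field
    Carrier        : Set
    _+_            : Carrier → Carrier → Carrier
    0#             : Carrier
    -_             : Carrier → Carrier
    isAbelianGroup : IsAbelianGroup _≡_ _+_ 0# -_
    enumeration    : Fin v ↔ Carrier

  abelianGroup : AbelianGroup 0ℓ 0ℓ
  abelianGroup = record { isAbelianGroup = isAbelianGroup }

  open AbelianGroup abelianGroup public
    using (group; assoc; comm; identityˡ; identityʳ; inverseˡ; inverseʳ)
  open import Algebra.Properties.AbelianGroup abelianGroup public
    using (∙-cancelˡ; ∙-cancelʳ; x∙y⁻¹≈ε⇒x≈y)

  infixl 6 _-_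
  _-_ : Carrier → Carrier → Carrier
  x - y = x + (- y)

  infixl 6 _+_
  infix 8 -_

  translate-difference : ∀ t x y → (t + x) - (t + y) ≡ x - y
  translate-difference t x y = begin
    (t + x) + (- (t + y))      ≡⟨ cong ((t + x) +_) (⁻¹-anti-homo-∙ t y) ⟩
    (t + x) + ((- y) + (- t))  ≡⟨ cong (_+ ((- y) + (- t))) (comm t x) ⟩
    (x + t) + ((- y) + (- t))  ≡⟨ cong ((x + t) +_) (comm (- y) (- t)) ⟩
    (x + t) + ((- t) + (- y))  ≡⟨ assoc x t _ ⟩
    x + (t + ((- t) + (- y)))  ≡⟨ cong (x +_) (sym (assoc t (- t) (- y))) ⟩
    x + ((t + (- t)) + (- y))  ≡⟨ cong (λ z → x + (z + (- y))) (inverseʳ t) ⟩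
    x + (0# + (- y))           ≡⟨ cong (x +_) (identityˡ (- y)) ⟩
    x + (- y)                  ∎
    where
    open ≡-Reasoning
    open import Algebra.Properties.Group group using (⁻¹-anti-homo-∙)

  cancel-difference : ∀ x y → (x - y) + y ≡ x
  cancel-difference x y = trans (assoc x (- y) y) (trans (cong (x +_) (inverseˡ y)) (identityʳ x))

-- The condition is imposed on each line index `i` separately because color `i` will always be
-- carried by line `i` of a base plane and of its translates.
record DifferenceFamily {v : ℕ} (G : FiniteAbelianGroup v) : Set₁ where
  open FiniteAbelianGroup G
  field
    Index          : Set
    {size}         : ℕ
    indices        : Fin size ↔ Index
    base           : Index → Fin 7 → Carrier
    base-injective : ∀ k → Injective _≡_ _≡_ (base k)
    covers         : ∀ i g → g ≢ 0# → ∃ λ k → ∃ λ a → ∃ λ b →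
                     a ≢ b × base k (point i a) - base k (point i b) ≡ g
    unique         : ∀ i {k l a b c d} → a ≢ b → c ≢ d →
                     base k (point i a) - base k (point i b) ≡
                     base l (point i c) - base l (point i d) →
                     k ≡ l × a ≡ c × b ≡ d

module _ {v : ℕ} {G : FiniteAbelianGroup v} (D : DifferenceFamily G) where
  open FiniteAbelianGroup G
  open DifferenceFamily D
  open Inverse enumeration using () renaming
    (to to element; from to code; strictlyInverseˡ to element-code; strictlyInverseʳ to code-element)
  private
    module Ix = Inverse indices
    module Pr = Inverse (Fin.*↔× {size} {v})

  private
    element-injective : ∀ {x y} → element x ≡ element y → x ≡ y
    element-injective {x} {y} eq =
      trans (sym (code-element x)) (trans (cong code eq) (code-element y))

    code-injective : ∀ {x y} → code x ≡ code y → x ≡ y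
    code-injective {x} {y} eq =
      trans (sym (element-code x)) (trans (cong element eq) (element-code y))

    groupOn : GroupOn v
    groupOn = record
      { _∙_ = λ x y → code (element x + element y)
      ; ε   = code 0#
      ; _⁻¹ = λ x → code (- element x)
      ; isGroup = record
        { isMonoid = record
          { isSemigroup = record
            { isMagma = record { isEquivalence = isEquivalence ; ∙-cong = cong₂ _ }
            ; assoc = λ x y z → cong code (trans
                (cong (_+ element z) (element-code _))
                (trans (assoc _ _ _) (cong (element x +_) (sym (element-code _)))))
            }
          ; identity =
              (λ x → trans (cong code (trans (cong (_+ element x) (element-code 0#)) (identityˡ _))) (code-element x))
            , (λ x → trans (cong code (trans (cong (element x +_) (element-code 0#)) (identityʳ _))) (code-element x))
          }
        ; inverse =
            (λ x → cong code (trans (cong (_+ element x) (element-code _)) (inverseˡ _)))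
          , (λ x → cong code (trans (cong (element x +_) (element-code _)) (inverseʳ _)))
        ; ⁻¹-cong = cong (λ x → code (- element x))
        }
      }

    plane : Index → Carrier → ColoredFano v
    plane k t = record
      { points   = λ j → code (t + base k j)
      ; distinct = λ eq → base-injective k (∙-cancelˡ t _ _ (code-injective eq))
      ; line     = λ c → c
      ; line-inj = λ eq → eq
      }

    onLine⁻ : ∀ k t c x → OnColoredLine (plane k t) c x → ∃ λ a → element x ≡ t + base k (point c a)
    onLine⁻ k t c x (inj₁ eq)        = 0F , trans (cong element eq) (element-code _)
    onLine⁻ k t c x (inj₂ (inj₁ eq)) = 1F , trans (cong element eq) (element-code _)
    onLine⁻ k t c x (inj₂ (inj₂ eq)) = 2F , trans (cong element eq) (element-code _)

    onLine⁺ : ∀ k t c x a → element x ≡ t + base k (point c a) → OnColoredLine (plane k t) c x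
    onLine⁺ k t c x 0F eq = inj₁ (element-injective (trans eq (sym (element-code _))))
    onLine⁺ k t c x 1F eq = inj₂ (inj₁ (element-injective (trans eq (sym (element-code _)))))
    onLine⁺ k t c x 2F eq = inj₂ (inj₂ (element-injective (trans eq (sym (element-code _)))))

    planes : Family v (size ℕ.* v)
    planes m = plane (Ix.to (proj₁ (Pr.to m))) (element (proj₂ (Pr.to m)))

    number : Index → Carrier → Fin (size ℕ.* v)
    number k t = Pr.from (Ix.from k , code t)

    planes-number : ∀ k t → planes (number k t) ≡ plane k t
    planes-number k t = trans
      (cong (λ (i , s) → plane (Ix.to i) (element s)) (Pr.strictlyInverseˡ (Ix.from k , code t)))
      (cong₂ plane (Ix.strictlyInverseˡ k) (element-code t))

    number-eta : ∀ m → number (Ix.to (proj₁ (Pr.to m))) (element (proj₂ (Pr.to m))) ≡ m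
    number-eta m = trans
      (cong Pr.from (cong₂ _,_ (Ix.strictlyInverseʳ _) (code-element _)))
      (Pr.strictlyInverseʳ m)

    -- The difference of x and y selects the base plane and the places of x and y on its line `c`;
    -- then x itself fixes the translation `t`.
    isFK : IsFK planes
    isFK x y x≢y c =
      let X = element x
          Y = element y
          k , a , b , a≢b , eq = covers c (X - Y) (λ d≡0 → x≢y (element-injective (x∙y⁻¹≈ε⇒x≈y X Y d≡0)))
          t = X - base k (point c a)
          onX : X ≡ t + base k (point c a)
          onX = sym (cancel-difference _ _)
          onY : Y ≡ t + base k (point c b)
          onY = let u = base k (point c a) ; w = base k (point c b) in begin
            Y                  ≡⟨ sym (∙-cancelˡ (X - Y) _ _ (begin
              (X - Y) + (t + w)  ≡⟨ cong (_+ (t + w)) (sym eq) ⟩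
              (u - w) + (t + w)  ≡⟨ cong ((u - w) +_) (comm t w) ⟩
              (u - w) + (w + t)  ≡⟨ sym (assoc _ _ _) ⟩
              ((u - w) + w) + t  ≡⟨ cong (_+ t) (cancel-difference u w) ⟩
              u + t              ≡⟨ comm u t ⟩
              t + u              ≡⟨ cancel-difference X u ⟩
              X                  ≡⟨ sym (cancel-difference X Y) ⟩
              (X - Y) + Y        ∎)) ⟩
            t + w              ∎
          at : ∀ z d → element z ≡ t + base k (point c d) → OnColoredLine (planes (number k t)) c z
          at z d e = subst (λ P → OnColoredLine P c z) (sym (planes-number k t)) (onLine⁺ k t c z d e)
      in number k t , (at x a onX , at y b onY) , λ m ox oy →
        let k′ = Ix.to (proj₁ (Pr.to m))
            t′ = element (proj₂ (Pr.to m))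
            a′ , ea = onLine⁻ k′ t′ c x ox
            b′ , eb = onLine⁻ k′ t′ c y oy
            a′≢b′ : a′ ≢ b′
            a′≢b′ a′≡b′ = x≢y (element-injective
              (trans ea (trans (cong (λ d → t′ + base k′ (point c d)) a′≡b′) (sym eb))))
            k≡ , a≡ , b≡ = unique c a′≢b′ a≢b (begin
              base k′ (point c a′) - base k′ (point c b′) ≡⟨ sym (translate-difference t′ _ _) ⟩
              (t′ + base k′ (point c a′)) - (t′ + base k′ (point c b′)) ≡⟨ cong₂ _-_ (sym ea) (sym eb) ⟩
              X - Y ≡⟨ sym eq ⟩
              base k (point c a) - base k (point c b) ∎)
            t′≡t = ∙-cancelʳ (base k (point c a)) _ _ (trans
              (cong₂ (λ l d → t′ + base l (point c d)) (sym k≡) (sym a≡))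
              (trans (sym ea) onX))
        in trans (sym (number-eta m)) (cong₂ number k≡ t′≡t)
      where open ≡-Reasoning

    translationInvariant : TranslationInvariant (GroupOn._∙_ groupOn) planes
    translationInvariant g m = number k (element g + t) , λ c x →
      subst (λ P → Claim P c x) (sym (planes-number k (element g + t))) (mk⇔
        (λ on → let a , e = onLine⁻ k (element g + t) c x on
                    y = code (t + base k (point c a))
                in y , onLine⁺ k t c y a (element-code _) ,
                   element-injective (trans e (trans (assoc _ _ _)
                     (sym (trans (element-code _) (cong (element g +_) (element-code _)))))))
        (λ (y , on , e) → let a , ey = onLine⁻ k t c y on in
          onLine⁺ k (element g + t) c x a
            (trans (cong element e) (trans (element-code _)
              (trans (cong (element g +_) ey) (sym (assoc _ _ _)))))))
      where
      k = Ix.to (proj₁ (Pr.to m))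
      t = element (proj₂ (Pr.to m))
      Claim : ColoredFano v → Fin 7 → Fin v → Set
      Claim P c x = OnColoredLine P c x Function.Bundles.⇔
        (∃ λ y → OnColoredLine (planes m) c y × x ≡ GroupOn._∙_ groupOn g y)

  regularFK : RegularFK v
  regularFK = groupOn , size ℕ.* v , planes , isFK , translationInvariant

-- Finite fields

record FiniteField (q : ℕ) : Set₁ where
  infixl 6 _+_
  infixl 7 _*_
  infix 8 -_
  field
    Carrier           : Set
    _+_ _*_           : Carrier → Carrier → Carrier
    -_                : Carrier → Carrier
    0# 1#             : Carrier
    isCommutativeRing : IsCommutativeRing _≡_ _+_ _*_ -_ 0# 1#
    1≢0               : 1# ≢ 0#
    integral          : ∀ x y → x * y ≡ 0# → x ≡ 0# ⊎ y ≡ 0#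
    enumeration       : Fin q ↔ Carrier

  commutativeRing : CommutativeRing 0ℓ 0ℓ
  commutativeRing = record { isCommutativeRing = isCommutativeRing }

  open CommutativeRing commutativeRing public
    using ( ring; semiring; +-isAbelianGroup; +-assoc; +-comm; +-identityˡ; +-identityʳ
          ; *-assoc; *-comm; *-identityˡ; *-identityʳ; distribˡ; distribʳ
          ; zeroˡ; zeroʳ; -‿inverseʳ )
  open Algebra.Properties.Ring ring public
    using (-‿distribˡ-*; -‿distribʳ-*; -‿involutive; -‿+-comm; -0#≈0#; +-cancelˡ; x∙y⁻¹≈ε⇒x≈y)
  open Algebra.Properties.Semiring.Mult semiring public
    using (×-homo-+; ×1-homo-*) renaming (_×_ to _⋆_)
  open Algebra.Properties.Semiring.Exp semiring public
    using (_^_; ^-homo-*; ^-assocʳ)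

  infixl 6 _-_
  _-_ : Carrier → Carrier → Carrier
  x - y = x + (- y)

  additiveGroup : FiniteAbelianGroup q
  additiveGroup = record { isAbelianGroup = +-isAbelianGroup ; enumeration = enumeration }

  open Inverse enumeration public using () renaming
    (to to element; from to code; strictlyInverseˡ to element-code; strictlyInverseʳ to code-element)

  code-injective : ∀ {x y} → code x ≡ code y → x ≡ y
  code-injective {x} {y} eq =
    trans (sym (element-code x)) (trans (cong element eq) (element-code y))

  element-injective : ∀ {x y} → element x ≡ element y → x ≡ y
  element-injective {x} {y} eq =
    trans (sym (code-element x)) (trans (cong code eq) (code-element y))

  infix 4 _≟_
  _≟_ : DecidableEquality Carrier
  x ≟ y = map′ code-injective (cong code) (code x Fin.≟ code y)

  *-nonzero : ∀ {x y} → x ≢ 0# → y ≢ 0# → x * y ≢ 0#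
  *-nonzero x≢0 y≢0 xy≡0 = [ x≢0 , y≢0 ]′ (integral _ _ xy≡0)

  ^-nonzero : ∀ {x} n → x ≢ 0# → x ^ n ≢ 0#
  ^-nonzero zero    x≢0 = 1≢0
  ^-nonzero (suc n) x≢0 = *-nonzero x≢0 (^-nonzero n x≢0)

  neg-nonzero : ∀ {x} → x ≢ 0# → - x ≢ 0#
  neg-nonzero x≢0 e = x≢0 (trans (sym (-‿involutive _)) (trans (cong -_ e) -0#≈0#))

  *-cancelˡ : ∀ {x y z} → x ≢ 0# → x * y ≡ x * z → y ≡ z
  *-cancelˡ {x} {y} {z} x≢0 e with integral x (y - z)
    (trans (distribˡ x y (- z)) (trans (cong (_+ x * (- z)) e)
      (trans (sym (distribˡ x z (- z))) (trans (cong (x *_) (-‿inverseʳ z)) (zeroʳ x)))))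
  ... | inj₁ x≡0 = ⊥-elim (x≢0 x≡0)
  ... | inj₂ d≡0 = x∙y⁻¹≈ε⇒x≈y y z d≡0

  -- A missed value would extend f to an injection of q + 1 points into q points.
  injective⇒surjective : (f : Carrier → Carrier) → Injective _≡_ _≡_ f → ∀ y → ∃ λ x → f x ≡ y
  injective⇒surjective f inj y with Fin.any? (λ i → f (element i) ≟ y)
  ... | yes (i , e) = element i , e
  ... | no missed = ⊥-elim (ℕ.1+n≰n (Fin.injective⇒≤ g-injective))
    where
    g : Fin (suc q) → Fin q
    g zero    = code y
    g (suc i) = code (f (element i))
    g-injective : Injective _≡_ _≡_ g
    g-injective {zero}  {zero}  _ = refl
    g-injective {zero}  {suc j} e = ⊥-elim (missed (j , sym (code-injective e)))
    g-injective {suc i} {zero}  e = ⊥-elim (missed (i , code-injective e))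
    g-injective {suc i} {suc j} e = cong suc (element-injective (inj (code-injective e)))

  divide : ∀ x y → x ≢ 0# → ∃ λ z → x * z ≡ y
  divide x y x≢0 = injective⇒surjective (x *_) (*-cancelˡ x≢0) y

-- A ring solver with integer coefficients

module Solver {q : ℕ} (K : FiniteField q) where
  open FiniteField K
  open ≡-Reasoning
  open import Algebra.Properties.CommutativeSemigroup
    (CommutativeRing.+-commutativeSemigroup commutativeRing) using (interchange)

  private
    ⟦_⟧ : ℕ × ℕ → Carrier
    ⟦ a , b ⟧ = a ⋆ 1# - b ⋆ 1#

    -- One of the two truncated differences is 0, so every integer has a single normal form and
    -- coefficients stay small.
    normal : ℕ × ℕ → ℕ × ℕ
    normal (a , b) = a ℕ.∸ b , b ℕ.∸ a

    -- (a , b) stands for a - b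
    differences : RawRing 0ℓ 0ℓ
    differences = record
      { Carrier = ℕ × ℕ
      ; _≈_ = _≡_
      ; _+_ = λ (a , b) (c , d) → normal (a ℕ.+ c , b ℕ.+ d)
      ; _*_ = λ (a , b) (c , d) → normal (a ℕ.* c ℕ.+ b ℕ.* d , a ℕ.* d ℕ.+ b ℕ.* c)
      ; -_  = λ (a , b) → b , a
      ; 0#  = 0 , 0
      ; 1#  = 1 , 0
      }

    +-hom : ∀ a b c d → ⟦ a ℕ.+ c , b ℕ.+ d ⟧ ≡ ⟦ a , b ⟧ + ⟦ c , d ⟧
    +-hom a b c d = begin
      (a ℕ.+ c) ⋆ 1# - (b ℕ.+ d) ⋆ 1#
        ≡⟨ cong₂ _+_ (×-homo-+ 1# a c) (cong -_ (×-homo-+ 1# b d)) ⟩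
      (a ⋆ 1# + c ⋆ 1#) - (b ⋆ 1# + d ⋆ 1#)
        ≡⟨ cong₂ _+_ refl (sym (-‿+-comm _ _)) ⟩
      (a ⋆ 1# + c ⋆ 1#) + (- (b ⋆ 1#) + - (d ⋆ 1#))
        ≡⟨ interchange _ _ _ _ ⟩
      ⟦ a , b ⟧ + ⟦ c , d ⟧ ∎

    neg-hom : ∀ a b → ⟦ b , a ⟧ ≡ - ⟦ a , b ⟧
    neg-hom a b = begin
      b ⋆ 1# - a ⋆ 1#            ≡⟨ +-comm _ _ ⟩
      - (a ⋆ 1#) + b ⋆ 1#        ≡⟨ cong₂ _+_ refl (sym (-‿involutive _)) ⟩
      - (a ⋆ 1#) + - - (b ⋆ 1#)  ≡⟨ -‿+-comm _ _ ⟩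
      - ⟦ a , b ⟧                ∎

    *-hom : ∀ a b c d → ⟦ a ℕ.* c ℕ.+ b ℕ.* d , a ℕ.* d ℕ.+ b ℕ.* c ⟧ ≡ ⟦ a , b ⟧ * ⟦ c , d ⟧
    *-hom a b c d = begin
      ⟦ a ℕ.* c ℕ.+ b ℕ.* d , a ℕ.* d ℕ.+ b ℕ.* c ⟧
        ≡⟨ +-hom (a ℕ.* c) (a ℕ.* d) (b ℕ.* d) (b ℕ.* c) ⟩
      ⟦ a ℕ.* c , a ℕ.* d ⟧ + ⟦ b ℕ.* d , b ℕ.* c ⟧
        ≡⟨ cong₂ _+_ (scale a c d) (trans (neg-hom (b ℕ.* c) (b ℕ.* d)) (cong -_ (scale b c d))) ⟩
      (a ⋆ 1#) * ⟦ c , d ⟧ + - ((b ⋆ 1#) * ⟦ c , d ⟧)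
        ≡⟨ cong₂ _+_ refl (-‿distribˡ-* _ _) ⟩
      (a ⋆ 1#) * ⟦ c , d ⟧ + - (b ⋆ 1#) * ⟦ c , d ⟧
        ≡⟨ sym (distribʳ _ _ _) ⟩
      ⟦ a , b ⟧ * ⟦ c , d ⟧ ∎
      where
      scale : ∀ a c d → ⟦ a ℕ.* c , a ℕ.* d ⟧ ≡ (a ⋆ 1#) * ⟦ c , d ⟧
      scale a c d = begin
        (a ℕ.* c) ⋆ 1# - (a ℕ.* d) ⋆ 1#
          ≡⟨ cong₂ _+_ (×1-homo-* a c) (cong -_ (×1-homo-* a d)) ⟩
        (a ⋆ 1#) * (c ⋆ 1#) - (a ⋆ 1#) * (d ⋆ 1#)
          ≡⟨ cong₂ _+_ refl (-‿distribʳ-* _ _) ⟩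
        (a ⋆ 1#) * (c ⋆ 1#) + (a ⋆ 1#) * - (d ⋆ 1#)
          ≡⟨ sym (distribˡ _ _ _) ⟩
        (a ⋆ 1#) * ⟦ c , d ⟧ ∎

    equal : ∀ a b c d → a ℕ.+ d ≡ c ℕ.+ b → ⟦ a , b ⟧ ≡ ⟦ c , d ⟧
    equal a b c d e = x∙y⁻¹≈ε⇒x≈y _ _ (begin
      ⟦ a , b ⟧ - ⟦ c , d ⟧       ≡⟨ cong₂ _+_ refl (sym (neg-hom c d)) ⟩
      ⟦ a , b ⟧ + ⟦ d , c ⟧       ≡⟨ sym (+-hom a b d c) ⟩
      ⟦ a ℕ.+ d , b ℕ.+ c ⟧       ≡⟨ cong₂ (λ m n → ⟦ m , n ⟧) e (ℕ.+-comm b c) ⟩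
      ⟦ c ℕ.+ b , c ℕ.+ b ⟧       ≡⟨ -‿inverseʳ _ ⟩
      0#                          ∎)

    normal≡ : ∀ d → ⟦ normal d ⟧ ≡ ⟦ d ⟧
    normal≡ (a , b) = equal (a ℕ.∸ b) (b ℕ.∸ a) a b (balance (ℕ.≤-total a b))
      where
      balance : a ℕ.≤ b ⊎ b ℕ.≤ a → (a ℕ.∸ b) ℕ.+ b ≡ a ℕ.+ (b ℕ.∸ a)
      balance (inj₁ a≤b) = trans (cong (ℕ._+ b) (ℕ.m≤n⇒m∸n≡0 a≤b)) (sym (ℕ.m+[n∸m]≡n a≤b))
      balance (inj₂ b≤a) = trans (ℕ.m∸n+n≡m b≤a) (sym (trans (cong (a ℕ.+_) (ℕ.m≤n⇒m∸n≡0 b≤a)) (ℕ.+-identityʳ a)))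

    -- The first two clauses make `con (0 , 0)` and `con (1 , 0)` evaluate to `0#` and `1#` by
    -- definition, where `⟦_⟧` would give sums such as (1 + 0) - 0. The equations handed to the
    -- solver can then be written in their natural form.
    value : ℕ × ℕ → Carrier
    value (0 , 0) = 0#
    value (1 , 0) = 1#
    value d       = ⟦ d ⟧

    value≡ : ∀ d → value d ≡ ⟦ d ⟧
    value≡ (0 , 0)           = sym (-‿inverseʳ 0#)
    value≡ (1 , 0)           = sym (trans (cong₂ _+_ (+-identityʳ 1#) -0#≈0#) (+-identityʳ 1#))
    value≡ (0 , suc _)       = refl
    value≡ (1 , suc _)       = refl
    value≡ (suc (suc _) , _) = refl

    morphism : differences -Raw-AlmostCommutative⟶ fromCommutativeRing commutativeRing
    morphism = record
      { ⟦_⟧    = value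
      ; +-homo = λ x@(a , b) y@(c , d) → trans (value≡ (normal (a ℕ.+ c , b ℕ.+ d))) (trans (normal≡ (a ℕ.+ c , b ℕ.+ d)) (trans (+-hom a b c d) (sym (cong₂ _+_ (value≡ x) (value≡ y)))))
      ; *-homo = λ x@(a , b) y@(c , d) → trans (value≡ (normal (a ℕ.* c ℕ.+ b ℕ.* d , a ℕ.* d ℕ.+ b ℕ.* c))) (trans (normal≡ (a ℕ.* c ℕ.+ b ℕ.* d , a ℕ.* d ℕ.+ b ℕ.* c)) (trans (*-hom a b c d) (sym (cong₂ _*_ (value≡ x) (value≡ y)))))
      ; -‿homo = λ x@(a , b) → trans (value≡ (b , a)) (trans (neg-hom a b) (sym (cong -_ (value≡ x))))
      ; 0-homo = refl
      ; 1-homo = refl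
      }

    equal? : ∀ a b c d → Maybe (value (a , b) ≡ value (c , d))
    equal? a b c d with a ℕ.+ d ℕ.≟ c ℕ.+ b
    ... | yes e = just (trans (value≡ (a , b)) (trans (equal a b c d e) (sym (value≡ (c , d)))))
    ... | no  _ = nothing

  open Algebra.Solver.Ring differences (fromCommutativeRing commutativeRing) morphism
    (λ (a , b) (c , d) → equal? a b c d) public

-- Products of difference families

_⊗_ : ∀ {m n} → FiniteAbelianGroup m → FiniteAbelianGroup n → FiniteAbelianGroup (m ℕ.* n)
_⊗_ {m} {n} G H = record
  { Carrier = G.Carrier × H.Carrier
  ; _+_ = λ (a , b) (c , d) → a G.+ c , b H.+ d
  ; 0# = G.0# , H.0#
  ; -_ = λ (a , b) → G.- a , H.- b
  ; isAbelianGroup = record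
    { isGroup = record
      { isMonoid = record
        { isSemigroup = record
          { isMagma = record { isEquivalence = isEquivalence ; ∙-cong = cong₂ _ }
          ; assoc = λ x y z → cong₂ _,_ (G.assoc _ _ _) (H.assoc _ _ _)
          }
        ; identity = (λ x → cong₂ _,_ (G.identityˡ _) (H.identityˡ _))
                   , (λ x → cong₂ _,_ (G.identityʳ _) (H.identityʳ _))
        }
      ; inverse = (λ x → cong₂ _,_ (G.inverseˡ _) (H.inverseˡ _))
                , (λ x → cong₂ _,_ (G.inverseʳ _) (H.inverseʳ _))
      ; ⁻¹-cong = cong (λ (a , b) → G.- a , H.- b)
      }
    ; comm = λ x y → cong₂ _,_ (G.comm _ _) (H.comm _ _)
    }
  ; enumeration = (G.enumeration ×-↔ H.enumeration) ↔-∘ Fin.*↔×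
  }
  where
  module G = FiniteAbelianGroup G
  module H = FiniteAbelianGroup H

module _ {m n} {G : FiniteAbelianGroup m} (K : FiniteField n)
         (μ : Fin 7 → FiniteField.Carrier K) (μ-injective : Injective _≡_ _≡_ μ)
         (D : DifferenceFamily G) (E : DifferenceFamily (FiniteField.additiveGroup K)) where
  private
    module G = FiniteAbelianGroup G
    module D = DifferenceFamily D
    module E = DifferenceFamily E
    module H = FiniteAbelianGroup (G ⊗ FiniteField.additiveGroup K)
    open FiniteField K
    open Solver K using (solve; _:*_; _:-_; _:=_)

    Index : Set
    Index = (D.Index × Carrier) ⊎ E.Index

    base : Index → Fin 7 → G.Carrier × Carrier
    base (inj₁ (k , h)) j = D.base k j , μ j * h
    base (inj₂ l)       j = G.0# , E.base l j

    factor : ∀ x y h → x * h - y * h ≡ (x - y) * h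
    factor = solve 3 (λ x y h → x :* h :- y :* h := (x :- y) :* h) refl

    μ-difference : ∀ i {a b} → a ≢ b → μ (point i a) - μ (point i b) ≢ 0#
    μ-difference i a≢b e = a≢b (point-injective i (μ-injective (x∙y⁻¹≈ε⇒x≈y _ _ e)))

    G-difference : ∀ k i {a b} → a ≢ b → D.base k (point i a) G.- D.base k (point i b) ≢ G.0#
    G-difference k i a≢b e = a≢b (point-injective i (D.base-injective k (G.x∙y⁻¹≈ε⇒x≈y _ _ e)))

    G≟ : DecidableEquality G.Carrier
    G≟ x y = map′
      (λ e → trans (sym (N.strictlyInverseˡ x)) (trans (cong N.to e) (N.strictlyInverseˡ y)))
      (cong N.from) (N.from x Fin.≟ N.from y)
      where module N = Inverse G.enumeration

  -- A nonzero first component determines the plane of `D` and the two places on the line; the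
  -- second component is then (μₐ - μ_b) h, which determines h because K is a field. Differences
  -- with first component 0 arise only from the planes of `E`.
  productFamily : DifferenceFamily (G ⊗ FiniteField.additiveGroup K)
  productFamily = record
    { Index          = Index
    ; indices        = (((D.indices ×-↔ enumeration) ↔-∘ Fin.*↔×) ⊎-↔ E.indices) ↔-∘ Fin.+↔⊎
    ; base           = base
    ; base-injective = injective
    ; covers         = covers
    ; unique         = unique
    }
    where
    injective : ∀ k → Injective _≡_ _≡_ (base k)
    injective (inj₁ (k , _)) e = D.base-injective k (cong proj₁ e)
    injective (inj₂ l)       e = E.base-injective l (cong proj₂ e)

    covers : ∀ i g → g ≢ H.0# → ∃ λ k → ∃ λ a → ∃ λ b →
             a ≢ b × base k (point i a) H.- base k (point i b) ≡ g
    covers i (g , h) gh≢0 with G≟ g G.0#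
    ... | no g≢0 =
      let k , a , b , a≢b , e = D.covers i g g≢0
          z , e′ = divide (μ (point i a) - μ (point i b)) h (μ-difference i a≢b)
      in inj₁ (k , z) , a , b , a≢b , cong₂ _,_ e (trans (factor _ _ z) e′)
    ... | yes refl =
      let l , a , b , a≢b , e = E.covers i h (λ { refl → gh≢0 refl })
      in inj₂ l , a , b , a≢b , cong₂ _,_ (G.inverseʳ G.0#) e

    unique : ∀ i {k l a b c d} → a ≢ b → c ≢ d →
             base k (point i a) H.- base k (point i b) ≡ base l (point i c) H.- base l (point i d) →
             k ≡ l × a ≡ c × b ≡ d
    unique i {inj₁ (k , h)} {inj₁ (l , h′)} {a} {b} a≢b c≢d e with D.unique i a≢b c≢d (cong proj₁ e)
    ... | refl , refl , refl = cong (λ z → inj₁ (k , z))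
            (*-cancelˡ (μ-difference i a≢b) (trans (sym (factor _ _ h)) (trans (cong proj₂ e) (factor _ _ h′)))) , refl , refl
    unique i {inj₁ (k , h)} {inj₂ l} a≢b c≢d e =
      ⊥-elim (G-difference k i a≢b (trans (cong proj₁ e) (G.inverseʳ G.0#)))
    unique i {inj₂ k} {inj₁ (l , h)} a≢b c≢d e =
      ⊥-elim (G-difference l i c≢d (trans (sym (cong proj₁ e)) (G.inverseʳ G.0#)))
    unique i {inj₂ k} {inj₂ l} a≢b c≢d e with E.unique i a≢b c≢d (cong proj₂ e)
    ... | refl , refl , refl = refl , refl , refl

-- Rainbow planes

infixl 6 _⊕_
_⊕_ : Fin 3 → Fin 3 → Fin 3
0F ⊕ b  = b
1F ⊕ 0F = 1F
1F ⊕ 1F = 2F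
1F ⊕ 2F = 0F
2F ⊕ 0F = 2F
2F ⊕ 1F = 0F
2F ⊕ 2F = 1F

⊕-identityʳ : ∀ a → a ⊕ 0F ≡ a
⊕-identityʳ = from-yes (Fin.all? λ a → a ⊕ 0F Fin.≟ a)

⊕-cancelˡ : ∀ a b c → a ⊕ b ≡ a ⊕ c → b ≡ c
⊕-cancelˡ = from-yes (Fin.all? λ a → Fin.all? λ b → Fin.all? λ c → (a ⊕ b Fin.≟ a ⊕ c) →-dec (b Fin.≟ c))

⊕-double : ∀ a → a ⊕ a ≡ 0F → a ≡ 0F
⊕-double = from-yes (Fin.all? λ a → (a ⊕ a Fin.≟ 0F) →-dec (a Fin.≟ 0F))

record CubicCharacter {q} (K : FiniteField q) : Set where
  open FiniteField K
  field
    χ          : Carrier → Fin 3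
    χ-*        : ∀ {x y} → x ≢ 0# → y ≢ 0# → χ (x * y) ≡ χ x ⊕ χ y
    nontrivial : ∃ λ g → g ≢ 0# × χ g ≡ 1F

  χ-1 : χ 1# ≡ 0F
  χ-1 = ⊕-cancelˡ (χ 1#) _ _ (trans (sym (χ-* 1≢0 1≢0)) (trans (cong χ (*-identityˡ 1#)) (sym (⊕-identityʳ _))))

  χ-neg : ∀ {x} → x ≢ 0# → χ (- x) ≡ χ x
  χ-neg {x} x≢0 = trans (cong χ (solve 1 (λ x → :- x := :- con (1 , 0) :* x) refl x))
      (trans (χ-* (neg-nonzero 1≢0) x≢0) (cong (_⊕ χ x) χ-1-))
    where
    open Solver K using (solve; _:*_; :-_; _:=_; con)
    χ-1- : χ (- 1#) ≡ 0F
    χ-1- = ⊕-double _ (trans (sym (χ-* (neg-nonzero 1≢0) (neg-nonzero 1≢0)))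
      (trans (cong χ (trans (sym (-‿distribˡ-* 1# (- 1#))) (trans (cong -_ (*-identityˡ _)) (-‿involutive 1#)))) χ-1))

next : Fin 3 → Fin 3
next 0F = 1F
next 1F = 2F
next 2F = 0F

third : ∀ a b → a ≢ b → ∃ λ c →
  (a ≡ next c × b ≡ next (next c)) ⊎ (a ≡ next (next c) × b ≡ next c)
third = from-yes (Fin.all? λ a → Fin.all? λ b → ¬? (a Fin.≟ b) →-dec Fin.any? λ c →
  ((a Fin.≟ next c) ×-dec (b Fin.≟ next (next c))) ⊎-dec ((a Fin.≟ next (next c)) ×-dec (b Fin.≟ next c)))

next≢next² : ∀ c → next c ≢ next (next c)
next≢next² = from-yes (Fin.all? λ c → ¬? (next c Fin.≟ next (next c)))

-- `edge i c` is the side of line `i` opposite to its point number `c`, oriented cyclically. As -1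
-- has color 0, reversing a side does not change its color.
record RainbowPlane {q} (K : FiniteField q) (X : CubicCharacter K) : Set where
  open FiniteField K
  open CubicCharacter X
  field
    vertex  : Fin 7 → Carrier

  edge : Fin 7 → Fin 3 → Carrier
  edge i c = vertex (point i (next c)) - vertex (point i (next (next c)))

  field
    edge≢0  : ∀ i c → edge i c ≢ 0#
    rainbow : ∀ i → Injective _≡_ _≡_ (χ ∘ edge i)

lookup-injective : ∀ {A : Set} {xs : List A} → Unique xs → Injective _≡_ _≡_ (lookup xs)
lookup-injective (_ ∷ _) {zero}  {zero}  e = refl
lookup-injective (p ∷ _) {zero}  {suc j} e = ⊥-elim (All.lookup p (∈-lookup j) e)
lookup-injective (p ∷ _) {suc i} {zero}  e = ⊥-elim (All.lookup p (∈-lookup i) (sym e))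
lookup-injective (_ ∷ u) {suc i} {suc j} e = cong suc (lookup-injective u e)

module _ {q} {K : FiniteField q} {X : CubicCharacter K} (P : RainbowPlane K X)
         (2≢0 : FiniteField._+_ K (FiniteField.1# K) (FiniteField.1# K) ≢ FiniteField.0# K) where
  open FiniteField K
  open CubicCharacter X
  open RainbowPlane P
  open Solver K using (solve; _:*_; _:-_; _:+_; :-_; _:=_; con)

  private
    -- Comparing the codes of s and -s chooses one of the two. They are different by `halve`, which
    -- is where 2 ≠ 0 enters.
    Scalar : Fin q → Set
    Scalar i = element i ≢ 0# × χ (element i) ≡ 0F × i Fin.< code (- element i)

    scalar? : ∀ i → Dec (Scalar i)
    scalar? i = ¬? (element i ≟ 0#) ×-dec (χ (element i) Fin.≟ 0F) ×-dec (i Fin.<? code (- element i))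

    scalars : List (Fin q)
    scalars = filter scalar? (allFin q)

    scalar : Fin (length scalars) → Carrier
    scalar k = element (lookup scalars k)

    isScalar : ∀ k → Scalar (lookup scalars k)
    isScalar k = proj₂ (∈-filter⁻ scalar? {xs = allFin q} (∈-lookup k))

    scalar-injective : Injective _≡_ _≡_ scalar
    scalar-injective e = lookup-injective (filter⁺ scalar? (allFin⁺ q)) (element-injective e)

    findScalar : ∀ i → Scalar i → ∃ λ k → scalar k ≡ element i
    findScalar i s = Any.index i∈ , cong element (sym (lookup-index i∈))
      where i∈ = ∈-filter⁺ scalar? (∈-allFin i) s

    scale : ∀ s x y → s * x - s * y ≡ s * (x - y)
    scale = solve 3 (λ s x y → s :* x :- s :* y := s :* (x :- y)) refl

    swap : ∀ x y → y - x ≡ - (x - y)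
    swap = solve 2 (λ x y → y :- x := :- (x :- y)) refl

    neg*neg : ∀ x y → - x * - y ≡ y * x
    neg*neg = solve 2 (λ x y → :- x :* :- y := y :* x) refl

    move-neg : ∀ x y → x * - y ≡ y * - x
    move-neg = solve 2 (λ x y → x :* :- y := y :* :- x) refl

    double : ∀ x → (1# + 1#) * x ≡ x + x
    double = solve 1 (λ x → (con (1 , 0) :+ con (1 , 0)) :* x := x :+ x) refl

    swapped : ∀ i c → vertex (point i (next (next c))) - vertex (point i (next c)) ≡ - edge i c
    swapped i c = swap (vertex (point i (next c))) (vertex (point i (next (next c))))

    halve : ∀ {x} → x ≡ - x → x ≡ 0#
    halve {x} e = [ (λ 2≡0 → ⊥-elim (2≢0 2≡0)) , (λ x≡0 → x≡0) ]′ (integral _ x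
      (trans (double x)
        (trans (cong (x +_) e) (-‿inverseʳ x))))

    χ-scalar : ∀ k i c → χ (scalar k * edge i c) ≡ χ (edge i c)
    χ-scalar k i c = let s≢0 , χs , _ = isScalar k in
      trans (χ-* s≢0 (edge≢0 i c)) (cong (_⊕ χ (edge i c)) χs)

    onto : ∀ {f : Fin 3 → Fin 3} → Injective _≡_ _≡_ f → ∀ y → ∃ λ x → f x ≡ y
    onto {f} inj y with Fin.any? (λ x → f x Fin.≟ y)
    ... | yes r = r
    ... | no missed = ⊥-elim (ℕ.1+n≰n (Fin.injective⇒≤ {f = λ { zero → y ; (suc x) → f x }}
            λ { {zero} {zero} _ → refl
              ; {zero} {suc x} e → ⊥-elim (missed (x , sym e))
              ; {suc x} {zero} e → ⊥-elim (missed (x , e))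
              ; {suc x} {suc x′} e → cong suc (inj e) }))

    -- The three edges of a line show all three colors, so one of them has the color of g and the
    -- quotient z has color 0. Either z is a chosen scalar, or -z is one and the edge is traversed
    -- in reverse.
    covers : ∀ i g → g ≢ 0# → ∃ λ k → ∃ λ a → ∃ λ b → a ≢ b ×
             scalar k * vertex (point i a) - scalar k * vertex (point i b) ≡ g
    covers i g g≢0 =
      let c , χc = onto (rainbow i) (χ g)
          z , ez = divide (edge i c) g (edge≢0 i c)
          z≢0 : z ≢ 0#
          z≢0 z≡0 = g≢0 (trans (sym ez) (trans (cong (edge i c *_) z≡0) (zeroʳ _)))
          χz : χ z ≡ 0F
          χz = ⊕-cancelˡ (χ (edge i c)) _ _ (trans (sym (χ-* (edge≢0 i c) z≢0))
                 (trans (cong χ ez) (trans (sym χc) (sym (⊕-identityʳ _)))))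
      in decide c z ez z≢0 χz
      where
      decide : ∀ c z → edge i c * z ≡ g → z ≢ 0# → χ z ≡ 0F → ∃ λ k → ∃ λ a → ∃ λ b → a ≢ b ×
               scalar k * vertex (point i a) - scalar k * vertex (point i b) ≡ g
      decide c z ez z≢0 χz with Fin.<-cmp (code z) (code (- z))
      ... | tri< lt _ _ =
        let k , ek = findScalar (code z)
              (subst (λ w → w ≢ 0# × χ w ≡ 0F × code z Fin.< code (- w)) (sym (element-code z)) (z≢0 , χz , lt))
        in k , next c , next (next c) , next≢next² c ,
           trans (scale _ _ _) (trans (cong (_* edge i c) (trans ek (element-code z))) (trans (*-comm z _) ez))
      ... | tri≈ _ e _ = ⊥-elim (z≢0 (halve (code-injective e)))
      ... | tri> _ _ gt =
        let -z≢0 = neg-nonzero z≢0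
            k , ek = findScalar (code (- z))
              (subst (λ w → w ≢ 0# × χ w ≡ 0F × code (- z) Fin.< code (- w)) (sym (element-code (- z)))
                (-z≢0 , trans (χ-neg z≢0) χz , subst (λ w → code (- z) Fin.< code w) (sym (-‿involutive z)) gt))
        in k , next (next c) , next c , (λ e → next≢next² c (sym e)) ,
           trans (scale _ _ _) (trans (cong₂ _*_ (trans ek (element-code (- z))) (swapped i c))
             (trans (neg*neg z (edge i c)) ez))

    same-color : ∀ i k l c d → χ (scalar k * edge i c) ≡ χ (scalar l * edge i d) → c ≡ d
    same-color i k l c d e = rainbow i (trans (sym (χ-scalar k i c)) (trans e (χ-scalar l i d)))

    same-edge : ∀ i k l c d → scalar k * edge i c ≡ scalar l * edge i d → k ≡ l × c ≡ d
    same-edge i k l c d e = finish (same-color i k l c d (cong χ e)) e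
      where
      finish : ∀ {d} → c ≡ d → scalar k * edge i c ≡ scalar l * edge i d → k ≡ l × c ≡ d
      finish refl e = scalar-injective (*-cancelˡ (edge≢0 i c) (trans (*-comm _ _) (trans e (*-comm _ _)))) , refl

    positive : ∀ k → code (scalar k) Fin.< code (- scalar k)
    positive k = subst (Fin._< code (- scalar k)) (sym (code-element _)) (proj₂ (proj₂ (isScalar k)))

    not-opposite : ∀ k l → scalar k ≢ - scalar l
    not-opposite k l k≡-l = Fin.<-asym
      (subst (λ w → code (scalar k) Fin.< code w) (trans (cong -_ k≡-l) (-‿involutive _)) (positive k))
      (subst (λ w → code (scalar l) Fin.< code w) (sym k≡-l) (positive l))

    opposite-edge : ∀ i k l c d → ¬ (scalar k * edge i c ≡ scalar l * - edge i d)
    opposite-edge i k l c d e = finish (same-color i k l c d (trans (cong χ e′) (χ-neg nz))) e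
      where
      e′ : scalar k * edge i c ≡ - (scalar l * edge i d)
      e′ = trans e (sym (-‿distribʳ-* _ _))
      nz : scalar l * edge i d ≢ 0#
      nz = *-nonzero (proj₁ (isScalar l)) (edge≢0 i d)
      finish : ∀ {d} → c ≡ d → ¬ (scalar k * edge i c ≡ scalar l * - edge i d)
      finish refl e = not-opposite k l (*-cancelˡ (edge≢0 i c)
        (trans (*-comm _ _) (trans e (move-neg (scalar l) (edge i c)))))

    Orientation : Fin 3 → Fin 3 → Fin 3 → Set
    Orientation a b c = (a ≡ next c × b ≡ next (next c)) ⊎ (a ≡ next (next c) × b ≡ next c)

    -- Equal differences have equal colors and thus come from the same edge up to orientation.
    -- Opposite orientations would make one chosen scalar the negative of another.
    unique : ∀ i {k l a b c d} → a ≢ b → c ≢ d →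
             scalar k * vertex (point i a) - scalar k * vertex (point i b) ≡
             scalar l * vertex (point i c) - scalar l * vertex (point i d) →
             k ≡ l × a ≡ c × b ≡ d
    unique i {k} {l} {a} {b} {c} {d} a≢b c≢d e =
      oriented (third a b a≢b) (third c d c≢d) (trans (sym (scale _ _ _)) (trans e (scale _ _ _)))
      where
      oriented : ∀ {a b c d} → ∃ (Orientation a b) → ∃ (Orientation c d) →
        scalar k * (vertex (point i a) - vertex (point i b)) ≡
        scalar l * (vertex (point i c) - vertex (point i d)) →
        k ≡ l × a ≡ c × b ≡ d
      oriented (x , inj₁ (refl , refl)) (y , inj₁ (refl , refl)) e =
        let k≡l , x≡y = same-edge i k l x y e in k≡l , cong next x≡y , cong (next ∘ next) x≡y
      oriented (x , inj₂ (refl , refl)) (y , inj₂ (refl , refl)) e =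
        let k≡l , x≡y = same-edge i k l x y (trans (move k x) (trans (cong -_ e) (sym (move l y))))
        in k≡l , cong (next ∘ next) x≡y , cong next x≡y
        where
        move : ∀ k x → scalar k * edge i x ≡
          - (scalar k * (vertex (point i (next (next x))) - vertex (point i (next x))))
        move k x = trans (cong (scalar k *_) (swap _ _)) (sym (-‿distribʳ-* _ _))
      oriented (x , inj₁ (refl , refl)) (y , inj₂ (refl , refl)) e =
        ⊥-elim (opposite-edge i k l x y (trans e (cong (scalar l *_) (swapped i y))))
      oriented (x , inj₂ (refl , refl)) (y , inj₁ (refl , refl)) e =
        ⊥-elim (opposite-edge i l k y x (trans (sym e) (cong (scalar k *_) (swapped i x))))

    vertex-injective : Injective _≡_ _≡_ vertex
    vertex-injective {u} {v} e with u Fin.≟ v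
    ... | yes u≡v = u≡v
    ... | no  u≢v = ⊥-elim (clash (joining-line u v u≢v))
      where
      difference≡0 : ∀ {x y} → x ≡ y → x - y ≡ 0#
      difference≡0 refl = -‿inverseʳ _
      coincide : ∀ {i a b c} → vertex (point i a) ≡ vertex (point i b) → Orientation a b c → ⊥
      coincide {i} {c = c} e (inj₁ (refl , refl)) = edge≢0 i c (difference≡0 e)
      coincide {i} {c = c} e (inj₂ (refl , refl)) = edge≢0 i c (difference≡0 (sym e))
      clash : ¬ (∃ λ i → ∃ λ a → ∃ λ b → u ≡ point i a × v ≡ point i b)
      clash (i , a , b , u≡ , v≡) =
        coincide (trans (cong vertex (sym u≡)) (trans e (cong vertex v≡)))
          (proj₂ (third a b λ a≡b → u≢v (trans u≡ (trans (cong (point i) a≡b) (sym v≡)))))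

  differenceFamily : DifferenceFamily additiveGroup
  differenceFamily = record
    { indices        = ↔-id _
    ; base           = λ k j → scalar k * vertex j
    ; base-injective = λ k e → vertex-injective (*-cancelˡ (proj₁ (isScalar k)) e)
    ; covers         = covers
    ; unique         = unique
    }

-- Symbolic planes

-- (a , b , c) stands for a + bω + cω², so that no negative coefficients are
-- needed: -1 is (0 , 1 , 1).
Eisenstein : Set
Eisenstein = ℕ × ℕ × ℕ

Polynomial : Set
Polynomial = List Eisenstein

0ₑ 1ₑ : Eisenstein
0ₑ = 0 , 0 , 0
1ₑ = 1 , 0 , 0

_+ₑ_ _*ₑ_ : Eisenstein → Eisenstein → Eisenstein
(a , b , c) +ₑ (d , e , f) = a ℕ.+ d , b ℕ.+ e , c ℕ.+ f
(a , b , c) *ₑ (d , e , f) =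
  a ℕ.* d ℕ.+ b ℕ.* f ℕ.+ c ℕ.* e ,
  a ℕ.* e ℕ.+ b ℕ.* d ℕ.+ c ℕ.* f ,
  a ℕ.* f ℕ.+ b ℕ.* e ℕ.+ c ℕ.* d

-- The largest possible multiple of 1 + ω + ω² = 0 is removed. This is a normal form, so reduced
-- triples represent the same element of ℤ[ω] only if they are identical.
reduce : Eisenstein → Eisenstein
reduce (a , b , c) = let m = a ⊓ b ⊓ c in a ∸ m , b ∸ m , c ∸ m

_+ₚ_ _*ₚ_ : Polynomial → Polynomial → Polynomial
[]      +ₚ q       = q
(a ∷ p) +ₚ []      = a ∷ p
(a ∷ p) +ₚ (b ∷ q) = reduce (a +ₑ b) ∷ (p +ₚ q)
[]      *ₚ q = []
(a ∷ p) *ₚ q = map (a *ₑ_) q +ₚ (0ₑ ∷ (p *ₚ q))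

same : Eisenstein → Eisenstein → Bool
same (a , b , c) (d , e , f) = (a ≡ᵇ d) ∧ (b ≡ᵇ e) ∧ (c ≡ᵇ f)

_==_ : Polynomial → Polynomial → Bool
[]      == []      = true
[]      == (b ∷ q) = same (reduce b) 0ₑ ∧ ([] == q)
(a ∷ p) == []      = same (reduce a) 0ₑ ∧ (p == [])
(a ∷ p) == (b ∷ q) = same (reduce a) (reduce b) ∧ (p == q)

T-split : ∀ {x y} → T (x ∧ y) → T x × T y
T-split {true} t = tt , t

same⇒≡ : ∀ x y → T (same x y) → x ≡ y
same⇒≡ (a , b , c) (d , e , f) t =
  let t₁ , t′ = T-split {a ≡ᵇ d} t
      t₂ , t₃ = T-split {b ≡ᵇ e} t′
  in cong₂ _,_ (ℕ.≡ᵇ⇒≡ a d t₁) (cong₂ _,_ (ℕ.≡ᵇ⇒≡ b e t₂) (ℕ.≡ᵇ⇒≡ c f t₃))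

record CubeRoot {q} (K : FiniteField q) : Set where
  open FiniteField K
  field
    ω       : Carrier
    1+ω+ω²  : 1# + ω + ω * ω ≡ 0#

  private
    open Solver K using (solve; _:*_; _:-_; _:+_; :-_; _:=_; con)
    factor : ∀ x → x * (x * x) - 1# ≡ (x - 1#) * (1# + x + x * x)
    factor = solve 1 (λ x → x :* (x :* x) :- con (1 , 0) :=
      (x :- con (1 , 0)) :* (con (1 , 0) :+ x :+ x :* x)) refl

  ω³ : ω * (ω * ω) ≡ 1#
  ω³ = x∙y⁻¹≈ε⇒x≈y _ _ (trans (factor ω) (trans (cong ((ω - 1#) *_) 1+ω+ω²) (zeroʳ _)))

module Evaluation {q} (K : FiniteField q) (R : CubeRoot K) where
  open FiniteField K
  open CubeRoot R
  open Solver K using (solve; _:*_; _:+_; _:=_; con)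

  ⟦_⟧ₑ : Eisenstein → Carrier
  ⟦ a , b , c ⟧ₑ = a ⋆ 1# + (b ⋆ 1#) * ω + (c ⋆ 1#) * (ω * ω)

  +ₑ-hom : ∀ x y → ⟦ x +ₑ y ⟧ₑ ≡ ⟦ x ⟧ₑ + ⟦ y ⟧ₑ
  +ₑ-hom (a , b , c) (d , e , f)
    rewrite ×-homo-+ 1# a d | ×-homo-+ 1# b e | ×-homo-+ 1# c f = lemma _ _ _ _ _ _ ω (ω * ω)
    where
    lemma : ∀ a b c d e f w v → (a + d) + (b + e) * w + (c + f) * v ≡ (a + b * w + c * v) + (d + e * w + f * v)
    lemma = solve 8 (λ a b c d e f w v → (a :+ d) :+ (b :+ e) :* w :+ (c :+ f) :* v :=
      (a :+ b :* w :+ c :* v) :+ (d :+ e :* w :+ f :* v)) refl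

  private
    3-homo : ∀ a b c d e f → (a ℕ.* b ℕ.+ c ℕ.* d ℕ.+ e ℕ.* f) ⋆ 1# ≡
      (a ⋆ 1#) * (b ⋆ 1#) + (c ⋆ 1#) * (d ⋆ 1#) + (e ⋆ 1#) * (f ⋆ 1#)
    3-homo a b c d e f = trans (×-homo-+ 1# (a ℕ.* b ℕ.+ c ℕ.* d) (e ℕ.* f))
      (cong₂ _+_ (trans (×-homo-+ 1# (a ℕ.* b) (c ℕ.* d)) (cong₂ _+_ (×1-homo-* a b) (×1-homo-* c d))) (×1-homo-* e f))

  *ₑ-hom : ∀ x y → ⟦ x *ₑ y ⟧ₑ ≡ ⟦ x ⟧ₑ * ⟦ y ⟧ₑ
  *ₑ-hom (a , b , c) (d , e , f)
    rewrite 3-homo a d b f c e | 3-homo a e b d c f | 3-homo a f b e c d =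
      sym (trans (expand A B C D E F ω) (trans
        (cong₂ (λ t s → (A * D + B * F * t + C * E * t) + (A * E + B * D + C * F * t) * ω + (A * F + B * E + C * D) * s) ω³ refl)
        (tidy A B C D E F ω (ω * ω))))
    where
    A = a ⋆ 1# ; B = b ⋆ 1# ; C = c ⋆ 1# ; D = d ⋆ 1# ; E = e ⋆ 1# ; F = f ⋆ 1#
    expand : ∀ a b c d e f w → (a + b * w + c * (w * w)) * (d + e * w + f * (w * w)) ≡
      (a * d + b * f * (w * (w * w)) + c * e * (w * (w * w)))
        + (a * e + b * d + c * f * (w * (w * w))) * w + (a * f + b * e + c * d) * (w * w)
    expand = solve 7 (λ a b c d e f w → (a :+ b :* w :+ c :* (w :* w)) :* (d :+ e :* w :+ f :* (w :* w)) :=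
      (a :* d :+ b :* f :* (w :* (w :* w)) :+ c :* e :* (w :* (w :* w)))
        :+ (a :* e :+ b :* d :+ c :* f :* (w :* (w :* w))) :* w :+ (a :* f :+ b :* e :+ c :* d) :* (w :* w)) refl
    tidy : ∀ a b c d e f w v →
      (a * d + b * f * 1# + c * e * 1#) + (a * e + b * d + c * f * 1#) * w + (a * f + b * e + c * d) * v ≡
      (a * d + b * f + c * e) + (a * e + b * d + c * f) * w + (a * f + b * e + c * d) * v
    tidy a b c d e f w v = cong₂ (λ s t → s + t + (a * f + b * e + c * d) * v)
      (cong₂ (λ s t → a * d + s + t) (*-identityʳ _) (*-identityʳ _))
      (cong (λ t → (a * e + b * d + t) * w) (*-identityʳ _))

  reduce-sound : ∀ x → ⟦ reduce x ⟧ₑ ≡ ⟦ x ⟧ₑ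
  reduce-sound (a , b , c) = begin
    ⟦ a ∸ m , b ∸ m , c ∸ m ⟧ₑ
      ≡⟨ sym (+-identityʳ _) ⟩
    ⟦ a ∸ m , b ∸ m , c ∸ m ⟧ₑ + 0#
      ≡⟨ cong (⟦ a ∸ m , b ∸ m , c ∸ m ⟧ₑ +_) (sym (trans (common M ω (ω * ω)) (trans (cong (M *_) 1+ω+ω²) (zeroʳ M)))) ⟩
    ⟦ a ∸ m , b ∸ m , c ∸ m ⟧ₑ + ⟦ m , m , m ⟧ₑ
      ≡⟨ sym (+ₑ-hom (a ∸ m , b ∸ m , c ∸ m) (m , m , m)) ⟩
    ⟦ (a ∸ m) ℕ.+ m , (b ∸ m) ℕ.+ m , (c ∸ m) ℕ.+ m ⟧ₑ
      ≡⟨ cong ⟦_⟧ₑ (cong₂ _,_ (ℕ.m∸n+n≡m m≤a) (cong₂ _,_ (ℕ.m∸n+n≡m m≤b) (ℕ.m∸n+n≡m m≤c))) ⟩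
    ⟦ a , b , c ⟧ₑ ∎
    where
    open ≡-Reasoning
    m = a ⊓ b ⊓ c
    M = m ⋆ 1#
    m≤a = ℕ.≤-trans (ℕ.m⊓n≤m (a ⊓ b) c) (ℕ.m⊓n≤m a b)
    m≤b = ℕ.≤-trans (ℕ.m⊓n≤m (a ⊓ b) c) (ℕ.m⊓n≤n a b)
    m≤c = ℕ.m⊓n≤n (a ⊓ b) c
    common : ∀ m w v → m + m * w + m * v ≡ m * (1# + w + v)
    common = solve 3 (λ m w v → m :+ m :* w :+ m :* v := m :* (con (1 , 0) :+ w :+ v)) refl

  ⟦0⟧ₑ : ⟦ 0ₑ ⟧ₑ ≡ 0#
  ⟦0⟧ₑ = solve 2 (λ w v → con (0 , 0) :+ con (0 , 0) :* w :+ con (0 , 0) :* v := con (0 , 0)) refl ω (ω * ω)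

  ⟦1⟧ₑ : ⟦ 1ₑ ⟧ₑ ≡ 1#
  ⟦1⟧ₑ = solve 2 (λ w v → (con (1 , 0) :+ con (0 , 0)) :+ con (0 , 0) :* w :+ con (0 , 0) :* v := con (1 , 0)) refl ω (ω * ω)

  same-sound : ∀ x y → T (same (reduce x) (reduce y)) → ⟦ x ⟧ₑ ≡ ⟦ y ⟧ₑ
  same-sound x y t = trans (sym (reduce-sound x)) (trans (cong ⟦_⟧ₑ (same⇒≡ (reduce x) (reduce y) t)) (reduce-sound y))

  module _ (y : Carrier) where

    ⟦_⟧ : Polynomial → Carrier
    ⟦ [] ⟧    = 0#
    ⟦ a ∷ p ⟧ = ⟦ a ⟧ₑ + y * ⟦ p ⟧

    +ₚ-hom : ∀ p q → ⟦ p +ₚ q ⟧ ≡ ⟦ p ⟧ + ⟦ q ⟧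
    +ₚ-hom []      q       = sym (+-identityˡ _)
    +ₚ-hom (a ∷ p) []      = sym (+-identityʳ _)
    +ₚ-hom (a ∷ p) (b ∷ q) =
      trans (cong₂ _+_ (trans (reduce-sound (a +ₑ b)) (+ₑ-hom a b)) (cong (y *_) (+ₚ-hom p q))) (lemma _ _ _ _ y)
      where
      lemma : ∀ a b p q y → (a + b) + y * (p + q) ≡ (a + y * p) + (b + y * q)
      lemma = solve 5 (λ a b p q y → (a :+ b) :+ y :* (p :+ q) := (a :+ y :* p) :+ (b :+ y :* q)) refl

    scale-hom : ∀ a q → ⟦ map (a *ₑ_) q ⟧ ≡ ⟦ a ⟧ₑ * ⟦ q ⟧
    scale-hom a []      = sym (zeroʳ _)
    scale-hom a (b ∷ q) = trans (cong₂ _+_ (*ₑ-hom a b) (cong (y *_) (scale-hom a q))) (lemma _ _ _ y)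
      where
      lemma : ∀ a b q y → a * b + y * (a * q) ≡ a * (b + y * q)
      lemma = solve 4 (λ a b q y → a :* b :+ y :* (a :* q) := a :* (b :+ y :* q)) refl

    *ₚ-hom : ∀ p q → ⟦ p *ₚ q ⟧ ≡ ⟦ p ⟧ * ⟦ q ⟧
    *ₚ-hom []      q = sym (zeroˡ _)
    *ₚ-hom (a ∷ p) q = trans (+ₚ-hom (map (a *ₑ_) q) (0ₑ ∷ (p *ₚ q)))
      (trans (cong₂ _+_ (scale-hom a q) (cong₂ _+_ ⟦0⟧ₑ (cong (y *_) (*ₚ-hom p q)))) (lemma _ _ _ y))
      where
      lemma : ∀ a p q y → a * q + (0# + y * (p * q)) ≡ (a + y * p) * q
      lemma = solve 4 (λ a p q y → a :* q :+ (con (0 , 0) :+ y :* (p :* q)) := (a :+ y :* p) :* q) refl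

    ==-sound : ∀ p q → T (p == q) → ⟦ p ⟧ ≡ ⟦ q ⟧
    ==-sound []      []      t = refl
    ==-sound []      (b ∷ q) t = let t₁ , t₂ = T-split {same (reduce b) 0ₑ} t in
      sym (trans (cong₂ _+_ (trans (same-sound b 0ₑ t₁) ⟦0⟧ₑ) (cong (y *_) (sym (==-sound [] q t₂))))
        (trans (+-identityˡ _) (zeroʳ y)))
    ==-sound (a ∷ p) []      t = let t₁ , t₂ = T-split {same (reduce a) 0ₑ} t in
      trans (cong₂ _+_ (trans (same-sound a 0ₑ t₁) ⟦0⟧ₑ) (cong (y *_) (==-sound p [] t₂)))
        (trans (+-identityˡ _) (zeroʳ y))
    ==-sound (a ∷ p) (b ∷ q) t = let t₁ , t₂ = T-split {same (reduce a) (reduce b)} t in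
      cong₂ (λ u v → u + y * v) (same-sound a b t₁) (==-sound p q t₂)

-- Colorings of the generators and symbolic planes

nth : {A : Set} → A → List A → ℕ → A
nth z []       _       = z
nth z (x ∷ xs) zero    = x
nth z (x ∷ xs) (suc n) = nth z xs n

-- `nothing` marks a generator of unknown color, which may even vanish. By `_⊞_` and `differ`, no
-- line with an edge containing such a generator passes as rainbow.
Coloring : Set
Coloring = List (Maybe (Fin 3))

_⊞_ : Maybe (Fin 3) → Maybe (Fin 3) → Maybe (Fin 3)
just a ⊞ just b = just (a ⊕ b)
_      ⊞ _      = nothing

differ : Maybe (Fin 3) → Maybe (Fin 3) → Bool
differ (just 0F) (just 1F) = true
differ (just 0F) (just 2F) = true
differ (just 1F) (just 0F) = true
differ (just 1F) (just 2F) = true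
differ (just 2F) (just 0F) = true
differ (just 2F) (just 1F) = true
differ _         _         = false

pairwise : Maybe (Fin 3) → Maybe (Fin 3) → Maybe (Fin 3) → Bool
pairwise l m n = differ l m ∧ differ m n ∧ differ l n

differ-sound : ∀ m n → T (differ m n) → ∃₂ λ a b → m ≡ just a × n ≡ just b × a ≢ b
differ-sound (just 0F) (just 1F) _ = _ , _ , refl , refl , λ ()
differ-sound (just 0F) (just 2F) _ = _ , _ , refl , refl , λ ()
differ-sound (just 1F) (just 0F) _ = _ , _ , refl , refl , λ ()
differ-sound (just 1F) (just 2F) _ = _ , _ , refl , refl , λ ()
differ-sound (just 2F) (just 0F) _ = _ , _ , refl , refl , λ ()
differ-sound (just 2F) (just 1F) _ = _ , _ , refl , refl , λ ()

HasColor : ∀ {q} {K : FiniteField q} (X : CubicCharacter K) → FiniteField.Carrier K → Maybe (Fin 3) → Set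
HasColor         X x nothing  = ⊤
HasColor {K = K} X x (just c) = x ≢ FiniteField.0# K × CubicCharacter.χ X x ≡ c

-- The edges of a plane as products of numbered generators, edge c of line i
-- being at position 3 i + c.
SymbolicPlane : Set
SymbolicPlane = List (List ℕ)

-- The base 32 digits of a number, least significant first, list the generators
-- of the successive edges; the digit 0 ends an edge.
decode : ℕ → SymbolicPlane
-- The fuel 512 exceeds the number of base 32 digits of every table entry.
decode = words 512
  where
  push : ℕ → List (List ℕ) → List (List ℕ)
  push zero      ws       = [] ∷ ws
  push d@(suc _) []       = (d ∷ []) ∷ []
  push d@(suc _) (w ∷ ws) = (d ∷ w) ∷ ws
  words : ℕ → ℕ → List (List ℕ)
  words zero    _         = []
  words (suc f) zero      = []
  words (suc f) n@(suc _) = push (n % 32) (words f (n / 32))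

module Symbolic (gens : List Polynomial) where

  symbol : SymbolicPlane → Fin 7 → Fin 3 → List ℕ
  symbol P i c = nth [] P (3 ℕ.* toℕ i ℕ.+ toℕ c)

  product : List ℕ → Polynomial
  product ds = foldr (λ d p → nth [] gens d *ₚ p) (1ₑ ∷ []) ds

  edgeₚ : SymbolicPlane → Fin 7 → Fin 3 → Polynomial
  edgeₚ P i c = product (symbol P i c)

  vertexₚ : SymbolicPlane → Fin 7 → Polynomial
  vertexₚ P 0F = []
  vertexₚ P 1F = ((0 , 1 , 1) ∷ []) *ₚ edgeₚ P 0F 2F
  vertexₚ P 2F = ((0 , 1 , 1) ∷ []) *ₚ edgeₚ P 6F 0F
  vertexₚ P 3F = edgeₚ P 0F 1F
  vertexₚ P 4F = ((0 , 1 , 1) ∷ []) *ₚ edgeₚ P 4F 1F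
  vertexₚ P 5F = edgeₚ P 4F 0F
  vertexₚ P 6F = edgeₚ P 6F 2F

  vertices : SymbolicPlane → List Polynomial
  vertices P = map (vertexₚ P) (allFin 7)

  consistentEdge : List Polynomial → SymbolicPlane → Fin 7 → Fin 3 → Bool
  consistentEdge vs P i c =
    (edgeₚ P i c +ₚ nth [] vs (toℕ (point i (next (next c))))) == nth [] vs (toℕ (point i (next c)))

  consistentLine : List Polynomial → SymbolicPlane → Fin 7 → Bool
  consistentLine vs P i = all (consistentEdge vs P i) (allFin 3)

  -- The vertices are a separate argument so that their evaluation can be shared by all 21 edges.
  consistentWith : List Polynomial → SymbolicPlane → Bool
  consistentWith vs P = all (consistentLine vs P) (allFin 7)

  consistent : SymbolicPlane → Bool
  consistent P = consistentWith (vertices P) P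

  nth-vertices : ∀ P j → nth [] (vertices P) (toℕ j) ≡ vertexₚ P j
  nth-vertices P 0F = refl
  nth-vertices P 1F = refl
  nth-vertices P 2F = refl
  nth-vertices P 3F = refl
  nth-vertices P 4F = refl
  nth-vertices P 5F = refl
  nth-vertices P 6F = refl

  color : Coloring → List ℕ → Maybe (Fin 3)
  color κ ds = foldr (λ d m → nth nothing κ d ⊞ m) (just 0F) ds

  edgeColor : Coloring → SymbolicPlane → Fin 7 → Fin 3 → Maybe (Fin 3)
  edgeColor κ P i c = color κ (symbol P i c)

  rainbowLine : Coloring → SymbolicPlane → Fin 7 → Bool
  rainbowLine κ P i = pairwise (edgeColor κ P i 0F) (edgeColor κ P i 1F) (edgeColor κ P i 2F)

  rainbowₚ : Coloring → SymbolicPlane → Bool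
  rainbowₚ κ P = all (rainbowLine κ P) (allFin 7)

  module _ {q} {K : FiniteField q} (X : CubicCharacter K) (R : CubeRoot K) (y : FiniteField.Carrier K) where
    open FiniteField K
    open CubicCharacter X
    open Evaluation K R

    Respects : Coloring → Set
    Respects κ = ∀ d → HasColor X (⟦_⟧ y (nth [] gens d)) (nth nothing κ d)

    private
      ⊞-sound : ∀ {x x′} m n → HasColor X x m → HasColor X x′ n → HasColor X (x * x′) (m ⊞ n)
      ⊞-sound (just a) (just b) (x≢0 , χx) (x′≢0 , χx′) =
        *-nonzero x≢0 x′≢0 , trans (χ-* x≢0 x′≢0) (cong₂ _⊕_ χx χx′)
      ⊞-sound (just a) nothing _ _ = tt
      ⊞-sound nothing  (just b) _ _ = tt
      ⊞-sound nothing  nothing _ _ = tt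

    product-color : ∀ κ → Respects κ → ∀ ds → HasColor X (⟦_⟧ y (product ds)) (color κ ds)
    product-color κ r [] = subst (λ x → HasColor X x (just 0F)) (sym one) (1≢0 , χ-1)
      where
      one : ⟦_⟧ y (1ₑ ∷ []) ≡ 1#
      one = trans (cong₂ _+_ ⟦1⟧ₑ (zeroʳ y)) (+-identityʳ 1#)
    product-color κ r (d ∷ ds) =
      subst (λ x → HasColor X x (color κ (d ∷ ds))) (sym (*ₚ-hom y (nth [] gens d) (product ds)))
        (⊞-sound (nth nothing κ d) (color κ ds) (r d) (product-color κ r ds))

    plane-sound : ∀ P → T (consistent P) → ∀ κ → Respects κ → T (rainbowₚ κ P) → RainbowPlane K X
    plane-sound P ok κ r rb = record
      { vertex  = vertex
      ; edge≢0  = λ i c e → proj₁ (proj₂ (colors i c)) (trans (sym (edge-value i c)) e)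
      ; rainbow = λ i {a} {b} e → injective i a b e
      }
      where
      vertex : Fin 7 → Carrier
      vertex j = ⟦_⟧ y (vertexₚ P j)

      edge-value : ∀ i c → vertex (point i (next c)) - vertex (point i (next (next c))) ≡ ⟦_⟧ y (edgeₚ P i c)
      edge-value i c = trans
        (cong (_- vertex (point i (next (next c)))) (sym (trans (sym (+ₚ-hom y (edgeₚ P i c) (vertexₚ P (point i (next (next c))))))
          (==-sound y (edgeₚ P i c +ₚ vertexₚ P (point i (next (next c)))) (vertexₚ P (point i (next c)))
            (subst₂ (λ u v → T ((edgeₚ P i c +ₚ u) == v)) (nth-vertices P (point i (next (next c)))) (nth-vertices P (point i (next c)))
              (All.lookup (all⁺ (consistentEdge (vertices P) P i) (allFin 3)
                (All.lookup (all⁺ (consistentLine (vertices P) P) (allFin 7) ok) (∈-allFin i))) (∈-allFin c)))))))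
        (trans (+-assoc _ _ _) (trans (cong (⟦_⟧ y (edgeₚ P i c) +_) (-‿inverseʳ _)) (+-identityʳ _)))

      e : Fin 7 → Fin 3 → Maybe (Fin 3)
      e = edgeColor κ P

      checks : ∀ i → T (differ (e i 0F) (e i 1F)) × T (differ (e i 1F) (e i 2F)) × T (differ (e i 0F) (e i 2F))
      checks i =
        let t₁ , t′ = T-split {differ (e i 0F) (e i 1F)} (All.lookup (all⁺ (rainbowLine κ P) (allFin 7) rb) (∈-allFin i))
        in t₁ , T-split {differ (e i 1F) (e i 2F)} t′

      known : ∀ i c {a} → e i c ≡ just a → ∃ λ a → ⟦_⟧ y (edgeₚ P i c) ≢ 0# × χ (⟦_⟧ y (edgeₚ P i c)) ≡ a × e i c ≡ just a
      known i c {a} eq = let nz , χe = subst (HasColor X _) eq (product-color κ r (symbol P i c)) in a , nz , χe , eq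

      colors : ∀ i c → ∃ λ a → ⟦_⟧ y (edgeₚ P i c) ≢ 0# × χ (⟦_⟧ y (edgeₚ P i c)) ≡ a × e i c ≡ just a
      colors i 0F = let _ , _ , eq , _ = differ-sound (e i 0F) (e i 1F) (proj₁ (checks i)) in known i 0F eq
      colors i 1F = let _ , _ , eq , _ = differ-sound (e i 1F) (e i 2F) (proj₁ (proj₂ (checks i))) in known i 1F eq
      colors i 2F = let _ , _ , _ , eq , _ = differ-sound (e i 0F) (e i 2F) (proj₂ (proj₂ (checks i))) in known i 2F eq

      apart : ∀ i a b → T (differ (e i a) (e i b)) →
        χ (vertex (point i (next a)) - vertex (point i (next (next a)))) ≢
        χ (vertex (point i (next b)) - vertex (point i (next (next b))))
      apart i a b t eq =
        let _ , _ , ea , eb , a≢b = differ-sound (e i a) (e i b) t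
            _ , χa = subst (HasColor X _) ea (product-color κ r (symbol P i a))
            _ , χb = subst (HasColor X _) eb (product-color κ r (symbol P i b))
        in a≢b (trans (sym χa) (trans (cong χ (sym (edge-value i a))) (trans eq (trans (cong χ (edge-value i b)) χb))))

      injective : ∀ i a b →
        χ (vertex (point i (next a)) - vertex (point i (next (next a)))) ≡
        χ (vertex (point i (next b)) - vertex (point i (next (next b)))) → a ≡ b
      injective i 0F 0F _ = refl
      injective i 1F 1F _ = refl
      injective i 2F 2F _ = refl
      injective i 0F 1F eq = ⊥-elim (apart i 0F 1F (proj₁ (checks i)) eq)
      injective i 1F 0F eq = ⊥-elim (apart i 0F 1F (proj₁ (checks i)) (sym eq))
      injective i 1F 2F eq = ⊥-elim (apart i 1F 2F (proj₁ (proj₂ (checks i))) eq)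
      injective i 2F 1F eq = ⊥-elim (apart i 1F 2F (proj₁ (proj₂ (checks i))) (sym eq))
      injective i 0F 2F eq = ⊥-elim (apart i 0F 2F (proj₂ (proj₂ (checks i))) eq)
      injective i 2F 0F eq = ⊥-elim (apart i 0F 2F (proj₂ (proj₂ (checks i))) (sym eq))

-- Unlike T b, this type is not computed when it is compared with itself.
record Holds (b : Bool) : Set where
  constructor holds
  field evidence : T b
open Holds

-- Decision trees on the colors of the generators. A leaf names a substitution
-- and a symbolic plane; a hole is a coloring that is left open.
data Tree : Set where
  lf   : ℕ → ℕ → Tree
  br   : ℕ → Tree → Tree → Tree → Tree
  hole : Tree

set : ℕ → Fin 3 → Coloring → Coloring
set _       c []      = []
set zero    c (_ ∷ κ) = just c ∷ κ
set (suc g) c (m ∷ κ) = m ∷ set g c κ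

holes : Tree → Coloring → List Coloring
holes (lf _ _)     κ = []
holes (br g a b c) κ = holes a (set g 0F κ) ++ holes b (set g 1F κ) ++ holes c (set g 2F κ)
holes hole           κ = κ ∷ []

nodes : Tree → List ℕ
nodes (lf _ _)     = []
nodes (br g a b c) = g ∷ nodes a ++ nodes b ++ nodes c
nodes hole           = []

nth-∈ : ∀ {A : Set} (z : A) xs n → nth z xs n ≡ z ⊎ nth z xs n ∈ xs
nth-∈ z []       n       = inj₁ refl
nth-∈ z (x ∷ xs) zero    = inj₂ (here refl)
nth-∈ z (x ∷ xs) (suc n) = [ inj₁ , (λ p → inj₂ (there p)) ]′ (nth-∈ z xs n)

module Decision (gens : List Polynomial) (table : List SymbolicPlane)
                (act : ℕ → Coloring → Coloring) where
  open Symbolic gens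

  valid : Tree → Coloring → Bool
  valid (lf t p)     κ = rainbowₚ (act t κ) (nth [] table p)
  valid (br g a b c) κ = valid a (set g 0F κ) ∧ valid b (set g 1F κ) ∧ valid c (set g 2F κ)
  valid hole           κ = true

  module _ {q} {K : FiniteField q} (X : CubicCharacter K) where
    open FiniteField K
    open CubicCharacter X

    RespectsAt : Coloring → CubeRoot K → Carrier → Set
    RespectsAt κ R y = Respects X R y κ

    set-respects : ∀ (f : ℕ → Carrier) g κ {c} → (∀ d → HasColor X (f d) (nth nothing κ d)) →
      HasColor X (f g) (just c) → ∀ d → HasColor X (f d) (nth nothing (set g c κ) d)
    set-respects f g       []      r h d       = tt
    set-respects f zero    (m ∷ κ) r h zero    = h
    set-respects f zero    (m ∷ κ) r h (suc d) = r (suc d)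
    set-respects f (suc g) (m ∷ κ) r h zero    = r zero
    set-respects f (suc g) (m ∷ κ) r h (suc d) = set-respects (λ d → f (suc d)) g κ (λ d → r (suc d)) h d

    module _ (consistent-table : Holds (all consistent table))
             -- A leaf may evaluate its plane at another root ω and another point y, provided that
             -- the colors there are those computed by `act`.
             (act-sound : ∀ t κ R y → RespectsAt κ R y → ∃₂ (RespectsAt (act t κ)))
             (R : CubeRoot K) (y : Carrier) (branchable : ℕ → Bool)
             (nonzero : ∀ g → T (branchable g) → Evaluation.⟦_⟧ K R y (nth [] gens g) ≢ 0#) where
      open Evaluation K R

      consistent-nth : ∀ p κ → T (rainbowₚ κ (nth [] table p)) → T (consistent (nth [] table p))
      consistent-nth p κ rb with nth-∈ [] table p
      -- Outside the table `nth` returns the empty plane. All its edges are the empty product, so it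
      -- is not rainbow.
      ... | inj₁ e  = ⊥-elim (subst (λ P → T (rainbowₚ κ P)) e rb)
      ... | inj₂ p∈ = All.lookup (all⁺ consistent table (evidence consistent-table)) p∈

      search : ∀ t κ → T (all branchable (nodes t)) → T (valid t κ) → Respects X R y κ →
        RainbowPlane K X ⊎ (∃ λ κ′ → κ′ ∈ holes t κ × Respects X R y κ′)
      search (lf t p) κ nz v r = let R′ , y′ , r′ = act-sound t κ R y r in
        inj₁ (plane-sound X R′ y′ (nth [] table p) (consistent-nth p (act t κ) v) (act t κ) r′ v)
      search hole κ nz v r = inj₂ (κ , here refl , r)
      search (br g a b c) κ nz v r =
        let ng , nz′ = T-split {branchable g} nz
            na , nz″ = all-++ (nodes a) nz′
            nb , nc = all-++ (nodes b) nz″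
            va , v′ = T-split {valid a (set g 0F κ)} v
            vb , vc = T-split {valid b (set g 1F κ)} v′
        in branch (χ (⟦_⟧ y (nth [] gens g))) refl (nonzero g ng) (na , nb , nc) va vb vc
        where
        all-++ : ∀ xs {ys} → T (all branchable (xs ++ ys)) → T (all branchable xs) × T (all branchable ys)
        all-++ []       t = tt , t
        all-++ (x ∷ xs) t = let t₁ , t₂ = T-split {branchable x} t
                                u , w = all-++ xs t₂
                            in Equivalence.from (T-∧ {branchable x}) (t₁ , u) , w

        branch : ∀ x → χ (⟦_⟧ y (nth [] gens g)) ≡ x → ⟦_⟧ y (nth [] gens g) ≢ 0# →
          T (all branchable (nodes a)) × T (all branchable (nodes b)) × T (all branchable (nodes c)) →
          T (valid a (set g 0F κ)) → T (valid b (set g 1F κ)) → T (valid c (set g 2F κ)) →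
          RainbowPlane K X ⊎ (∃ λ κ′ → κ′ ∈ holes (br g a b c) κ × Respects X R y κ′)
        branch 0F e g≢0 (na , nb , nc) va vb vc with search a _ na va (set-respects _ g κ r (g≢0 , e))
        ... | inj₁ P = inj₁ P
        ... | inj₂ (κ′ , κ′∈ , r′) = inj₂ (κ′ , ∈-++⁺ˡ κ′∈ , r′)
        branch 1F e g≢0 (na , nb , nc) va vb vc with search b _ nb vb (set-respects _ g κ r (g≢0 , e))
        ... | inj₁ P = inj₁ P
        ... | inj₂ (κ′ , κ′∈ , r′) = inj₂ (κ′ , ∈-++⁺ʳ (holes a (set g 0F κ)) (∈-++⁺ˡ κ′∈) , r′)
        branch 2F e g≢0 (na , nb , nc) va vb vc with search c _ nc vc (set-respects _ g κ r (g≢0 , e))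
        ... | inj₁ P = inj₁ P
        ... | inj₂ (κ′ , κ′∈ , r′) = inj₂ (κ′ , ∈-++⁺ʳ (holes a (set g 0F κ)) (∈-++⁺ʳ (holes b (set g 1F κ)) κ′∈) , r′)

      decide : ∀ t κ → Holds (all branchable (nodes t)) → Holds (valid t κ) → Respects X R y κ →
        RainbowPlane K X ⊎ (∃ λ κ′ → κ′ ∈ holes t κ × Respects X R y κ′)
      decide t κ nz v = search t κ (evidence nz) (evidence v)

-- A point y with χ(y) = 1 and χ(1 - y) = 2

module _ {q} {K : FiniteField q} (X : CubicCharacter K) where
  open FiniteField K
  open CubicCharacter X
  open Solver K using (solve; _:*_; _:-_; :-_; _:=_; con)

  private
    RainbowPoint : Carrier → Set
    RainbowPoint y = y ≢ 0# × (1# - y ≢ 0#) × χ y ≡ 1F × χ (1# - y) ≡ 2F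

    rainbowPoint? : ∀ y → Dec (RainbowPoint y)
    rainbowPoint? y = ¬? (y ≟ 0#) ×-dec ¬? (1# - y ≟ 0#) ×-dec (χ y Fin.≟ 1F) ×-dec (χ (1# - y) Fin.≟ 2F)

    Cube : Carrier → Set
    Cube x = x ≢ 0# × χ x ≡ 0F

    cube? : ∀ x → Dec (Cube x)
    cube? x = ¬? (x ≟ 0#) ×-dec (χ x Fin.≟ 0F)

  -- Otherwise multiplication by a non-cube g followed by y ↦ 1 - y or
  -- y ↦ 1 - y⁻¹ would map the cubes injectively to the cubes other than 1.
  rainbow-point : ∃ RainbowPoint
  rainbow-point with Fin.any? (λ i → rainbowPoint? (element i))
  ... | yes (i , p) = element i , p
  ... | no none = ⊥-elim (impossible (injective⇒surjective f f-injective 1#))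
    where
    g = proj₁ nontrivial
    g≢0 = proj₁ (proj₂ nontrivial)
    χg = proj₂ (proj₂ nontrivial)

    never : ∀ y → ¬ RainbowPoint y
    never y p = none (code y , subst RainbowPoint (sym (element-code y)) p)

    Image : Carrier → Carrier → Set
    Image x z = z ≡ 1# - g * x ⊎ ∃ λ v → (g * x) * v ≡ 1# × z ≡ 1# - v

    χgx : ∀ {x} → Cube x → χ (g * x) ≡ 1F
    χgx (x≢0 , χx) = trans (χ-* g≢0 x≢0) (cong₂ _⊕_ χg χx)

    gx≢0 : ∀ {x} → Cube x → g * x ≢ 0#
    gx≢0 (x≢0 , _) = *-nonzero g≢0 x≢0

    inverse≢0 : ∀ {w v} → w * v ≡ 1# → v ≢ 0#
    inverse≢0 {w} e v≡0 = 1≢0 (trans (sym e) (trans (cong (w *_) v≡0) (zeroʳ w)))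

    -- Put w = g x, of color 1. The color of 1 - w is not 2 by assumption; if it is 0, take 1 - w,
    -- and if it is 1, take 1 - w⁻¹ = -(1 - w) / w, whose color is 1 minus 1.
    step : ∀ x → Cube x → ∃ λ z → Cube z × Image x z
    step x c = choose (χ (1# - w)) refl
      where
      w = g * x
      w≢0 = gx≢0 c
      1-w≢0 : 1# - w ≢ 0#
      1-w≢0 e = 0≢1 (trans (sym χ-1) (trans (cong χ (x∙y⁻¹≈ε⇒x≈y 1# w e)) (χgx c)))
        where
        0≢1 : 0F ≢ 1F
        0≢1 ()
      choose : ∀ k → χ (1# - w) ≡ k → ∃ λ z → Cube z × Image x z
      choose 0F e = 1# - w , (1-w≢0 , e) , inj₁ refl
      choose 2F e = ⊥-elim (never w (w≢0 , 1-w≢0 , χgx c , e))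
      choose 1F e = 1# - v , (z≢0 , χz) , inj₂ (v , wv , refl)
        where
        v = proj₁ (divide w 1# w≢0)
        wv = proj₂ (divide w 1# w≢0)
        wz : w * (1# - v) ≡ - (1# - w)
        wz = trans (solve 2 (λ w v → w :* (con (1 , 0) :- v) := w :- w :* v) refl w v)
          (trans (cong (λ t → w - t) wv) (solve 1 (λ w → w :- con (1 , 0) := :- (con (1 , 0) :- w)) refl w))
        z≢0 : 1# - v ≢ 0#
        z≢0 z≡0 = neg-nonzero 1-w≢0 (trans (sym wz) (trans (cong (w *_) z≡0) (zeroʳ w)))
        χz : χ (1# - v) ≡ 0F
        χz = ⊕-cancelˡ 1F _ _ (trans (cong (_⊕ χ (1# - v)) (sym (χgx c)))
          (trans (sym (χ-* w≢0 z≢0)) (trans (cong χ wz) (trans (χ-neg 1-w≢0) e))))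

    image≢1 : ∀ {x z} → Cube x → Image x z → z ≢ 1#
    image≢1 {x} c (inj₁ refl) e = gx≢0 c (minus e)
      where
      minus : ∀ {w} → 1# - w ≡ 1# → w ≡ 0#
      minus {w} e = trans (solve 1 (λ w → w := con (1 , 0) :- (con (1 , 0) :- w)) refl w)
        (trans (cong (λ t → 1# - t) e) (-‿inverseʳ 1#))
    image≢1 {x} c (inj₂ (v , wv , refl)) e = inverse≢0 wv
      (trans (solve 1 (λ w → w := con (1 , 0) :- (con (1 , 0) :- w)) refl v)
        (trans (cong (λ t → 1# - t) e) (-‿inverseʳ 1#)))

    subtract-cancel : ∀ {v w} → 1# - v ≡ 1# - w → v ≡ w
    subtract-cancel {v} {w} e = trans (twice v) (trans (cong (λ t → 1# - t) e) (sym (twice w)))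
      where
      twice : ∀ w → w ≡ 1# - (1# - w)
      twice = solve 1 (λ w → w := con (1 , 0) :- (con (1 , 0) :- w)) refl

    -- The product of `g * x′` and `g * x` would be 1, yet both factors have color 1, so that the
    -- product has color 2.
    clash : ∀ {x x′ v} → Cube x → Cube x′ → (g * x′) * v ≡ 1# → g * x ≡ v → ⊥
    clash {x} {x′} {v} c c′ wv refl = two≢0 (trans (sym (cong₂ _⊕_ (χgx c′) (χgx c)))
        (trans (sym (χ-* (gx≢0 c′) (gx≢0 c))) (trans (cong χ wv) χ-1)))
      where
      two≢0 : 1F ⊕ 1F ≢ 0F
      two≢0 ()

    image-injective : ∀ {x x′ z} → Cube x → Cube x′ → Image x z → Image x′ z → x ≡ x′
    image-injective c c′ (inj₁ e) (inj₁ e′) = *-cancelˡ g≢0 (subtract-cancel (trans (sym e) e′))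
    image-injective c c′ (inj₁ e) (inj₂ (v , wv , e′)) =
      ⊥-elim (clash c c′ wv (subtract-cancel (trans (sym e) e′)))
    image-injective c c′ (inj₂ (v , wv , e)) (inj₁ e′) =
      ⊥-elim (clash c′ c wv (subtract-cancel (trans (sym e′) e)))
    image-injective c c′ (inj₂ (v , wv , e)) (inj₂ (v′ , wv′ , e′)) =
      *-cancelˡ g≢0 (*-cancelˡ (inverse≢0 wv) (trans (*-comm v _) (trans wv
        (trans (sym wv′) (trans (*-comm _ v′) (cong (_* _) (subtract-cancel (trans (sym e′) e))))))))

    -- Extending the map by the identity outside the cubes gives an injective self-map of K that
    -- misses 1, against `injective⇒surjective`.
    apply : ∀ x → Dec (Cube x) → Carrier
    apply x (yes c) = proj₁ (step x c)
    apply x (no _)  = x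

    f : Carrier → Carrier
    f x = apply x (cube? x)

    apply-injective : ∀ {x x′} d d′ → apply x d ≡ apply x′ d′ → x ≡ x′
    apply-injective (yes c) (yes c′) e =
      image-injective c c′ (proj₂ (proj₂ (step _ c))) (subst (Image _) (sym e) (proj₂ (proj₂ (step _ c′))))
    apply-injective (yes c) (no ¬c′) e = ⊥-elim (¬c′ (subst Cube e (proj₁ (proj₂ (step _ c)))))
    apply-injective (no ¬c) (yes c′) e = ⊥-elim (¬c (subst Cube (sym e) (proj₁ (proj₂ (step _ c′)))))
    apply-injective (no _)  (no _)   e = e

    f-injective : Injective _≡_ _≡_ f
    f-injective {x} {x′} = apply-injective (cube? x) (cube? x′)

    apply≢1 : ∀ x d → apply x d ≢ 1#
    apply≢1 x (yes c) e = image≢1 c (proj₂ (proj₂ (step x c))) e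
    apply≢1 x (no ¬c) e = ¬c (subst Cube (sym e) (1≢0 , χ-1))

    impossible : ¬ (∃ λ x → f x ≡ 1#)
    impossible (x , e) = apply≢1 x (cube? x) e

-- A substitution is described by expressing every generator at the new point
-- as a product of generators at the old one, up to a cube.
module Substitution (gens : List Polynomial) where
  open Symbolic gens

  transform : List (List ℕ) → Coloring → Coloring
  transform rows κ = map (color κ) rows

  matches : (Polynomial → Polynomial) → List Polynomial → List (List ℕ) → Bool
  matches f _        []         = true
  matches f []       (_ ∷ _)    = false
  matches f (p ∷ ps) (ds ∷ dss) = (f p == product ds) ∧ matches f ps dss

  module _ {q} {K : FiniteField q} (X : CubicCharacter K) where
    open FiniteField K
    open CubicCharacter X

    private
      color-modulo-cubes : ∀ m {x z w} → z ≢ 0# → (z * (z * z)) * x ≡ w → HasColor X w m → HasColor X x m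
      color-modulo-cubes nothing  z≢0 e h = tt
      color-modulo-cubes (just c) {x} {z} {w} z≢0 e (w≢0 , χw) = x≢0 ,
        trans (sym (trans (χ-* z³≢0 x≢0) (cong (_⊕ χ x) χz³))) (trans (cong χ e) χw)
        where
        x≢0 : x ≢ 0#
        x≢0 x≡0 = w≢0 (trans (sym e) (trans (cong (_ *_) x≡0) (zeroʳ _)))
        z³≢0 = *-nonzero z≢0 (*-nonzero z≢0 z≢0)
        triple : ∀ a → a ⊕ (a ⊕ a) ≡ 0F
        triple = from-yes (Fin.all? λ a → a ⊕ (a ⊕ a) Fin.≟ 0F)
        χz³ : χ (z * (z * z)) ≡ 0F
        χz³ = trans (χ-* z≢0 (*-nonzero z≢0 z≢0)) (trans (cong (χ z ⊕_) (χ-* z≢0 z≢0)) (triple (χ z)))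

    transform-sound : ∀ f rows → T (matches f gens rows) → ∀ (R R′ : CubeRoot K) y y′ →
      (∀ p → ∃ λ z → z ≢ 0# × (z * (z * z)) * Evaluation.⟦_⟧ K R′ y′ p ≡ Evaluation.⟦_⟧ K R y (f p)) →
      ∀ κ → Respects X R y κ → Respects X R′ y′ (transform rows κ)
    transform-sound f rows ok R R′ y y′ value κ r = go gens rows ok
      where
      go : ∀ ps rows → T (matches f ps rows) → ∀ d →
        HasColor X (Evaluation.⟦_⟧ K R′ y′ (nth [] ps d)) (nth nothing (map (color κ) rows) d)
      go ps       []         t d       = tt
      go (p ∷ ps) (ds ∷ dss) t zero    = let z , z≢0 , e = value p in
        color-modulo-cubes (color κ ds) z≢0
          (trans e (Evaluation.==-sound K R y (f p) (product ds) (proj₁ (T-split {f p == product ds} t))))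
          (product-color X R y κ r ds)
      go (p ∷ ps) (ds ∷ dss) t (suc d) = go ps dss (proj₂ (T-split {f p == product ds} t)) d

-- The substitutions y ↦ m y, ω ↦ ω² and y ↦ 1/y

stretch : Eisenstein → Polynomial → Polynomial
stretch m []      = []
stretch m (a ∷ p) = a ∷ map (m *ₑ_) (stretch m p)

conjugateₚ : Polynomial → Polynomial
conjugateₚ = map (λ (a , b , c) → a , c , b)

reverseOnto : Polynomial → Polynomial → Polynomial
reverseOnto []      acc = acc
reverseOnto (a ∷ p) acc = reverseOnto p (a ∷ acc)

-- y³ⁿ p(1/y), where n + 1 is the number of coefficients of p
reciprocal : Polynomial → Polynomial
reciprocal p = replicate (2 ℕ.* (length p ℕ.∸ 1)) 0ₑ ++ reverseOnto p []

module _ {q} {K : FiniteField q} where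
  open FiniteField K
  open Solver K using (solve; _:*_; _:+_; _:=_; con)

  conjugateRoot : CubeRoot K → CubeRoot K
  conjugateRoot R = record { ω = ω * ω ; 1+ω+ω² = trans (cong (1# + ω * ω +_) ω⁴) (trans (swap 1# ω (ω * ω)) 1+ω+ω²) }
    where
    open CubeRoot R
    ω⁴ : ω * ω * (ω * ω) ≡ ω
    ω⁴ = trans (solve 1 (λ w → w :* w :* (w :* w) := w :* (w :* (w :* w))) refl ω) (trans (cong (ω *_) ω³) (*-identityʳ ω))
    swap : ∀ a b c → a + c + b ≡ a + b + c
    swap = solve 3 (λ a b c → a :+ c :+ b := a :+ b :+ c) refl

  module _ (R : CubeRoot K) where
    open CubeRoot R
    open Evaluation K R

    stretch-sound : ∀ m y p → ⟦_⟧ y (stretch m p) ≡ ⟦_⟧ (⟦ m ⟧ₑ * y) p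
    stretch-sound m y []      = refl
    stretch-sound m y (a ∷ p) = cong (⟦ a ⟧ₑ +_) (trans
      (cong (y *_) (trans (scale-hom y m (stretch m p)) (cong (⟦ m ⟧ₑ *_) (stretch-sound m y p))))
      (solve 3 (λ y m p → y :* (m :* p) := m :* y :* p) refl y ⟦ m ⟧ₑ _))

    conjugate-sound : ∀ y p → ⟦_⟧ y (conjugateₚ p) ≡ Evaluation.⟦_⟧ K (conjugateRoot R) y p
    conjugate-sound y []                = refl
    conjugate-sound y ((a , b , c) ∷ p) = cong₂ (λ u v → u + y * v)
      (trans (swap _ _ _) (cong (a ⋆ 1# + (b ⋆ 1#) * (ω * ω) +_) (cong ((c ⋆ 1#) *_) (sym ω⁴))))
      (conjugate-sound y p)
      where
      ω⁴ : ω * ω * (ω * ω) ≡ ω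
      ω⁴ = trans (solve 1 (λ w → w :* w :* (w :* w) := w :* (w :* (w :* w))) refl ω) (trans (cong (ω *_) ω³) (*-identityʳ ω))
      swap : ∀ a b c → a + c + b ≡ a + b + c
      swap = solve 3 (λ a b c → a :+ c :+ b := a :+ b :+ c) refl

    module _ {y z : Carrier} (yz : y * z ≡ 1#) where

      reverseOnto-sound : ∀ p acc →
        ⟦_⟧ y (reverseOnto p acc) ≡ y ^ length p * (⟦_⟧ y acc + z * ⟦_⟧ z p)
      reverseOnto-sound []      acc =
        solve 2 (λ a z → a := con (1 , 0) :* (a :+ z :* con (0 , 0))) refl (⟦_⟧ y acc) z
      reverseOnto-sound (a ∷ p) acc = trans (reverseOnto-sound p (a ∷ acc)) (trans
        (cong₂ (λ t u → y ^ length p * (t + y * ⟦_⟧ y acc + u)) (insert ⟦ a ⟧ₑ) (insert (z * ⟦_⟧ z p)))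
        (regroup (y ^ length p) y z ⟦ a ⟧ₑ (⟦_⟧ y acc) (⟦_⟧ z p)))
        where
        insert : ∀ x → x ≡ y * z * x
        insert x = trans (sym (*-identityˡ x)) (cong (_* x) (sym yz))
        regroup : ∀ n y z a s p → n * (y * z * a + y * s + y * z * (z * p)) ≡ y * n * (s + z * (a + z * p))
        regroup = solve 6 (λ n y z a s p → n :* (y :* z :* a :+ y :* s :+ y :* z :* (z :* p)) :=
          y :* n :* (s :+ z :* (a :+ z :* p))) refl

      shift-sound : ∀ n p → ⟦_⟧ y (replicate n 0ₑ ++ p) ≡ y ^ n * ⟦_⟧ y p
      shift-sound zero    p = sym (*-identityˡ _)
      shift-sound (suc n) p = trans (cong₂ _+_ ⟦0⟧ₑ (cong (y *_) (shift-sound n p)))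
        (trans (+-identityˡ _) (sym (*-assoc y _ _)))

      reciprocal-sound : ∀ p → ∃ λ w → w ≢ 0# × (w * (w * w)) * ⟦_⟧ z p ≡ ⟦_⟧ y (reciprocal p)
      reciprocal-sound []      = 1# , 1≢0 , zeroʳ _
      reciprocal-sound (a ∷ p) = y ^ n , ^-nonzero n y≢0 , sym (begin
        ⟦_⟧ y (reciprocal (a ∷ p))
          ≡⟨ shift-sound (2 ℕ.* n) (reverseOnto p (a ∷ [])) ⟩
        y ^ (2 ℕ.* n) * ⟦_⟧ y (reverseOnto (a ∷ p) [])
          ≡⟨ cong (y ^ (2 ℕ.* n) *_) (reverseOnto-sound (a ∷ p) []) ⟩
        y ^ (2 ℕ.* n) * (y * y ^ n * (0# + z * v))
          ≡⟨ cong (_* (y * y ^ n * (0# + z * v))) (trans (cong (λ k → y ^ (n ℕ.+ k)) (ℕ.+-identityʳ n)) (^-homo-* y n n)) ⟩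
        (y ^ n * y ^ n) * (y * y ^ n * (0# + z * v))
          ≡⟨ regroup (y ^ n) y z v ⟩
        (y * z) * ((y ^ n * (y ^ n * y ^ n)) * v)
          ≡⟨ trans (cong (_* ((y ^ n * (y ^ n * y ^ n)) * v)) yz) (*-identityˡ _) ⟩
        (y ^ n * (y ^ n * y ^ n)) * v ∎)
        where
        open ≡-Reasoning
        n = length p
        v = ⟦_⟧ z (a ∷ p)
        y≢0 : y ≢ 0#
        y≢0 y≡0 = 1≢0 (trans (sym yz) (trans (cong (_* z) y≡0) (zeroˡ z)))
        regroup : ∀ n y z v → (n * n) * (y * n * (0# + z * v)) ≡ (y * z) * ((n * (n * n)) * v)
        regroup = solve 4 (λ n y z v → (n :* n) :* (y :* n :* (con (0 , 0) :+ z :* v)) :=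
          (y :* z) :* ((n :* (n :* n)) :* v)) refl

-- Values and colors of particular polynomials

AllColors : ∀ {q} {K : FiniteField q} (X : CubicCharacter K) →
  (Polynomial → FiniteField.Carrier K) → List Polynomial → Coloring → Set
AllColors X f ps       []      = ⊤
AllColors X f []       (_ ∷ _) = ⊥
AllColors X f (p ∷ ps) (m ∷ κ) = HasColor X (f p) m × AllColors X f ps κ

allColors : ∀ {q} {K : FiniteField q} (X : CubicCharacter K) f ps κ → AllColors X f ps κ →
  ∀ d → HasColor X (f (nth [] ps d)) (nth nothing κ d)
allColors X f ps       []      h       d       = tt
allColors X f (p ∷ ps) (m ∷ κ) (h , _) zero    = h
allColors X f (p ∷ ps) (m ∷ κ) (_ , h) (suc d) = allColors X f ps κ h d

module _ {q} {K : FiniteField q} (X : CubicCharacter K) (R : CubeRoot K) where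
  open FiniteField K
  open CubicCharacter X
  open CubeRoot R
  open Evaluation K R
  open Solver K using (solve; _:*_; _:-_; _:+_; :-_; _:=_; con)

  ⟦n⟧ₑ : ∀ n → ⟦ n , 0 , 0 ⟧ₑ ≡ n ⋆ 1#
  ⟦n⟧ₑ n = solve 3 (λ n w v → n :+ con (0 , 0) :* w :+ con (0 , 0) :* v := n) refl (n ⋆ 1#) ω (ω * ω)

  ⟦ω⟧ₑ : ⟦ 0 , 1 , 0 ⟧ₑ ≡ ω
  ⟦ω⟧ₑ = solve 2 (λ w v → con (0 , 0) :+ (con (1 , 0) :+ con (0 , 0)) :* w :+ con (0 , 0) :* v := w) refl ω (ω * ω)

  ⟦-1⟧ₑ : ⟦ 0 , 1 , 1 ⟧ₑ ≡ - 1#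
  ⟦-1⟧ₑ = +-cancelˡ 1# _ _ (trans (solve 2 (λ w v → con (1 , 0) :+ (con (0 , 0) :+ (con (1 , 0) :+ con (0 , 0)) :* w :+ (con (1 , 0) :+ con (0 , 0)) :* v) := con (1 , 0) :+ w :+ v) refl ω (ω * ω))
    (trans 1+ω+ω² (sym (-‿inverseʳ 1#))))

  ⟦const⟧ : ∀ y c → ⟦_⟧ y (c ∷ []) ≡ ⟦ c ⟧ₑ
  ⟦const⟧ y c = solve 2 (λ c y → c :+ y :* con (0 , 0) := c) refl ⟦ c ⟧ₑ y

  ⟦linear⟧ : ∀ y c → ⟦_⟧ y (c ∷ 1ₑ ∷ []) ≡ ⟦ c ⟧ₑ + y
  ⟦linear⟧ y c = cong (⟦ c ⟧ₑ +_) (trans (cong (y *_) (trans (⟦const⟧ y 1ₑ) ⟦1⟧ₑ)) (*-identityʳ y))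

  ⟦shift⟧ : ∀ y p → ⟦_⟧ y (0ₑ ∷ p) ≡ y * ⟦_⟧ y p
  ⟦shift⟧ y p = trans (cong (_+ y * ⟦_⟧ y p) ⟦0⟧ₑ) (+-identityˡ _)

  ⟦y⟧ : ∀ y → ⟦_⟧ y (0ₑ ∷ 1ₑ ∷ []) ≡ y
  ⟦y⟧ y = trans (⟦linear⟧ y 0ₑ) (trans (cong (_+ y) ⟦0⟧ₑ) (+-identityˡ y))

  ⟦-⟧ : ∀ y → ⟦_⟧ y ((0 , 1 , 1) ∷ 1ₑ ∷ []) ≡ - (1# - y)
  ⟦-⟧ y = trans (⟦linear⟧ y (0 , 1 , 1)) (trans (cong (_+ y) ⟦-1⟧ₑ)
    (solve 1 (λ y → :- con (1 , 0) :+ y := :- (con (1 , 0) :- y)) refl y))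

  colored : ∀ {x y m} → x ≡ y → HasColor X y m → HasColor X x m
  colored refl h = h

  -- Otherwise x = -u would have the color of u, as -1 has color 0.
  sum-nonzero : ∀ {x u} → u ≢ 0# → χ x ≢ χ u → u + x ≢ 0#
  sum-nonzero {x} {u} u≢0 χ≢ e = χ≢ (trans (cong χ (+-cancelˡ u _ _ (trans e (sym (-‿inverseʳ u))))) (χ-neg u≢0))

  neg-one : HasColor X ⟦ 0 , 1 , 1 ⟧ₑ (just 0F)
  neg-one = colored ⟦-1⟧ₑ (neg-nonzero 1≢0 , trans (χ-neg 1≢0) χ-1)

  ⟦⟧ₑ-* : ∀ x y {a b} → HasColor X ⟦ x ⟧ₑ (just a) → HasColor X ⟦ y ⟧ₑ (just b) → HasColor X ⟦ x *ₑ y ⟧ₑ (just (a ⊕ b))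
  ⟦⟧ₑ-* x y (x≢0 , χx) (y≢0 , χy) = colored (*ₑ-hom x y)
    (*-nonzero x≢0 y≢0 , trans (χ-* x≢0 y≢0) (cong₂ _⊕_ χx χy))

  -- `(2 , 0 , 1)` is 1 - ω and `(2 , 1 , 0)` is 1 - ω²; their product is 3.
  θ≢0 : 3 ⋆ 1# ≢ 0# → ⟦ 2 , 0 , 1 ⟧ₑ ≢ 0#
  θ≢0 3≢0 e = 3≢0 (trans (sym (⟦n⟧ₑ 3)) (trans (reduce-sound (5 , 2 , 2))
    (trans (*ₑ-hom (2 , 0 , 1) (2 , 1 , 0)) (trans (cong (_* ⟦ 2 , 1 , 0 ⟧ₑ) e) (zeroˡ _)))))

-- Planes for χ(ω) = 0

-- Numbered from 0: 1, -1, ω, 1 - ω, 2, y; then y - u for the six units u; then the factors y² + 1,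
-- y² + ω, y² + ω² of y⁶ + 1; finally y⁴ + 1.
gens₂ : List Polynomial
gens₂ =
  (1ₑ ∷ []) ∷ ((0 , 1 , 1) ∷ []) ∷ ((0 , 1 , 0) ∷ []) ∷ ((2 , 0 , 1) ∷ []) ∷ ((2 , 0 , 0) ∷ []) ∷
  (0ₑ ∷ 1ₑ ∷ []) ∷
  ((0 , 1 , 1) ∷ 1ₑ ∷ []) ∷ (1ₑ ∷ 1ₑ ∷ []) ∷
  ((1 , 0 , 1) ∷ 1ₑ ∷ []) ∷ ((1 , 1 , 0) ∷ 1ₑ ∷ []) ∷
  ((0 , 1 , 0) ∷ 1ₑ ∷ []) ∷ ((0 , 0 , 1) ∷ 1ₑ ∷ []) ∷
  (1ₑ ∷ 0ₑ ∷ 1ₑ ∷ []) ∷ ((0 , 1 , 0) ∷ 0ₑ ∷ 1ₑ ∷ []) ∷ ((0 , 0 , 1) ∷ 0ₑ ∷ 1ₑ ∷ []) ∷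
  (1ₑ ∷ 0ₑ ∷ 0ₑ ∷ 0ₑ ∷ 1ₑ ∷ []) ∷
  []

open Substitution gens₂ using (transform)

-- These belong to y ↦ -ω y, ω ↦ ω² and y ↦ 1/y. `rotation` has no row for generator 15, because y⁴
-- + 1 becomes ω y⁴ + 1, which is not among the products of generators; its color is unknown after a
-- rotation. The factors 5 in `inversion` come from multiplying a polynomial of degree n at 1/y by
-- the cube y³ⁿ.
rotation conjugation inversion : List (List ℕ)
rotation = [] ∷ (1 ∷ []) ∷ (2 ∷ []) ∷ (3 ∷ []) ∷ (4 ∷ []) ∷ (1 ∷ 2 ∷ 5 ∷ []) ∷
  (1 ∷ 2 ∷ 11 ∷ []) ∷ (1 ∷ 2 ∷ 9 ∷ []) ∷ (1 ∷ 2 ∷ 7 ∷ []) ∷ (1 ∷ 2 ∷ 10 ∷ []) ∷ (1 ∷ 2 ∷ 6 ∷ []) ∷ (1 ∷ 2 ∷ 8 ∷ []) ∷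
  (2 ∷ 2 ∷ 13 ∷ []) ∷ (2 ∷ 2 ∷ 14 ∷ []) ∷ (2 ∷ 2 ∷ 12 ∷ []) ∷ []
conjugation = [] ∷ (1 ∷ []) ∷ (2 ∷ 2 ∷ []) ∷ (1 ∷ 2 ∷ 2 ∷ 3 ∷ []) ∷ (4 ∷ []) ∷ (5 ∷ []) ∷
  (6 ∷ []) ∷ (7 ∷ []) ∷ (9 ∷ []) ∷ (8 ∷ []) ∷ (11 ∷ []) ∷ (10 ∷ []) ∷
  (12 ∷ []) ∷ (14 ∷ []) ∷ (13 ∷ []) ∷ (15 ∷ []) ∷ []
inversion = [] ∷ (1 ∷ []) ∷ (2 ∷ []) ∷ (3 ∷ []) ∷ (4 ∷ []) ∷ (5 ∷ 5 ∷ []) ∷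
  (1 ∷ 6 ∷ 5 ∷ 5 ∷ []) ∷ (7 ∷ 5 ∷ 5 ∷ []) ∷ (1 ∷ 2 ∷ 9 ∷ 5 ∷ 5 ∷ []) ∷ (1 ∷ 2 ∷ 2 ∷ 8 ∷ 5 ∷ 5 ∷ []) ∷
  (2 ∷ 11 ∷ 5 ∷ 5 ∷ []) ∷ (2 ∷ 2 ∷ 10 ∷ 5 ∷ 5 ∷ []) ∷
  (12 ∷ 5 ∷ 5 ∷ 5 ∷ 5 ∷ []) ∷ (2 ∷ 14 ∷ 5 ∷ 5 ∷ 5 ∷ 5 ∷ []) ∷ (2 ∷ 2 ∷ 13 ∷ 5 ∷ 5 ∷ 5 ∷ 5 ∷ []) ∷
  (15 ∷ 5 ∷ 5 ∷ 5 ∷ 5 ∷ 5 ∷ 5 ∷ 5 ∷ 5 ∷ []) ∷ []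

-- Inversion requires y ≠ 0, which a coloring guarantees only if it gives y a color. Otherwise all
-- colors are forgotten, which is always sound.
invert : Maybe (Fin 3) → Coloring → Coloring
invert nothing  κ = []
invert (just _) κ = transform inversion κ

iterate : {A : Set} → ℕ → (A → A) → A → A
iterate zero    f x = x
iterate (suc n) f x = iterate n f (f x)

-- The number r + 6 s + 12 t stands for y ↦ (-ω)ʳ y, followed by s complex
-- conjugations and t inversions.
act₂ : ℕ → Coloring → Coloring
act₂ n κ = iterate (n / 12) (λ κ → invert (nth nothing κ 5) κ)
  (iterate ((n / 6) % 2) (transform conjugation) (iterate (n % 6) (transform rotation) κ))

table₂ : List SymbolicPlane
table₂ =
  map decode (
  0x105281062880B41442020C102CC210406288205A90602D482840B52008314A1020C5020C6281062884102D061040831820598A2081662940B418A102D2508105018A5 ∷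
  0x5A4C302D29188405A503100C518C0828C62024A318840398C31080939862020E61812930841024C602926188404A1021014840C42081083040941C621040B4A4621012518C4202928184094184102528 ∷
  0x16A3080B3084102CC51040A41842029062816A41820518A51040B518A2028C50816A514405AD421040B51CC2081652884101CC51080A2880B314A05A8C51080B498A202D462840B514205A8A5 ∷
  0x25030290310105188404A040418410206042041020A3081280146310123104081884031462020C2101261040830C4102062081051880A40C204946030C42 ∷
  0x498621012628C40524C310406314621014828C621040949461029063040A4A0C0520C31080A4A0C21040B4A4C20812731820524C61040A314631040A420C20292518C0A4A101029293014940C2052506101494A041 ∷
  0xB5A8405A8A51080B520C21040B2944102CA21040B51440598A102D4602CC20814628841028A05A8A2101483144202CC52884101CC51016B514420816A2840B518A21016A081483080A29441 ∷
  0x29261884102526208404A0C20292620C4202D4918C420814948C405A4C41812830C61029261884041CC30814730C62024E620C41020C610820498C40814630C094A00B4A0620812831040525030814830C410290818841 ∷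
  0x30244208102100C2080A21040A0810200C42024410290102D2018809280A310408284051040B080C210407080E6080E5 ∷
  0xB41C0B3880B394204204041408388404A0A210107288082940A41C4208107104083984201C41014420810101CA041CA2100E528841020E50810730107 ∷
  0xB5240A29461028E61040A5142051CA051461028E52816A49C2051C4102D272840B494605A92501CA31040A3944101CE51014728C0A398A0520E5081483840B49C40394A3 ∷
  0xC31082041862080C51880830C061880628C204182049840398604A00A40C2041841020A31080830C4208103108203986210409304083084049861024A302461 ∷
  0x28E518C40524A31080A41462081472904201CE52082049CA41880B51CE2029083882051CA210407398C2080E628C4208149398402946302D4510407394404A0A31812839C405A9281040839461024E51880739463 ∷
  0x628820314A2101262884101CC508127300E61080929409284093142049440294620810510820494A2101262880A4940941842081205A4A21012608125108205A441 ∷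
  0x2CC20810610820314205AC42081651040B4040B081660816502C42081651080B30841004051040B101051040B48806108205946102D4059C41 ∷
  0x18A0300E6081461080B4884101462100C1018A2024C2080E610820308403144201841018A2101261082040841020A210106108204942049809 ∷
  0x1281082049442024204082041841020A2020C21010210105108203980B4880A408404982039842080C51040628106080C2081480812501842 ∷
  0x18A5018A2028C5080A0294203140B5040B518205A8A059806100C6080E6101451040B10806288403014610820318A102D26020C1 ∷
  0x2D683080A41CC20810628C621016A4184102D06188205A0E6101661840B314621016830C420816928C4102D484080B398C20814828C420814830C205A90310408398621016730C40398A302D061840B414605A061 ∷
  0x290208149108205182052041029221040A3040A49042081462040A41041024C3108051814A1884101CC21040A38C41024E2029020814910820518205A86102CC208169 ∷
  0x51040628820294404944208145108051080628840288402944208122100C2080A3100E61040528C405204202CA20144041441014201040A ∷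
  0xB41840594A20816B08166288205A44102D48101651080B1082059842080A5020C51016B2882028840594403144102C0B3840B281680810602041 ∷
  0x41CC21040B4184102906080C5188405A522081484080A49841024E6081693084102D2910105180E63082052102080E63080928C404146049462018A31080B4A020525021040941C41 ∷
  0xB524C21040A398C0518A5188405A92902D49408405A9261016A48C4202D4930C4202D4928C420816930C0B49CC102D49300E628C20520A3108205A4A31040A520C21016A49842081461840B524C102D2628C420816B49842 ∷
  0x520C0930C420816718840418831016620C603188308166208205A0821016B20C4059882100C418820398821040B30C420816618C20598831040B30C6059884101661040B5106102C831082059883 ∷
  0x528C08288092840730802014A208148108202946210169020A2101251040528C4028C42081221010101442014A210406288402942031405 ∷
  0x2D451884102D461080B524205A8C31080A30C42029061884102CC308165188205A8621040628C60518A310820598A31080A5180B5182051862081473040730C4059CC050C205146051861 ∷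
  0x292508127281251840A3940A38841029270814528840524A21040A28820498A21040929420524A20812501CA101441024E2029281080B4944208149081251040948841 ∷
  0x20E6280E51040B394A1029051080B4144208105184082946210408394A102D052810730408384083940B38840594A2101694084102CA0520A0394A102D282840B520E05A041 ∷
  0xC5024A2080A518407314205A4A028C20294A029420314A100406080A052041020A508128300C5100A2014A208105080E602441 ∷
  0x105024403982031441024A201460398405A42029460188081040610062101481040B4880608100184062840A40121 ∷
  0x40C051880B1884040C4028C4202C6028C4101C61020621040910102080621040610820188410204201862100A30286200C20400C1 ∷
  0x1462104081080608062100C31040B1880B18840180C31082038C051880818840488061082050C410184101461020061840518061 ∷
  0x3108204840601842080A21004208125080E602042080A51884101CC210148081051080518841018A210405014A1018A0081691082029442 ∷
  0x1040508140280C5014A1018201840802D22100A510820028A2104052010510807280E6080E102D2102902100A518841 ∷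
  0x28C4188405148418841028E418840524C418820398C418806290631080A39884101473100A398831040A39841028C61884102D462040A39C621040B51C831040A39863080E520C4101CE62040A49C80398830814730C42020E618841 ∷
  0x494A029462100C5284092884028C4031442081220250608169280C1020A21040B4884031420414051840928102100E608148284073140518841 ∷
  0x14420804102C42014A2080C5100A20290202842028A208162014410040710407308203944030820488030142028C4029041 ∷
  0x20E5180E628C420816728C62101083986202D0730C6041CC61840B41CC41040B4A0E102D6838C405AD060810628C62081483980B31462081673986202D2830C4102D6730C0B41CC202CE63040B520E308168290621040B420C3 ∷
  0xA41CE31040A418C31014829083101483980A41CC40290730C621016839882020E520C205210720820398A420C420294730C410210730C40518A41814A418820814939882029283106041CC620C20418A418C4102D4839061028E520C620814739883 ∷
  0x418A3080E630C0930C4102D061810518C420814840C20398C30812628C0830C42024C6104084184031463104094980628C62081063040928C605A5230814930C0940C204A0C102508 ∷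
  0x308410186101882080E2104072082038C20590410188101482104062080610806180C4081440104201483010610188308104080C41082049041 ∷
  0x2D441040B5884102D23080A4208204988059C81025242084102924188404A082080A420C605AC841080A390821040B58C620812910808310821040B48C093906202523188205A4830816820C420816620C41 ∷
  0x2D4938C0B5A8E21016A51C8202D28388405A5272016A49C6102D2520C420816A4A48202D27310410292520C41029293884102D493084051CA42080B3948210127290605A8E72016A4A08102D452040B524E41840A4A0E41040A49CC4 ∷
  0x5A50102D2828169418205A5050816941CA05A5052840B49CA302D273080B4A0E101CC6288082946102D2928820520C502D2829020420E502D283140B49CC508169314420816941CC1020E610408398A5 ∷
  0x5A8E30814720C42029271816A20C0B5148302D4720C205A94402D471080B5186102CE72082059CA41840B51C8039CC41840A29063108205AD2418147290605A8E410147390205A8E30816838C0B39062 ∷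
  0x59CE620C0B398C41080B49CC42080B3148308169290831082059CA418C41024C520C62024E63106102D28310604A4E6188405ACE61884101CC52106202D27308205A9262084102D2630C4202D28390420812729061024E73104202D493906102D2730C605A4E718841 ∷
  0x4A08308128410094188102528208204A0C21040941C61020C620106290610250620820314831880B4A4830814841060498C410128310420252620128308405A0C3021062080941861024C520C0A49861 ∷
  0x2D494148302D693146102D293946102D494146102D49414A302D49418A30814829463029083946102D4941460529083980B529283040A520C51840B49CE63040B494A3188405AD494A00B49CC528C0A41CC528C20398A518C405A9283946102D49420E05A92839841 ∷
  0xA40144201461018201080A00405080E0080E0284091040B1008101840100A20810101803 ∷
  0x292730C621040A49CC102927310204A0E61882049CA41814939C6201CC520C40528E620C2049CC620C0A3148310820524C61880B51CC31040A524C4101693988208126290631014941C820814729063081473188202D49390610292931060524A420C41 ∷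
  0x28E61814518C4102D481840A30C42020C310806290621040A418420814831020520C3029061014628C41028C610820520A31040A40C40520C31010518408398420814940840418C30814830C420810628C41 ∷
  0x1672016B1080B48C205AC841080B410621040B51040290831812720C405988310409490821040521041028E4208404A44202D631882041884108205A460524831080948C6202D24184093100941041 ∷
  0x5A9241040B2906210167310405290410820524E21016A30840514831040B52081028E62014A41042028A41880B51882104072906101CE62084102927208405A0E21040B518420816B4904202D471840A41C820814938841 ∷
  0x738128384072940C38407394A04A0E6080E5280E5080E62840528409400E102505080E5014A502507280E52942039CA1030E5080A04A0A5 ∷
  0x6294A06140B51CA10250601CE6080C502507304073140C39807398A0314A10250628407280E101CC101CA5080E629420394A501CC628407314A0398A1 ∷
  0xE62840731807300C52900C31407398A1030A4080E7280C6280E5290073148101CA4080E73040C300C520187301872840C380E629420398A0398C5 ∷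
  0x16A2816B1040B398202840528820594403144202CC5080C528167314206ACA05944202D28301061010629420581650816602CA50816629420594A5 ∷
  0x12839C094A1010250508128394204A0E60250702506025052040941C0C2840C39C0C4A020294204A0070812829409418A102505081283942039CA0394A5 ∷
  0x316839842081883080C420C51080C59CC1030E629441031073184059CC52884102D28398A21018B398A21040B520E72882062D483880B520E61018C41440618A50818B49CA208188314A208107314A510106314A208188398A1031683940C41CA2 ∷
  0x520A102D482840A420A05A9021040B5250602D4A414205A506101073144102906101CB288205A8A210168294405A8E50816A4A00B5040B5250502D28314205A5051080A418A5081452880B514A5 ∷
  0x29451040528840498A2028A52840A4A0A051CA1025062812629040524C5081C93040E5280E288204A4C6024C52840A4984102525025051080931440524A30814A498205A929 ∷
  0xA49CC21040E51CC21040A39CC51080E51C420394A3940E524E6081CA2880A494A2081472840E5A4A2039273082072921038E6281CA39442038E52880E51CC503949294207290510820524E6294204A0E62880E49CC5 ∷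
  0x169308205A8E610820598A51080B50840294A21040C3084029442080C52880B29441030C52884102D4941842018420816A314A21016A2944202D4529442080C629442018A510806294A210406294205A4C528841018A529442 ∷
  0x2D28398A502D28398420396941CC1020A5294420390528808398A5039052884103905294A1039C82940E294A21016A394A2104082944103967081C81040E2940E41CC203905281CE40840720E62942072CE52940E394A2 ∷
  0xE418A202D2831441020C5101CB3140E398A2081C8314610396730840720C0718A51082072D02081CB4144072D061040B414A21040B51CC51082072D2510808398C5039073040B41CC0720C5081C82884072905 ∷
  0x30A0618A20818A28806294A05A8C528186294203140C294205A8E5030C1030C6081862818A30840520C5108205A8C1031462818631420618A21018B5142062D4062D46 ∷
  0xA4206210108301284084101CC618841025271814838C621016930C2052503024A31884049CC31040628C61029061880931809498420814930C420252820149410610250620820525030816948C420312318841 ∷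
  0x16A414410290510820520C5101692880C598420816A5204202D263080B51842081662944102CC520841035681040B5A922020E630820398A102D673080A418C21040B51CC1031461040B520C102D06108205A0C6 ∷
  0xA420A21040A520A2101482902072902101481040A414A21040E501452902052900714810390510820728A2101052900A4202072020520A102945028A41040A414204148202105 ∷
  0x2D49414A21040A414A528820629052840B52505288205A928294A502D6A4A5052840B5A9294080C5A9281080B525052818B488205A4A50816A4A04208187314A2081482944202D25294A20398A414A07316A4A020731481040C5A9282942062D252884103169294A5 ∷
  0x16941C205A4E702D271080B41CE21040D41C41025083840B41C205A5071040B41CA202D281040B4A1021016941C42081AB4882059CE6101682884049CA208128394405A4E51040941C205A5051014942041 ∷
  0x16A4A0C502D262840D5A4C50816A481AB5240B52928081AB5080D5A8A5081AB5A9206B5421040A4A5061080B5A8A203527308406AD206A925108206AD290356A3840D594420356A4A0206A928301AA4A041 ∷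
  0xC5014052840A00840304073080528840680C5104051080B288051040201840081C2014A2080E60814502C41 ∷
  0xE62840B2940A2884102CE502CE202D47080A5100A201CA2081451040829420714052840B280A21040B4884102042018A2100E1024A2081C2 ∷
  0x384208169080A51040308148104073080D5A441034A5101A21040E520401882061CC208148080E600C42080A5180E62944102905288052840C108205A441 ∷
  0x1CA501CC5280E529420398205A442014A310820301850816A380A4080E5018A102D472818730407081482942041442081283140B29420398A051442 ∷
  0xD49CC6201A7314841040D59CE62040D4A4E61080D5A4E7108206A4E52040B5A5273084102D4941CC4081AB49CC302D2831482101A93148310129398A41040D598A40356B398420356931842081AB394831016A49CA41080B59CC5208206AD49390206AD283100D5A4A420841 ∷
  0x30E6000A529420380E5080E6030A1018A52840B51CA0394A0604094182029420280C5014A1018A5080A5280E629420614A029481 ∷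
  0xA4A0E630149398A21040D524E608128318A2101A9418420814941842035883080D520E61080D4A0C60354A4204102949414405A948398406A9251880D498A41080D4A0A06A9261080D520C5101AA398C2081AA4A0C10356A4A00D52502 ∷
  0x5A948108205A4A20818B30840520A21018A308205AD4910146288205AD461080A418C21040D5184203949108205A8A310409398C21040731420528E61080B498C20816A51840598A21040B51CC1028C520820524C6 ∷
  0x1C8181483080B42020418A30816828C0828C405A0C3108205AD031080B40C0B59862080C51810630C40598C202D060816628C0B4A04102D481880B4184202D071840B5A46059463 ∷
  0x5A0831040840C62029030816718C4049C6041C831080930C62028C41884059860528821016721042038831880A5084028C62101671082052060524831014A18C41029041840B5100A39041 ∷
  0x5AD4A39842081AA3148202929418C2101AA418C2101AA3040D5A8C51082069CC508169318A0518A5201AB494410356A52042081AC59842039AA488410354A3984203548288406A926288406AD26081A9398C21040B524C102D4A494420356A48841 ∷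
  0x1A5281CA4040C1040E29440730410384072902101A2101852884103840714A0734207084073042081C5288407300E294207040C398202946203969 ∷
  0x398A3940E528E72880E524E6288407B947081AB524E73018A394A2081ED4980C498A51080E52507318207A4C5108207A8E51040F61420524E62942073549398207A927301AA49CC51040D624C5081A9498C51082062927314205A927398A21040A4A0E631441 ∷
  0x1AB41CC51040E6AD073040D5A5073180B41CC52816941CC62884103968398A2101E831440620C52880B520E73144103D850356B39CA2101C8418C5101ED59C207AD07301EB39442081CB520E7301CC418A103DC83040C5A0E62840D62CE50316729442 ∷
  0x352602D49404094944103C20394A50250608185024C51080A394404A0A40818940128318204A0A029407394204A0A502506284094142049CC50812728C204A0E5 ∷
  0x1AB41CC51040E6AD073040D5A5073180B41CC52816941CC62884103968398A2101E831440620C52880B520E73144103D850356B39CA2101C8418C5101ED59C207AD07301EB39442081CB520E7301CC418A103DC83040C5A0E62840D62CE50316729442 ∷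
  0x398A3940E528E72880E524E6288407B947081AB524E73018A394A2081ED4980C498A51080E52507318207A4C5108207A8E51040F61420524E62942073549398207A927301AA49CC51040D624C5081A9498C51082062927314205A927398A21040A4A0E631441 ∷
  0x4A0A2080A510407394405A9281040E41840420A10250630809414820312810409418404A0404A0A2080E203C41025062880B3940831442030A2020E51840941C41020E6 ∷
  [])

tree₂ : Tree
tree₂ =
  br 8 (br 9 (br 7 (br 10 (br 11 (br 3 (lf 12 39) (lf 0 35) (br 4 (br 12 (br 13 (br 14 (lf 0 82) (lf 0 79)
  (lf 0 61)) (br 14 (lf 6 79) (lf 12 72) (lf 0 61)) (lf 6 61)) (lf 14 68) (lf 0 55)) (br 12 (lf 0 75) (lf 0
  55) (lf 12 65)) (br 12 (lf 12 77) (br 13 (lf 18 78) (br 14 (lf 12 78) (lf 12 72) (lf 0 61)) (lf 6 61)) (lf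
  12 65)))) (br 3 (lf 18 29) (lf 18 28) (lf 1 4)) (lf 12 5)) (br 11 (br 3 (lf 12 29) (lf 12 28) (lf 1 4)) (br
  3 (lf 12 32) (lf 0 32) (br 4 (br 12 (br 13 (lf 6 69) (lf 6 69) (lf 6 64)) (lf 14 68) (lf 0 55)) (lf 12 34)
  (br 13 (lf 0 76) (br 12 (lf 6 69) (br 14 (lf 6 76) (lf 0 83) (lf 0 64)) (lf 0 62)) (lf 6 64)))) (lf 19 5))
  (lf 17 5)) (br 10 (br 11 (br 3 (br 4 (br 12 (lf 0 55) (lf 0 53) (lf 12 54)) (br 12 (br 13 (br 14 (br 15 (lf
  0 85) (lf 0 84) (lf 12 86)) (lf 0 63) (lf 12 67)) (lf 6 63) (lf 18 67)) (lf 0 53) (lf 12 54)) (br 12 (lf 0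
  57) (lf 0 53) (lf 12 54))) (br 4 (br 12 (lf 0 55) (lf 0 53) (lf 12 54)) (br 12 (br 13 (lf 12 80) (lf 6 63)
  (lf 18 67)) (lf 0 53) (lf 12 54)) (lf 12 23)) (br 4 (br 12 (lf 0 55) (lf 0 53) (lf 12 54)) (br 12 (br 13
  (lf 6 81) (lf 6 63) (lf 18 67)) (lf 0 53) (lf 12 54)) (lf 0 49))) (br 3 (br 4 (br 12 (lf 0 55) (lf 0 53)
  (lf 12 58)) (br 12 (lf 0 62) (lf 0 53) (lf 12 58)) (br 12 (lf 0 57) (lf 0 53) (lf 0 57))) (br 4 (br 12 (lf
  0 55) (lf 0 53) (lf 12 58)) (lf 6 42) (lf 6 34)) (lf 6 27)) (lf 12 16)) (br 3 (br 11 (br 4 (br 12 (lf 0 55)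
  (lf 0 53) (lf 18 58)) (br 12 (lf 6 62) (lf 0 53) (lf 18 58)) (br 12 (lf 0 57) (lf 0 53) (lf 0 57))) (br 4
  (br 12 (lf 0 55) (lf 0 53) (lf 0 54)) (lf 0 51) (br 12 (lf 0 57) (lf 0 53) (lf 0 54))) (lf 1 4)) (br 4 (br
  11 (br 12 (lf 0 55) (lf 0 53) (lf 18 58)) (br 12 (lf 0 55) (lf 0 53) (lf 0 54)) (br 12 (lf 0 55) (lf 0 53)
  (lf 12 54))) (br 11 (lf 0 42) (lf 0 52) (lf 6 33)) (br 11 (lf 0 34) (lf 12 50) (br 12 (lf 0 57) (lf 0 53)
  (lf 12 54)))) (br 11 (lf 0 27) (br 4 (br 12 (lf 0 55) (lf 0 53) (lf 0 54)) (br 12 (br 13 (br 14 (lf 0 74)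
  (lf 1 74) (lf 6 71)) (br 14 (lf 0 74) (lf 0 72) (lf 6 71)) (lf 0 71)) (lf 0 53) (lf 0 54)) (br 12 (lf 0 57)
  (lf 0 53) (lf 0 54))) (br 4 (br 12 (lf 0 55) (lf 0 53) (lf 12 54)) (br 13 (lf 1 54) (lf 13 53) (lf 13 57))
  (lf 19 33)))) (br 11 (lf 18 16) (br 3 (lf 1 4) (br 4 (br 12 (lf 0 55) (lf 0 53) (lf 12 54)) (lf 0 33) (br
  12 (lf 0 57) (lf 0 53) (lf 12 54))) (br 4 (br 12 (lf 0 55) (lf 0 53) (lf 12 54)) (br 14 (lf 5 54) (lf 17
  53) (lf 17 57)) (lf 17 33))) (br 3 (lf 5 10) (lf 12 19) (br 4 (lf 0 37) (lf 13 36) (lf 2 38))))) (br 10 (br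
  11 (lf 12 20) (br 3 (lf 1 1) (br 4 (lf 5 18) (lf 5 18) (lf 5 18)) (lf 15 24)) (br 3 (lf 12 4) (lf 1 4) (br
  4 (lf 3 11) (lf 3 11) (lf 3 11)))) (br 11 (br 3 (lf 11 1) (br 4 (lf 3 18) (lf 3 18) (lf 3 18)) (lf 15 24))
  (br 3 (lf 0 31) (br 4 (lf 12 43) (lf 15 44) (lf 0 48)) (br 4 (lf 3 43) (lf 15 48) (lf 0 44))) (lf 1 0)) (br
  11 (br 3 (lf 16 4) (lf 1 4) (br 4 (lf 9 11) (lf 9 11) (lf 9 11))) (lf 3 0) (lf 0 2)))) (br 3 (br 10 (br 7
  (br 11 (lf 10 1) (lf 0 1) (lf 19 16)) (br 11 (br 4 (br 12 (lf 0 55) (lf 12 53) (lf 0 66)) (br 13 (lf 12 60)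
  (lf 12 60) (lf 12 60)) (lf 12 47)) (lf 6 1) (lf 3 1)) (br 11 (lf 4 1) (lf 0 31) (lf 3 14))) (br 7 (br 11
  (br 4 (lf 0 45) (lf 6 46) (lf 6 41)) (br 4 (br 12 (lf 6 66) (lf 0 53) (lf 0 55)) (lf 0 47) (br 14 (lf 0 60)
  (lf 0 60) (lf 0 60))) (lf 12 22)) (br 11 (br 4 (lf 3 45) (lf 0 41) (lf 18 46)) (lf 2 1) (lf 6 5)) (br 11
  (lf 0 21) (lf 8 1) (lf 3 14))) (br 7 (br 11 (lf 18 5) (lf 2 1) (lf 0 13)) (br 11 (lf 0 22) (lf 11 16) (lf
  12 13)) (br 11 (lf 9 14) (lf 9 14) (lf 3 14)))) (br 11 (br 4 (br 7 (br 10 (lf 2 18) (lf 2 18) (lf 2 18))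
  (br 10 (lf 2 18) (lf 2 18) (lf 2 18)) (br 10 (lf 2 18) (lf 2 18) (lf 2 18))) (br 7 (br 10 (lf 2 18) (lf 2
  18) (lf 2 18)) (br 10 (lf 2 18) (lf 2 18) (lf 2 18)) (br 10 (lf 2 18) (lf 2 18) (lf 2 18))) (br 7 (br 10
  (lf 2 18) (lf 2 18) (lf 2 18)) (br 10 (lf 2 18) (lf 2 18) (lf 2 18)) (br 10 (lf 2 18) (lf 2 18) (lf 2
  18)))) (br 10 (br 7 (br 4 (lf 6 6) (lf 0 6) (lf 6 40)) (br 4 (lf 6 6) (lf 0 6) (lf 0 11)) (lf 0 22)) (br 7
  (lf 12 7) (lf 12 7) (lf 12 7)) (br 7 (lf 0 21) (lf 10 1) (br 4 (lf 8 6) (lf 2 6) (lf 5 23)))) (lf 6 3)) (br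
  10 (br 11 (br 7 (lf 0 7) (lf 0 7) (lf 0 7)) (br 7 (br 4 (lf 0 6) (lf 6 11) (lf 6 6)) (br 4 (lf 0 6) (lf 6
  40) (lf 6 6)) (lf 12 22)) (br 7 (lf 2 1) (lf 0 21) (br 4 (lf 4 6) (lf 13 23) (lf 10 6)))) (br 4 (br 7 (br
  11 (lf 0 18) (lf 0 18) (lf 0 18)) (br 11 (lf 0 18) (lf 0 18) (lf 0 18)) (br 11 (lf 0 18) (lf 0 18) (lf 0
  18))) (br 7 (br 11 (lf 0 18) (lf 0 18) (lf 0 18)) (br 11 (lf 0 18) (lf 0 18) (lf 0 18)) (br 11 (lf 0 18)
  (lf 0 18) (lf 0 18))) (br 7 (br 11 (lf 0 18) (lf 0 18) (lf 0 18)) (br 11 (lf 0 18) (lf 0 18) (lf 0 18)) (br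
  11 (lf 0 18) (lf 0 18) (lf 0 18)))) (lf 18 3))) (br 10 (br 3 (br 7 (br 11 (lf 0 12) (lf 10 12) (lf 17 4))
  (br 11 (lf 0 12) (lf 4 10) (lf 10 14)) (br 11 (lf 15 4) (lf 0 14) (lf 0 24))) (br 7 (br 11 (lf 0 7) (lf 4
  7) (lf 4 7)) (br 11 (lf 0 7) (lf 12 25) (lf 1 3)) (br 11 (lf 0 7) (lf 9 3) (lf 0 30))) (br 7 (br 11 (br 4
  (br 12 (lf 12 54) (lf 12 53) (lf 0 55)) (br 12 (lf 12 54) (lf 12 53) (lf 12 57)) (br 12 (lf 12 54) (lf 12
  53) (lf 18 65))) (lf 4 17) (br 4 (lf 10 11) (lf 10 11) (lf 10 11))) (br 11 (lf 4 17) (lf 0 26) (br 4 (lf 9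
  6) (lf 18 23) (lf 3 6))) (br 11 (br 4 (lf 0 11) (lf 0 11) (lf 0 11)) (br 4 (lf 1 6) (lf 16 23) (lf 7 6))
  (lf 4 10)))) (br 7 (lf 22 0) (lf 22 0) (lf 22 0)) (br 7 (br 11 (lf 18 5) (br 3 (lf 11 13) (lf 23 13) (lf 5
  1)) (br 3 (lf 14 9) (lf 0 9) (lf 10 14))) (br 11 (br 3 (lf 5 13) (lf 11 3) (lf 3 1)) (br 3 (lf 4 10) (br 4
  (lf 11 37) (lf 1 38) (lf 4 36)) (lf 5 19)) (lf 4 15)) (br 11 (br 3 (lf 13 9) (lf 2 9) (lf 0 14)) (lf 6 15)
  (lf 6 2))))) (br 9 (br 3 (br 10 (br 7 (br 11 (lf 2 1) (br 4 (lf 3 45) (lf 0 46) (lf 0 41)) (lf 12 5)) (br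
  11 (br 4 (br 12 (lf 0 55) (lf 12 53) (lf 6 66)) (br 14 (lf 18 60) (lf 18 60) (lf 18 60)) (lf 18 47)) (br 4
  (lf 0 45) (lf 6 41) (lf 12 46)) (lf 6 22)) (br 11 (lf 8 1) (lf 0 21) (lf 3 14))) (br 7 (br 11 (lf 6 1) (br
  4 (br 12 (lf 0 66) (lf 0 53) (lf 0 55)) (lf 6 47) (br 13 (lf 6 60) (lf 6 60) (lf 6 60))) (lf 3 1)) (br 11
  (lf 0 1) (lf 10 1) (lf 1 16)) (br 11 (lf 6 31) (lf 4 1) (lf 3 14))) (br 7 (br 11 (lf 17 16) (lf 18 22) (lf
  6 13)) (br 11 (lf 2 1) (lf 0 5) (lf 18 13)) (br 11 (lf 9 14) (lf 9 14) (lf 3 14)))) (br 10 (br 4 (br 7 (br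
  11 (lf 0 18) (lf 0 18) (lf 0 18)) (br 11 (lf 0 18) (lf 0 18) (lf 0 18)) (br 11 (lf 0 18) (lf 0 18) (lf 0
  18))) (br 7 (br 11 (lf 0 18) (lf 0 18) (lf 0 18)) (br 11 (lf 0 18) (lf 0 18) (lf 0 18)) (br 11 (lf 0 18)
  (lf 0 18) (lf 0 18))) (br 7 (br 11 (lf 0 18) (lf 0 18) (lf 0 18)) (br 11 (lf 0 18) (lf 0 18) (lf 0 18)) (br
  11 (lf 0 18) (lf 0 18) (lf 0 18)))) (br 11 (br 7 (br 4 (lf 0 6) (lf 6 6) (lf 0 40)) (br 4 (lf 0 6) (lf 6 6)
  (lf 6 11)) (lf 6 22)) (br 7 (lf 12 7) (lf 12 7) (lf 12 7)) (br 7 (lf 0 21) (lf 2 1) (br 4 (lf 4 6) (lf 10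
  6) (lf 7 23)))) (lf 0 3)) (br 11 (br 10 (br 7 (lf 0 7) (lf 0 7) (lf 0 7)) (br 7 (br 4 (lf 6 6) (lf 0 11)
  (lf 0 6)) (br 4 (lf 6 6) (lf 0 40) (lf 0 6)) (lf 18 22)) (br 7 (lf 10 1) (lf 0 21) (br 4 (lf 8 6) (lf 23
  23) (lf 2 6)))) (br 4 (br 7 (br 10 (lf 2 18) (lf 2 18) (lf 2 18)) (br 10 (lf 2 18) (lf 2 18) (lf 2 18)) (br
  10 (lf 2 18) (lf 2 18) (lf 2 18))) (br 7 (br 10 (lf 2 18) (lf 2 18) (lf 2 18)) (br 10 (lf 2 18) (lf 2 18)
  (lf 2 18)) (br 10 (lf 2 18) (lf 2 18) (lf 2 18))) (br 7 (br 10 (lf 2 18) (lf 2 18) (lf 2 18)) (br 10 (lf 2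
  18) (lf 2 18) (lf 2 18)) (br 10 (lf 2 18) (lf 2 18) (lf 2 18)))) (lf 12 3))) (br 7 (br 10 (br 3 (br 11 (br
  4 (br 12 (lf 12 54) (lf 12 53) (lf 0 55)) (br 12 (lf 12 54) (lf 12 53) (lf 12 57)) (lf 0 51)) (br 4 (br 12
  (lf 0 58) (lf 12 53) (lf 0 55)) (br 12 (lf 12 57) (lf 12 53) (lf 12 57)) (br 12 (lf 0 58) (lf 12 53) (lf 12
  62))) (lf 17 4)) (br 11 (br 4 (br 12 (lf 12 54) (lf 12 53) (lf 0 55)) (br 12 (lf 12 54) (lf 12 53) (lf 12
  57)) (br 12 (lf 12 54) (lf 12 53) (br 13 (lf 18 71) (br 14 (lf 12 71) (lf 12 72) (lf 14 74)) (br 14 (lf 12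
  71) (lf 12 74) (lf 12 74))))) (lf 18 27) (br 4 (br 12 (lf 0 54) (lf 12 53) (lf 0 55)) (lf 1 33) (br 13 (lf
  1 57) (lf 1 53) (lf 13 54)))) (br 4 (br 11 (br 12 (lf 12 54) (lf 12 53) (lf 0 55)) (br 12 (lf 0 58) (lf 12
  53) (lf 0 55)) (br 12 (lf 0 54) (lf 12 53) (lf 0 55))) (br 11 (lf 0 50) (lf 18 34) (br 12 (lf 0 54) (lf 12
  53) (lf 12 57))) (br 11 (lf 0 52) (lf 0 42) (lf 12 33)))) (br 11 (br 3 (br 4 (br 12 (lf 6 58) (lf 12 53)
  (lf 0 55)) (br 12 (lf 12 57) (lf 12 53) (lf 12 57)) (br 12 (lf 6 58) (lf 12 53) (lf 18 62))) (lf 12 27) (br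
  4 (br 12 (lf 6 58) (lf 12 53) (lf 0 55)) (lf 12 34) (lf 6 42))) (br 3 (br 4 (br 12 (lf 0 54) (lf 12 53) (lf
  0 55)) (br 12 (lf 0 54) (lf 12 53) (lf 12 57)) (br 12 (lf 0 54) (lf 12 53) (br 13 (lf 0 67) (lf 12 63) (br
  14 (lf 6 67) (lf 18 63) (br 15 (lf 0 84) (lf 0 85) (lf 0 86)))))) (br 4 (br 12 (lf 0 54) (lf 12 53) (lf 0
  55)) (lf 0 49) (br 12 (lf 0 54) (lf 12 53) (br 13 (lf 0 67) (lf 12 63) (lf 6 81)))) (br 4 (br 12 (lf 0 54)
  (lf 12 53) (lf 0 55)) (lf 0 23) (br 12 (lf 0 54) (lf 12 53) (br 13 (lf 0 67) (lf 12 63) (lf 6 80))))) (lf 6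
  16)) (br 11 (br 3 (lf 17 4) (br 4 (br 12 (lf 0 54) (lf 12 53) (lf 0 55)) (lf 11 33) (br 14 (lf 5 57) (lf 5
  53) (lf 17 54))) (br 4 (br 12 (lf 0 54) (lf 12 53) (lf 0 55)) (br 12 (lf 0 54) (lf 12 53) (lf 12 57)) (lf
  18 33))) (lf 0 16) (br 3 (lf 5 10) (br 4 (lf 0 37) (lf 2 38) (lf 5 36)) (lf 0 19)))) (br 10 (br 11 (br 3
  (lf 0 32) (br 4 (br 12 (lf 0 55) (lf 1 68) (br 13 (lf 12 64) (lf 12 69) (lf 12 69))) (br 13 (lf 12 64) (br
  12 (lf 12 62) (br 14 (lf 18 64) (lf 0 83) (lf 6 76)) (lf 12 69)) (lf 0 76)) (lf 0 34)) (lf 12 32)) (br 3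
  (lf 6 29) (lf 17 4) (lf 6 28)) (lf 1 5)) (br 11 (br 3 (lf 0 29) (lf 17 4) (lf 0 28)) (br 3 (lf 0 39) (br 4
  (br 12 (lf 0 55) (lf 1 68) (br 13 (lf 12 61) (br 14 (lf 18 61) (lf 0 72) (lf 6 79)) (br 14 (lf 18 61) (lf 0
  79) (lf 12 82)))) (br 12 (lf 0 65) (br 13 (lf 12 61) (br 14 (lf 18 61) (lf 0 72) (lf 6 78)) (lf 0 78)) (lf
  0 77)) (br 12 (lf 0 65) (lf 0 55) (lf 12 75))) (lf 12 35)) (lf 1 5)) (lf 11 5)) (br 10 (br 11 (br 3 (lf 3
  31) (br 4 (lf 15 43) (lf 12 44) (lf 3 48)) (br 4 (lf 0 43) (lf 12 48) (lf 3 44))) (br 3 (lf 11 1) (lf 3 24)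
  (br 4 (lf 3 18) (lf 3 18) (lf 3 18))) (lf 15 0)) (br 11 (br 3 (lf 1 1) (lf 3 24) (br 4 (lf 5 18) (lf 5 18)
  (lf 5 18))) (lf 0 20) (br 3 (lf 2 4) (br 4 (lf 3 11) (lf 3 11) (lf 3 11)) (lf 17 4))) (br 11 (lf 17 0) (br
  3 (lf 0 4) (br 4 (lf 9 11) (lf 9 11) (lf 9 11)) (lf 17 4)) (lf 12 2)))) (br 10 (br 7 (lf 4 0) (lf 4 0) (lf
  4 0)) (br 3 (br 7 (br 11 (lf 4 10) (lf 18 12) (lf 10 14)) (br 11 (lf 16 12) (lf 16 12) (lf 1 4)) (br 11 (lf
  0 14) (lf 5 4) (lf 12 24))) (br 7 (br 11 (lf 16 26) (lf 12 17) (br 4 (lf 9 6) (lf 3 6) (lf 0 23))) (br 11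
  (lf 12 17) (br 4 (br 12 (lf 0 55) (lf 0 53) (lf 0 54)) (br 12 (lf 0 65) (lf 0 53) (lf 0 54)) (br 12 (lf 0
  57) (lf 0 53) (lf 0 54))) (br 4 (lf 10 11) (lf 10 11) (lf 10 11))) (br 11 (br 4 (lf 1 6) (lf 7 6) (lf 10
  23)) (br 4 (lf 0 11) (lf 0 11) (lf 0 11)) (lf 4 10))) (br 7 (br 11 (lf 4 25) (lf 12 7) (lf 19 3)) (br 11
  (lf 16 7) (lf 12 7) (lf 16 7)) (br 11 (lf 15 3) (lf 12 7) (lf 13 30)))) (br 7 (br 11 (br 3 (lf 4 10) (lf 17
  19) (br 4 (lf 11 37) (lf 12 36) (lf 1 38))) (br 3 (lf 23 13) (lf 3 1) (lf 17 3)) (lf 22 15)) (br 11 (br 3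
  (lf 17 13) (lf 5 1) (lf 5 13)) (lf 0 5) (br 3 (lf 0 9) (lf 10 14) (lf 14 9))) (br 11 (lf 12 15) (br 3 (lf 2
  9) (lf 0 14) (lf 13 9)) (lf 12 2))))) (br 9 (br 11 (br 3 (br 7 (br 10 (lf 2 12) (lf 2 12) (lf 17 4)) (br 10
  (lf 6 12) (lf 0 10) (lf 2 14)) (br 10 (lf 13 4) (lf 6 14) (lf 0 24))) (br 7 (br 10 (lf 0 7) (lf 2 7) (lf 2
  7)) (br 10 (lf 0 7) (lf 14 25) (lf 11 3)) (br 10 (lf 0 7) (lf 3 3) (lf 2 30))) (br 7 (br 10 (br 4 (br 12
  (lf 12 54) (lf 12 53) (lf 0 55)) (br 12 (lf 12 54) (lf 12 53) (lf 12 57)) (br 12 (lf 12 54) (lf 12 53) (lf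
  12 65))) (lf 0 17) (br 4 (lf 2 11) (lf 2 11) (lf 2 11))) (br 10 (lf 0 17) (lf 2 26) (br 4 (lf 3 6) (lf 12
  23) (lf 9 6))) (br 10 (br 4 (lf 6 11) (lf 6 11) (lf 6 11)) (br 4 (lf 11 6) (lf 20 23) (lf 5 6)) (lf 0
  10)))) (br 7 (lf 14 0) (lf 14 0) (lf 14 0)) (br 7 (br 10 (lf 12 5) (br 3 (lf 1 13) (lf 13 13) (lf 5 1)) (br
  3 (lf 12 9) (lf 1 9) (lf 2 14))) (br 10 (br 3 (lf 7 13) (lf 1 3) (lf 1 1)) (br 3 (lf 0 10) (br 4 (lf 1 37)
  (lf 0 38) (lf 0 36)) (lf 1 19)) (lf 8 15)) (br 10 (br 3 (lf 13 9) (lf 2 9) (lf 3 14)) (lf 0 15) (lf 0 2))))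
  (br 11 (br 7 (lf 8 0) (lf 8 0) (lf 8 0)) (br 3 (br 7 (br 10 (lf 0 10) (lf 12 12) (lf 2 14)) (br 10 (lf 20
  12) (lf 12 12) (lf 1 4)) (br 10 (lf 6 14) (lf 3 4) (lf 12 24))) (br 7 (br 10 (lf 12 26) (lf 14 17) (br 4
  (lf 3 6) (lf 9 6) (lf 6 23))) (br 10 (lf 14 17) (br 4 (br 12 (lf 0 55) (lf 0 53) (lf 0 54)) (br 12 (lf 6
  65) (lf 0 53) (lf 0 54)) (br 12 (lf 0 57) (lf 0 53) (lf 0 54))) (br 4 (lf 2 11) (lf 2 11) (lf 2 11))) (br
  10 (br 4 (lf 11 6) (lf 5 6) (lf 2 23)) (br 4 (lf 6 11) (lf 6 11) (lf 6 11)) (lf 0 10))) (br 7 (br 10 (lf 0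
  25) (lf 12 7) (lf 17 3)) (br 10 (lf 14 7) (lf 12 7) (lf 14 7)) (br 10 (lf 21 3) (lf 12 7) (lf 12 30)))) (br
  7 (br 10 (br 3 (lf 0 10) (lf 13 19) (br 4 (lf 1 37) (lf 14 36) (lf 0 38))) (br 3 (lf 13 13) (lf 1 1) (lf 19
  3)) (lf 14 15)) (br 10 (br 3 (lf 19 13) (lf 5 1) (lf 7 13)) (lf 6 5) (br 3 (lf 1 9) (lf 2 14) (lf 12 9)))
  (br 10 (lf 18 15) (br 3 (lf 2 9) (lf 3 14) (lf 13 9)) (lf 18 2)))) (br 7 (br 10 (br 11 (br 3 (br 4 (br 12
  (lf 14 59) (lf 0 53) (lf 0 55)) (br 12 (lf 14 59) (lf 0 53) (lf 16 70)) (br 12 (lf 14 59) (lf 0 53) (lf 16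
  70))) (br 4 (br 12 (lf 14 59) (lf 0 53) (lf 0 55)) (br 12 (lf 14 59) (lf 0 53) (lf 16 70)) (br 12 (lf 14
  59) (lf 0 53) (lf 16 70))) (br 4 (br 12 (lf 14 59) (lf 0 53) (lf 0 55)) (br 12 (lf 14 59) (lf 0 53) (lf 16
  70)) (br 12 (lf 14 59) (lf 0 53) (lf 16 70)))) (lf 2 8) (lf 1 2)) (br 11 (lf 0 8) (lf 0 8) (lf 7 2)) (br 11
  (lf 5 2) (lf 5 2) (lf 5 2))) (br 10 (br 11 (lf 4 8) (lf 2 8) (lf 1 2)) (br 11 (lf 4 8) (br 3 (br 4 (br 12
  (lf 0 55) (lf 12 53) (lf 4 59)) (br 12 (lf 2 70) (lf 12 53) (lf 4 59)) (br 12 (lf 2 70) (lf 12 53) (lf 4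
  59))) (br 4 (br 12 (lf 0 55) (lf 12 53) (lf 4 59)) (br 12 (lf 2 70) (lf 12 53) (lf 4 59)) (br 12 (lf 2 70)
  (lf 12 53) (lf 4 59))) (br 4 (br 12 (lf 0 55) (lf 12 53) (lf 4 59)) (br 12 (lf 2 70) (lf 12 53) (lf 4 59))
  (br 12 (lf 2 70) (lf 12 53) (lf 4 59)))) (lf 13 2)) (br 11 (lf 11 2) (lf 17 2) (lf 13 2))) (br 10 (br 11
  (lf 3 2) (lf 9 2) (lf 1 2)) (br 11 (lf 3 2) (lf 15 2) (lf 15 2)) (br 11 (lf 3 2) (lf 17 2) (br 3 (br 4 (br
  12 (lf 13 56) (lf 1 73) (lf 2 56)) (br 12 (lf 13 56) (lf 1 73) (lf 2 56)) (br 12 (lf 13 56) (lf 1 73) (lf 2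
  56))) (br 4 (br 12 (lf 13 56) (lf 1 73) (lf 2 56)) (br 12 (lf 13 56) (lf 1 73) (lf 2 56)) (br 12 (lf 13 56)
  (lf 1 73) (lf 2 56))) (br 4 (br 12 (lf 13 56) (lf 1 73) (lf 2 56)) (br 12 (lf 13 56) (lf 1 73) (lf 2 56))
  (br 12 (lf 13 56) (lf 1 73) (lf 2 56))))))))

-- Entries 0, 1, 2 are units, of color 0 as χ(ω) = 0. Entries 5 and 6 are y and y - 1, colored by
-- the choice of y.
start₂ : Coloring
start₂ = just 0F ∷ just 0F ∷ just 0F ∷ nothing ∷ nothing ∷ just 1F ∷ just 2F ∷
  nothing ∷ nothing ∷ nothing ∷ nothing ∷ nothing ∷ nothing ∷ nothing ∷ nothing ∷ nothing ∷ []

table₂-consistent : Holds (all (Symbolic.consistent gens₂) table₂)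
table₂-consistent = holds tt

tree₂-valid : Holds (Decision.valid gens₂ table₂ act₂ tree₂ start₂)
tree₂-valid = holds tt

tree₂-complete : holes tree₂ start₂ ≡ []
tree₂-complete = refl

tree₂-branches : Holds (all (λ d → d <ᵇ 16) (nodes tree₂))
tree₂-branches = holds tt

allNonzero : ∀ {q} {K : FiniteField q} (f : Polynomial → FiniteField.Carrier K) {ps} →
  All (λ p → f p ≢ FiniteField.0# K) ps → ∀ d → T (d <ᵇ length ps) → f (nth [] ps d) ≢ FiniteField.0# K
allNonzero f (h ∷ _)  zero    t = h
allNonzero {K = K} f (_ ∷ hs) (suc d) t = allNonzero {K = K} f hs d t

no-member : ∀ {A : Set} {xs : List A} {x} → xs ≡ [] → ¬ (x ∈ xs)
no-member refl ()

module _ {q} {K : FiniteField q} (X : CubicCharacter K) where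
  open FiniteField K
  open CubicCharacter X
  open Symbolic gens₂
  open Substitution gens₂ using (transform-sound)
  open Decision gens₂ table₂ act₂

  private
    Sound : (Coloring → Coloring) → Set
    Sound f = ∀ κ R y → Respects X R y κ → ∃₂ λ R′ y′ → Respects X R′ y′ (f κ)

    iterate-sound : ∀ n {f} → Sound f → Sound (iterate n f)
    iterate-sound zero    s κ R y r = R , y , r
    iterate-sound (suc n) s κ R y r = let R′ , y′ , r′ = s κ R y r in iterate-sound n s _ R′ y′ r′

    up-to-1 : ∀ {x y} → x ≡ y → ∃ λ z → z ≢ 0# × (z * (z * z)) * y ≡ x
    up-to-1 {x} refl = 1# , 1≢0 , trans (cong (_* x) (trans (*-identityˡ _) (*-identityˡ 1#))) (*-identityˡ x)

    rotation-sound : Sound (transform rotation)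
    rotation-sound κ R y r = R , ⟦ 1 , 0 , 1 ⟧ₑ * y ,
      transform-sound X (stretch (1 , 0 , 1)) rotation tt R R y (⟦ 1 , 0 , 1 ⟧ₑ * y)
        (λ p → up-to-1 (stretch-sound R (1 , 0 , 1) y p)) κ r
      where open Evaluation K R

    conjugation-sound : Sound (transform conjugation)
    conjugation-sound κ R y r = conjugateRoot R , y ,
      transform-sound X conjugateₚ conjugation tt R (conjugateRoot R) y y (λ p → up-to-1 (conjugate-sound R y p)) κ r

    inversion-sound : Sound (λ κ → invert (nth nothing κ 5) κ)
    inversion-sound κ R y r = cases (nth nothing κ 5) refl
      where
      cases : ∀ m → nth nothing κ 5 ≡ m → ∃₂ λ R′ y′ → Respects X R′ y′ (invert m κ)
      cases nothing  e = R , y , λ d → tt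
      cases (just c) e =
        let z , yz = divide y 1# λ y≡0 → proj₁ (subst (HasColor X _) e (r 5)) (trans (⟦y⟧ X R y) y≡0)
        in R , z , transform-sound X reciprocal inversion tt R R y z (reciprocal-sound R yz) κ r

    act₂-sound : ∀ t → Sound (act₂ t)
    act₂-sound t κ R y r =
      let R₁ , y₁ , r₁ = iterate-sound (t % 6) rotation-sound κ R y r
          R₂ , y₂ , r₂ = iterate-sound ((t / 6) % 2) conjugation-sound _ R₁ y₁ r₁
      in iterate-sound (t / 12) inversion-sound _ R₂ y₂ r₂

  -- The tree may branch on every generator since none vanishes: all units have color 0, whereas y,
  -- y², y⁴ have colors 1, 2, 1, so none of these is minus a unit. For 2 and 1 - ω this follows from
  -- the two hypotheses on numerals.
  rainbowPlane₂ : (R : CubeRoot K) → χ (CubeRoot.ω R) ≡ 0F → 2 ⋆ 1# ≢ 0# → 3 ⋆ 1# ≢ 0# → RainbowPlane K X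
  rainbowPlane₂ R χω 2≢0 3≢0 = finish (decide X table₂-consistent act₂-sound R y (λ d → d <ᵇ 16)
      (allNonzero {K = K} (⟦_⟧ y) nonzero) tree₂ start₂ tree₂-branches tree₂-valid
      (allColors X (⟦_⟧ y) gens₂ start₂ colors))
    where
    open CubeRoot R
    open Evaluation K R
    y = proj₁ (rainbow-point X)
    y≢0 = proj₁ (proj₂ (rainbow-point X))
    1-y≢0 = proj₁ (proj₂ (proj₂ (rainbow-point X)))
    χy = proj₁ (proj₂ (proj₂ (proj₂ (rainbow-point X))))
    χ1-y = proj₂ (proj₂ (proj₂ (proj₂ (rainbow-point X))))

    finish : RainbowPlane K X ⊎ (∃ λ κ′ → κ′ ∈ holes tree₂ start₂ × Respects X R y κ′) → RainbowPlane K X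
    finish (inj₁ P) = P
    finish (inj₂ (κ′ , κ′∈ , _)) = ⊥-elim (no-member tree₂-complete κ′∈)

    ω≢0 : ω ≢ 0#
    ω≢0 ω≡0 = 1≢0 (trans (sym ω³) (trans (cong (_* (ω * ω)) ω≡0) (zeroˡ _)))

    Unit : Eisenstein → Set
    Unit u = HasColor X ⟦ u ⟧ₑ (just 0F)

    one : Unit 1ₑ
    one = colored X R ⟦1⟧ₑ (1≢0 , χ-1)
    u-1 : Unit (0 , 1 , 1)
    u-1 = neg-one X R
    uω : Unit (0 , 1 , 0)
    uω = colored X R (⟦ω⟧ₑ X R) (ω≢0 , χω)
    uω² : Unit (0 , 0 , 1)
    uω² = ⟦⟧ₑ-* X R (0 , 1 , 0) (0 , 1 , 0) uω uω
    u-ω : Unit (1 , 0 , 1)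
    u-ω = ⟦⟧ₑ-* X R (0 , 1 , 1) (0 , 1 , 0) u-1 uω
    u-ω² : Unit (1 , 1 , 0)
    u-ω² = ⟦⟧ₑ-* X R (0 , 1 , 1) (0 , 0 , 1) u-1 uω²

    constant : ∀ c {m} → HasColor X ⟦ c ⟧ₑ m → HasColor X (⟦_⟧ y (c ∷ [])) m
    constant c h = colored X R (⟦const⟧ X R y c) h

    χy² : χ (y * y) ≡ 2F
    χy² = trans (χ-* y≢0 y≢0) (cong₂ _⊕_ χy χy)
    y²≢0 = *-nonzero y≢0 y≢0

    plus : ∀ c x → Unit c → χ x ≢ 0F → ⟦ c ⟧ₑ + x ≢ 0#
    plus c x (c≢0 , χc) χx≢0 = sum-nonzero X R c≢0 (λ e → χx≢0 (trans e χc))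

    linear : ∀ c → Unit c → ⟦_⟧ y (c ∷ 1ₑ ∷ []) ≢ 0#
    linear c u e = plus c y u (λ e → 1≢0′ (trans (sym χy) e)) (trans (sym (⟦linear⟧ X R y c)) e)
      where
      1≢0′ : 1F ≢ 0F
      1≢0′ ()

    square : ∀ c → Unit c → ⟦_⟧ y (c ∷ 0ₑ ∷ 1ₑ ∷ []) ≢ 0#
    square c u e = plus c (y * y) u (λ e → 2≢0′ (trans (sym χy²) e))
      (trans (cong (λ t → ⟦ c ⟧ₑ + y * t) (sym (⟦y⟧ X R y))) e)
      where
      2≢0′ : 2F ≢ 0F
      2≢0′ ()

    quartic : ⟦_⟧ y (1ₑ ∷ 0ₑ ∷ 0ₑ ∷ 0ₑ ∷ 1ₑ ∷ []) ≢ 0#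
    quartic e = plus 1ₑ (y * (y * (y * y))) one (λ e → 1≢0′ (trans (sym χy⁴) e))
      (trans (cong (λ t → ⟦ 1ₑ ⟧ₑ + y * t) (sym (trans (⟦shift⟧ X R y (0ₑ ∷ 0ₑ ∷ 1ₑ ∷ [])) (cong (y *_) (trans (⟦shift⟧ X R y (0ₑ ∷ 1ₑ ∷ [])) (cong (y *_) (⟦y⟧ X R y))))))) e)
      where
      1≢0′ : 1F ≢ 0F
      1≢0′ ()
      χy⁴ : χ (y * (y * (y * y))) ≡ 1F
      χy⁴ = trans (χ-* y≢0 (*-nonzero y≢0 y²≢0)) (cong₂ _⊕_ χy (trans (χ-* y≢0 y²≢0) (cong₂ _⊕_ χy χy²)))

    colors : AllColors X (⟦_⟧ y) gens₂ start₂
    colors = constant 1ₑ one , constant (0 , 1 , 1) u-1 , constant (0 , 1 , 0) uω , tt , tt ,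
      colored X R (⟦y⟧ X R y) (y≢0 , χy) ,
      colored X R (⟦-⟧ X R y) (neg-nonzero 1-y≢0 , trans (χ-neg 1-y≢0) χ1-y) ,
      tt , tt , tt , tt , tt , tt , tt , tt , tt , tt

    nonzero : All (λ p → ⟦_⟧ y p ≢ 0#) gens₂
    nonzero = proj₁ (constant 1ₑ one) ∷ proj₁ (constant (0 , 1 , 1) u-1) ∷ proj₁ (constant (0 , 1 , 0) uω) ∷
      (λ e → θ≢0 X R 3≢0 (trans (sym (⟦const⟧ X R y (2 , 0 , 1))) e)) ∷
      (λ e → 2≢0 (trans (sym (⟦n⟧ₑ X R 2)) (trans (sym (⟦const⟧ X R y (2 , 0 , 0))) e))) ∷
      (λ e → y≢0 (trans (sym (⟦y⟧ X R y)) e)) ∷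
      (λ e → neg-nonzero 1-y≢0 (trans (sym (⟦-⟧ X R y)) e)) ∷
      linear 1ₑ one ∷ linear (1 , 0 , 1) u-ω ∷ linear (1 , 1 , 0) u-ω² ∷
      linear (0 , 1 , 0) uω ∷ linear (0 , 0 , 1) uω² ∷
      square 1ₑ one ∷ square (0 , 1 , 0) uω ∷ square (0 , 0 , 1) uω² ∷ quartic ∷ []

-- Planes for χ(ω) = 1

-- Numbers 5 and 6 are the factors 3 + ω and 3 + ω² of 7. Numbers 10 to 15 are 1 - u y for the six
-- units u, and 16 is 1 - 2 y; they serve the pattern modulo 2. Numbers 17 to 28 are y - 1 to y -
-- 12, and 29 is y + 1; they serve the pattern modulo 13.
gens₁ : List Polynomial
gens₁ =
  (1ₑ ∷ []) ∷ ((0 , 1 , 1) ∷ []) ∷ ((0 , 1 , 0) ∷ []) ∷ ((2 , 0 , 1) ∷ []) ∷ ((2 , 0 , 0) ∷ []) ∷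
  ((3 , 1 , 0) ∷ []) ∷ ((3 , 0 , 1) ∷ []) ∷ ((5 , 0 , 0) ∷ []) ∷ ((11 , 0 , 0) ∷ []) ∷
  (0ₑ ∷ 1ₑ ∷ []) ∷
  (1ₑ ∷ (0 , 1 , 1) ∷ []) ∷ (1ₑ ∷ (1 , 0 , 0) ∷ []) ∷ (1ₑ ∷ (1 , 0 , 1) ∷ []) ∷
  (1ₑ ∷ (0 , 1 , 0) ∷ []) ∷ (1ₑ ∷ (1 , 1 , 0) ∷ []) ∷ (1ₑ ∷ (0 , 0 , 1) ∷ []) ∷
  (1ₑ ∷ (0 , 2 , 2) ∷ []) ∷
  ((0 , 1 , 1) ∷ 1ₑ ∷ []) ∷ ((0 , 2 , 2) ∷ 1ₑ ∷ []) ∷ ((0 , 3 , 3) ∷ 1ₑ ∷ []) ∷ ((0 , 4 , 4) ∷ 1ₑ ∷ []) ∷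
  ((0 , 5 , 5) ∷ 1ₑ ∷ []) ∷ ((0 , 6 , 6) ∷ 1ₑ ∷ []) ∷ ((0 , 7 , 7) ∷ 1ₑ ∷ []) ∷ ((0 , 8 , 8) ∷ 1ₑ ∷ []) ∷
  ((0 , 9 , 9) ∷ 1ₑ ∷ []) ∷ ((0 , 10 , 10) ∷ 1ₑ ∷ []) ∷ ((0 , 11 , 11) ∷ 1ₑ ∷ []) ∷ ((0 , 12 , 12) ∷ 1ₑ ∷ []) ∷
  (1ₑ ∷ 1ₑ ∷ []) ∷ []

table₁ : List SymbolicPlane
table₁ =
  map decode (
  0x1040210401010420804100C4200C4100C20188410104018820008201082008002100402040210403 ∷
  0x410402104030804100C420808100C420106200C6018800208401884100C4100C20180831080318804184031040318841 ∷
  0xC6200C6018C420106208082104041006200C4200C03108201840310403104031080318802004030142020C4208042 ∷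
  0x831082018C0518402100A51040420C202884101462100A02882020403100A2100A201405180A31840518820290610148029041 ∷
  0xC0310803100601884100C62100820102020C0200C410084100C62080631082018C2030C42080C1018420146100C4208083 ∷
  0x418C62014631040618C4201063104041080421042080802108101063108202904029005208403144100C61010820182020C42080A2100C4080C41082031041 ∷
  0x318A4100C420C6031041018A518820318A310820314841840628C62018A42084031442080A520C420148420C403148301083080C31082028C410188420C42080C520C20318831040629481014802908318841 ∷
  0xC520840318A210406284052900528820314A101484018A4080A41040620C4201883188203148310820308410146210082104062882031442080C5080C518406200C6 ∷
  0x184018C6210404204051040210063080620806100C42080C210063184042082018C62018202104200C6210041014010144200C62 ∷
  0x820808210404080841880318C03104041884021041014821040418C42080831882020C6101082100C410083004061840520820080C41082028C42 ∷
  0x31040310820184031040310820184041884101061010620808408003188410140318820208031040310820184031840410806 ∷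
  0x62882031042080C3188402904020C42080C41040400C61014420106310405200841008318C402108101482100C40808210083188410182028C620808420841 ∷
  0xA2080C308082080631840418C62014631882031062080A41082021042080A41840528C051884020C631008310820210831080421062104052106210084188052902029081018A418841 ∷
  0x42082030803080C42080621060310810108318820210621040420C4021062080C42084101084080C61880618C20310831040628C05210610146310820210830808418C410188418841 ∷
  0x14A401082080C62084029040314602944029082080A418C42018A41082020C610104201482080C41040620C20310061884101420204062942031063100C6 ∷
  0x7A46210410588206B44083C420820F1041078410588406A46103DE210410488104884104123104107082080C4083042041A21041068410688207B4205A410 ∷
  0x6AD43108206B562101ED5840D58C4103DA3081AD1884103DAB1880F6AC62101ED58C0F5A8621020B1884103569181EF581ED588207AC6103DAD081EE68C42081ED588407B523081EB48C407A463 ∷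
  0x41E30820A041820820A1814918C0F50C208246082462102091881068C408286210203041421020A1041050C405A841035231020E101E9184101880D50C41 ∷
  0x1082080841082021020210620108301083108052106039081010821040718C4201462100C420C42080202104030C042008418C4208084210202108101C0318841 ∷
  0x18C2104052884038C2018C6031808100A5080A5108202944100C63100C61010210080208041080318C4208101018C21040421061018C029441 ∷
  0x630C0630C403186210063188402946038C42014A31082018C62080E310405288403184101084188063084101084188402940318C0528C4038C0421061018C029441 ∷
  0x29442018C20808420C4018C42080842010100C60408042104100C63080631882018C62104081080421042080631008420C42080C6108052840421061018C029441 ∷
  0x668402480B588101083188410588318840C106310820B1081066C4082F6202D60830906484082C90588105A410588420416202C418C42083562041CB0316 ∷
  0x24921020B49240624920416490831884106289210179248408316210189108318840C248420398902924841691084203124831649020D6120C49240627221020C5A440624921020C4920C492318841 ∷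
  0xC24831831620C60C4C8418C20B1C8318413210630608318C6210416ACC820831349040D4C831831699C40C5AA31831649041062D318C16990630835698C610626418C20C4E6410418B4C820626418C20D626318418C4C63 ∷
  0x1AA2480A2484062892041CA50810629321016A2481073042041849084083142106310820E6120E5120E59240831448316A1020E6280C5124062C921020C61240628921020C5120C512318841 ∷
  0x48842012418C42060810508418C420588420124202C418C42082440830420416904124824418C4206120C106310818B0409202C40808418C420508408312082C9 ∷
  0x4841748416480E4048E049C20D4420D241A083290248106D210552105640A9012482C90812420409210204812318841 ∷
  0x1239020B2480D4481058E4203872040939020E5880DC881068E4072410492105A4406920D588107340DA481072240588401C840835207121 ∷
  0x1C8902049C8105A4401C8408351203692041A3901CB101B91020E681C4841C39012484123901A902C9203562041639081058840839208349 ∷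
  0x2F289C20BC62705E27082D289C1C89C178A4E10725105E5108251382F690417924E105E5120C6210417382273824720C62102F138397882F78841789C8105E4705D27 ∷
  0xA0C610446300C631884020C631884105863024630808318383183431841C20820490402108318262082E3184192082018C1818C20C8C60210630838202441 ∷
  0x1DACC81077B5983B59C420ED644203B5A4480ED6692041DA4484083B38901DAC4809CA24202B3490810766421020ACE31076B58841589084083B59C41DA4E24083B39C41DACE24082B3890159C524 ∷
  0x2B149011490631082094524083B12101D94480EC524083B2204139248104A31202B2484188A41D490128A4128902094A2104A29203B2490209248404A2921020945209452318841 ∷
  0x304201242028421020210631082021004210810566420415A1080A9080A506310820C241691081051209908105A41050840829421020A4C84050840831408294 ∷
  0x1649084082D42106310820E5884082D621084072D22101AB248408394210631081C49080E588420392482D44840949080E5A81072C420398B039689080E55242041C99084072C921020E5920E592318841 ∷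
  0x448402463108140824418C4204C840248098C621041108284082710822904463108144828318840A4C204826100C62102440829108269 ∷
  0x4E5121014924840824420C621027249020A4E440827291080A4D2408264210209CA4406A730827391C139A48408335902B2490159C8631081691080A4C84081242027221020DCE4105E72 ∷
  0x5084010840488408124202D221014990810492408292202442101490C6210416A041449020C482091080E481591080A48831884094880A4884082920524318841 ∷
  0x1349080A4D2404E4920409210149248404E692102091083188409C88408249210149C8169A4209908408272482B249020BC9209C92404E51210209CA4404E49210209C9209C92318841 ∷
  0x15A4820ACA40AC88105643188410567205649082F3902F220417AC8202106310820AD12105A5105484056B2082D5882B2202722041221015910810568405524 ∷
  0x624406084083142041649020B5084062C4082C421080C10840828421020E60184831620418A029420414483142031621020C6080C5084083140628318841 ∷
  0x144829208284082C90830405280A9084050E4081240524105A8406A8106A8021080C5820A101420C621041421081050840839408314 ∷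
  0xB5880B2416A0C62102A421018A101691020A1C81066840829420394083160248105A8406A810524105A80A4C8105120B5084082D405A8318841 ∷
  0x292202442041691020A10209A48094881010810564408293202F2082B2048810664049016984124901289020910209C8840827204E4318841 ∷
  0x17B5121059272033692416A24E105A9249C16A4D270829249C20A4A2905A92484149C8E405A872029449C8105A4721016924E105A92382D5924E0AD24938415924E405A924908105AB490416A4A27 ∷
  [])

table₁-consistent : Holds (all (Symbolic.consistent gens₁) table₁)
table₁-consistent = holds tt

act₁ : ℕ → Coloring → Coloring
act₁ _ κ = κ

-- The holes of `tree₁` list the colors of 1 - ω, 2, 3 + ω, 3 + ω². They are (0, 2, 0, 1) and (1, 1,
-- 2, 0), which belong to the two primes of ℤ[ω] above 13, and (2, c, 2, 1) for each color c, which
-- belong to the prime 2. The holes of `treeB` and `treeC` are the colors 0 of 5 and 2 of 11, again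
-- those modulo 13.
tree₁ treeA treeB treeC : Tree
tree₁ =
  br 3 (br 4 (lf 0 1) (lf 0 0) (br 5 (br 6 (lf 0 5) hole (lf 0 8)) (br 6 (lf 0 7) (lf 0 6) (lf 0 5)) (br 6
  (lf 0 6) (lf 0 9) (lf 0 10)))) (br 4 (lf 0 0) (br 5 (br 6 (lf 0 5) (lf 0 6) (lf 0 12)) (br 6 (lf 0 11) (lf
  0 10) (lf 0 5)) (br 6 hole (lf 0 9) (lf 0 6))) (lf 0 1)) (br 4 (br 5 (lf 0 2) (br 6 (lf 0 4) (lf 0 4) (lf 0
  4)) (br 6 (lf 0 8) hole (lf 0 7))) (br 5 (br 6 (lf 0 4) (lf 0 4) (lf 0 4)) (lf 0 3) (br 6 (lf 0 13) hole
  (lf 0 14))) (br 5 (lf 0 3) (lf 0 2) (br 6 (lf 0 7) hole (lf 0 8))))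
treeA =
  br 16 hole (br 9 (lf 0 17) (lf 0 16) (lf 0 15)) (br 9 (lf 0 16) (lf 0 15) (lf 0 17))
treeB = br 7 hole (lf 0 18) (lf 0 20)
treeC = br 8 (lf 0 19) (lf 0 21) hole

-- treeN ρ belongs to the residue ρ + 1 modulo 13.
treeN : Fin 12 → Tree
treeN 0F = br 9 hole (lf 0 22) (lf 0 23)
treeN 1F = br 9 (lf 0 24) (lf 0 25) hole
treeN 2F = br 9 (lf 0 26) (lf 0 27) hole
treeN 3F = br 9 (lf 0 29) hole (lf 0 28)
treeN 4F = br 9 hole (lf 0 30) (lf 0 31)
treeN 5F = br 9 (lf 0 33) hole (lf 0 32)
treeN 6F = br 9 (lf 0 35) hole (lf 0 34)
treeN 7F = br 9 hole (lf 0 36) (lf 0 37)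
treeN 8F = br 9 (lf 0 39) hole (lf 0 38)
treeN 9F = br 9 (lf 0 40) (lf 0 41) hole
treeN (suc 9F) = br 9 (lf 0 42) (lf 0 43) hole
treeN (suc (suc 9F)) = br 9 hole (lf 0 44) (lf 0 45)

start₁ : Coloring
start₁ = just 0F ∷ just 0F ∷ just 1F ∷ nothing ∷ nothing ∷ nothing ∷ nothing ∷ []

-- Modulo 2 the elements 1 - ω, 3 + ω, 3 + ω² become ω², ω², ω, hence the colors 2, 2, 1; the
-- element 2 itself vanishes there and its color is left open. The six zeros say that 1 - u y has
-- color 0 for all units u.
startA : Coloring
startA = just 0F ∷ just 0F ∷ just 1F ∷ just 2F ∷ nothing ∷ just 2F ∷ just 1F ∷ nothing ∷ nothing ∷ nothing ∷ just 0F ∷ just 0F ∷ just 0F ∷ just 0F ∷ just 0F ∷ just 0F ∷ nothing ∷ []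

startB : Coloring
startB = just 0F ∷ just 0F ∷ just 1F ∷ just 0F ∷ just 2F ∷ just 0F ∷ just 1F ∷ nothing ∷ []

startC : Coloring
startC = just 0F ∷ just 0F ∷ just 1F ∷ just 0F ∷ just 2F ∷ just 0F ∷ just 1F ∷ just 0F ∷ nothing ∷ []

among : List ℕ → ℕ → Bool
among ds d = any (λ e → e ≡ᵇ d) ds

treeA-branches : Holds (all (among (4 ∷ 9 ∷ 16 ∷ [])) (nodes treeA))
treeA-branches = holds tt

treeA-valid : Holds (Decision.valid gens₁ table₁ act₁ treeA startA)
treeA-valid = holds tt

tree₁-branches : Holds (all (among (3 ∷ 4 ∷ 5 ∷ 6 ∷ [])) (nodes tree₁))
tree₁-branches = holds tt

tree₁-valid : Holds (Decision.valid gens₁ table₁ act₁ tree₁ start₁)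
tree₁-valid = holds tt

treeB-branches : Holds (all (among (7 ∷ [])) (nodes treeB))
treeB-branches = holds tt

treeB-valid : Holds (Decision.valid gens₁ table₁ act₁ treeB startB)
treeB-valid = holds tt

treeC-branches : Holds (all (among (8 ∷ [])) (nodes treeC))
treeC-branches = holds tt

treeC-valid : Holds (Decision.valid gens₁ table₁ act₁ treeC startC)
treeC-valid = holds tt

members : ∀ (Q : ℕ → Set) {ds} → All Q ds → ∀ d → T (among ds d) → Q d
members Q {e ∷ _} (h ∷ hs) d t with e ≡ᵇ d in eq
... | true  = subst Q (ℕ.≡ᵇ⇒≡ e d (subst T (sym eq) tt)) h
... | false = members Q hs d t

last-true : (P : ℕ → Set) → (∀ n → Dec (P n)) → P 0 → ∀ n → ¬ P n → ∃ λ k → P k × ¬ P (suc k)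
last-true P P? p zero    ¬p = ⊥-elim (¬p p)
last-true P P? p (suc n) ¬p with P? n
... | yes pn = n , pn , ¬p
... | no ¬pn = last-true P P? p n ¬pn

least-false : (P : ℕ → Set) → (∀ n → Dec (P n)) → ∀ n → ¬ P n → ∃ λ k → ¬ P k × (∀ m → m < k → P m)
least-false P P? = <-rec _ λ n rec ¬p → cases n (λ {m} → rec {m}) ¬p (ℕ.anyUpTo? (λ m → ¬? (P? m)) n)
  where
  cases : ∀ n → (∀ {m} → m < n → ¬ P m → ∃ λ k → ¬ P k × (∀ m → m < k → P m)) → ¬ P n →
    Dec (∃ λ m → m < n × ¬ P m) → ∃ λ k → ¬ P k × (∀ m → m < k → P m)
  cases n rec ¬p (yes (m , m<n , ¬pm)) = rec m<n ¬pm
  cases n rec ¬p (no none) = n , ¬p , λ m m<n → decidable-stable (P? m) λ ¬pm → none (m , m<n , ¬pm)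

module _ {q} (K : FiniteField q) where
  open FiniteField K

  -- Two of the q + 1 powers with exponents 0 to q coincide, and x can be cancelled.
  finite-order : ∀ x → x ≢ 0# → ∃ λ n → x ^ suc n ≡ 1#
  finite-order x x≢0 =
    let i , j , i<j , e = Fin.pigeonhole (ℕ.n<1+n q) (λ i → code (x ^ toℕ i))
        m = toℕ j ∸ suc (toℕ i)
        split : suc m ℕ.+ toℕ i ≡ toℕ j
        split = trans (sym (ℕ.+-suc m (toℕ i))) (ℕ.m∸n+n≡m i<j)
    in m , *-cancelˡ (^-nonzero (toℕ i) x≢0) (trans (*-comm _ _)
      (trans (sym (^-homo-* x (suc m) (toℕ i)))
        (trans (cong (x ^_) split) (trans (sym (code-injective e)) (sym (*-identityʳ _))))))

ω≢0 : ∀ {q} {K : FiniteField q} (R : CubeRoot K) → CubeRoot.ω R ≢ FiniteField.0# K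
ω≢0 {K = K} R ω≡0 = 1≢0 (trans (sym ω³) (trans (cong (_* (ω * ω)) ω≡0) (zeroˡ _)))
  where
  open FiniteField K
  open CubeRoot R

-- Characters that look like the cubic character modulo 2

module CaseA {q} {K : FiniteField q} (X : CubicCharacter K) (R : CubeRoot K) where
  open FiniteField K
  open CubicCharacter X
  open CubeRoot R
  open Evaluation K R
  open Symbolic gens₁ using (Respects)

  hasColor? : ∀ x m → Dec (HasColor X x m)
  hasColor? x nothing  = yes tt
  hasColor? x (just c) = ¬? (x ≟ 0#) ×-dec (χ x Fin.≟ c)

  allColors? : ∀ f ps κ → Dec (AllColors X f ps κ)
  allColors? f ps       []      = yes tt
  allColors? f []       (_ ∷ _) = no λ ()
  allColors? f (p ∷ ps) (m ∷ κ) = hasColor? (f p) m ×-dec allColors? f ps κ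

  -- 1 - u y for the six units u
  units : List Polynomial
  units = (1ₑ ∷ (0 , 1 , 1) ∷ []) ∷ (1ₑ ∷ (1 , 0 , 0) ∷ []) ∷ (1ₑ ∷ (1 , 0 , 1) ∷ []) ∷
    (1ₑ ∷ (0 , 1 , 0) ∷ []) ∷ (1ₑ ∷ (1 , 1 , 0) ∷ []) ∷ (1ₑ ∷ (0 , 0 , 1) ∷ []) ∷ []

  zeros : Coloring
  zeros = just 0F ∷ just 0F ∷ just 0F ∷ just 0F ∷ just 0F ∷ just 0F ∷ []

  -- If y were a multiple of 2 in ℤ[ω], every 1 - u y would be 1 modulo 2. `Small` asks for the
  -- colors that the pattern modulo 2 predicts for such y.
  Small : Carrier → Set
  Small x = AllColors X (⟦_⟧ x) units zeros

  small? : ∀ x → Dec (Small x)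
  small? x = allColors? (⟦_⟧ x) units zeros

  p₁₆ : Polynomial
  p₁₆ = 1ₑ ∷ (0 , 2 , 2) ∷ []

  rotated : ℕ → Polynomial → Polynomial
  rotated zero    p = p
  rotated (suc k) p = stretch (1 , 0 , 1) (rotated k p)

  turn : ℕ → Carrier → Carrier
  turn zero    y = y
  turn (suc k) y = turn k (⟦ 1 , 0 , 1 ⟧ₑ * y)

  turn-value : ∀ k y p → ⟦_⟧ (turn k y) p ≡ ⟦_⟧ y (rotated k p)
  turn-value zero    y p = refl
  turn-value (suc k) y p = trans (turn-value k _ p) (sym (stretch-sound R (1 , 0 , 1) y (rotated k p)))

  -- The factor is -ω, so the six forms 1 - u y are merely permuted.
  small-turn : ∀ y → Small y → Small (⟦ 1 , 0 , 1 ⟧ₑ * y)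
  small-turn y (a , b , c , d , e , f , _) =
    by 0 3 d tt , by 1 2 c tt , by 2 5 f tt , by 3 4 e tt , by 4 1 b tt , by 5 0 a tt , tt
    where
    by : ∀ i j → HasColor X (⟦_⟧ y (nth [] units j)) (just 0F) →
         T (stretch (1 , 0 , 1) (nth [] units i) == nth [] units j) →
         HasColor X (⟦_⟧ (⟦ 1 , 0 , 1 ⟧ₑ * y) (nth [] units i)) (just 0F)
    by i j h t = colored X R (trans (sym (stretch-sound R (1 , 0 , 1) y (nth [] units i)))
      (==-sound y (stretch (1 , 0 , 1) (nth [] units i)) (nth [] units j) t)) h

  small-turns : ∀ k y → Small y → Small (turn k y)
  small-turns zero    y s = s
  small-turns (suc k) y s = small-turns k _ (small-turn y s)

  module _ (χω : χ ω ≡ 1F) {c : Fin 3}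
           (hθ : HasColor X ⟦ 2 , 0 , 1 ⟧ₑ (just 2F)) (h2 : HasColor X ⟦ 2 , 0 , 0 ⟧ₑ (just c))
           (hπ : HasColor X ⟦ 3 , 1 , 0 ⟧ₑ (just 2F)) (hπ̄ : HasColor X ⟦ 3 , 0 , 1 ⟧ₑ (just 1F)) where

    private
      hω : HasColor X ⟦ 0 , 1 , 0 ⟧ₑ (just 1F)
      hω = colored X R (⟦ω⟧ₑ X R) (ω≢0 R , χω)
      h-1 : HasColor X ⟦ 0 , 1 , 1 ⟧ₑ (just 0F)
      h-1 = neg-one X R
      h-ω : HasColor X ⟦ 1 , 0 , 1 ⟧ₑ (just 1F)
      h-ω = ⟦⟧ₑ-* X R (0 , 1 , 1) (0 , 1 , 0) h-1 hω
      hω² : HasColor X ⟦ 0 , 0 , 1 ⟧ₑ (just 2F)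
      hω² = ⟦⟧ₑ-* X R (0 , 1 , 0) (0 , 1 , 0) hω hω
      h-ω² : HasColor X ⟦ 1 , 1 , 0 ⟧ₑ (just 2F)
      h-ω² = ⟦⟧ₑ-* X R (0 , 1 , 1) (0 , 0 , 1) h-1 hω²

      two : Carrier
      two = ⟦ 2 , 0 , 0 ⟧ₑ

      two≢0 : two ≢ 0#
      two≢0 = proj₁ h2

      at-two : ∀ u → ⟦_⟧ two (1ₑ ∷ u ∷ []) ≡ ⟦ 1ₑ +ₑ ((2 , 0 , 0) *ₑ u) ⟧ₑ
      at-two u = trans (cong (λ t → ⟦ 1ₑ ⟧ₑ + two * t) (⟦const⟧ X R two u))
        (sym (trans (+ₑ-hom 1ₑ ((2 , 0 , 0) *ₑ u)) (cong (⟦ 1ₑ ⟧ₑ +_) (*ₑ-hom (2 , 0 , 0) u))))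

      small-at-two : ∀ u v → HasColor X ⟦ v ⟧ₑ (just 0F) → T (same (reduce (1ₑ +ₑ ((2 , 0 , 0) *ₑ u))) (reduce v)) →
        HasColor X (⟦_⟧ two (1ₑ ∷ u ∷ [])) (just 0F)
      small-at-two u v h t = colored X R (trans (at-two u) (same-sound (1ₑ +ₑ ((2 , 0 , 0) *ₑ u)) v t)) h

      -- The six values are -1, 3 = -ω² (1 - ω)², -ω (3 + ω), ω (1 - ω), -ω² (3 + ω²) and -ω (1 -
      -- ω); the assumed colors make each of them 0.
      small-two : Small two
      small-two =
        small-at-two (0 , 1 , 1) (0 , 1 , 1) h-1 tt ,
        small-at-two (1 , 0 , 0) ((1 , 1 , 0) *ₑ ((2 , 0 , 1) *ₑ (2 , 0 , 1)))
          (⟦⟧ₑ-* X R (1 , 1 , 0) ((2 , 0 , 1) *ₑ (2 , 0 , 1)) h-ω² (⟦⟧ₑ-* X R (2 , 0 , 1) (2 , 0 , 1) hθ hθ)) tt ,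
        small-at-two (1 , 0 , 1) ((1 , 0 , 1) *ₑ (3 , 1 , 0)) (⟦⟧ₑ-* X R (1 , 0 , 1) (3 , 1 , 0) h-ω hπ) tt ,
        small-at-two (0 , 1 , 0) ((0 , 1 , 0) *ₑ (2 , 0 , 1)) (⟦⟧ₑ-* X R (0 , 1 , 0) (2 , 0 , 1) hω hθ) tt ,
        small-at-two (1 , 1 , 0) ((1 , 1 , 0) *ₑ (3 , 0 , 1)) (⟦⟧ₑ-* X R (1 , 1 , 0) (3 , 0 , 1) h-ω² hπ̄) tt ,
        small-at-two (0 , 0 , 1) ((1 , 0 , 1) *ₑ (2 , 0 , 1)) (⟦⟧ₑ-* X R (1 , 0 , 1) (2 , 0 , 1) h-ω hθ) tt , tt

      not-small-1 : ¬ Small 1#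
      not-small-1 (( nz , _) , _) = nz (trans (cong₂ (λ s t → s + 1# * t) ⟦1⟧ₑ (trans (⟦const⟧ X R 1# (0 , 1 , 1)) (⟦-1⟧ₑ X R)))
        (trans (cong (1# +_) (*-identityˡ _)) (-‿inverseʳ 1#)))

      -- The powers of 2 start with a small element and return to 1, which is not small because 1 -
      -- 1 vanishes. So smallness is lost at some doubling.
      last : ∃ λ y → y ≢ 0# × Small y × ¬ Small (two * y)
      last =
        let n , e = finite-order K two two≢0
            k , s , ¬s = last-true (λ k → Small (two ^ suc k)) (λ k → small? (two ^ suc k))
              (subst Small (sym (*-identityʳ two)) small-two) n (λ s → not-small-1 (subst Small e s))
        in two ^ suc k , ^-nonzero (suc k) two≢0 , s , ¬s

      doubled : ∀ y i k → T (rotated k p₁₆ == stretch (2 , 0 , 0) (nth [] units i)) →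
        HasColor X (⟦_⟧ (turn k y) p₁₆) (just 0F) → HasColor X (⟦_⟧ (two * y) (nth [] units i)) (just 0F)
      doubled y i k t h = colored X R (trans (sym (stretch-sound R (2 , 0 , 0) y (nth [] units i)))
        (trans (sym (==-sound y (rotated k p₁₆) (stretch (2 , 0 , 0) (nth [] units i)) t)) (sym (turn-value k y p₁₆)))) h

      turn≢0 : ∀ k {y} → y ≢ 0# → turn k y ≢ 0#
      turn≢0 zero    y≢0 = y≢0
      turn≢0 (suc k) y≢0 = turn≢0 k (*-nonzero (proj₁ h-ω) y≢0)

      Escapes : Carrier → Fin 6 → Set
      Escapes y k = ¬ HasColor X (⟦_⟧ (turn (toℕ k) y) p₁₆) (just 0F)

      -- The six values 1 - 2 u y are the values of 1 - 2 y at the turns of y. Replacing y by a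
      -- suitable turn, which is again small, moves the failure to u = 1.
      escape : ∀ y → y ≢ 0# → Small y → ¬ Small (two * y) → Dec (∃ (Escapes y)) →
        ∃ λ y → y ≢ 0# × Small y × ¬ HasColor X (⟦_⟧ y p₁₆) (just 0F)
      escape y y≢0 s ¬s (yes (k , ¬h)) = turn (toℕ k) y , turn≢0 (toℕ k) y≢0 , small-turns (toℕ k) y s , ¬h
      escape y y≢0 s ¬s (no none) = ⊥-elim (¬s
          (doubled y 0 0 tt (at 0F) , doubled y 1 3 tt (at 3F) , doubled y 2 4 tt (at 4F) ,
           doubled y 3 1 tt (at 1F) , doubled y 4 2 tt (at 2F) , doubled y 5 5 tt (at 5F) , tt))
        where
        at : ∀ (k : Fin 6) → HasColor X (⟦_⟧ (turn (toℕ k) y) p₁₆) (just 0F)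
        at k = decidable-stable (hasColor? (⟦_⟧ (turn (toℕ k) y) p₁₆) (just 0F)) λ ¬h → none (k , ¬h)

      witness : ∃ λ y → y ≢ 0# × Small y × ¬ HasColor X (⟦_⟧ y p₁₆) (just 0F)
      witness = let y , y≢0 , s , ¬s = last in
        escape y y≢0 s ¬s (Fin.any? (λ k → ¬? (hasColor? (⟦_⟧ (turn (toℕ k) y) p₁₆) (just 0F))))

      twice : ∀ y p r s → T ((((2 , 0 , 0) ∷ []) *ₚ p) == ((r ∷ []) +ₚ ((s ∷ []) *ₚ p₁₆))) →
        ⟦_⟧ y p₁₆ ≡ 0# → two * ⟦_⟧ y p ≡ ⟦ r ⟧ₑ
      twice y p r s t e = begin
        two * ⟦_⟧ y p
          ≡⟨ cong (_* ⟦_⟧ y p) (sym (⟦const⟧ X R y (2 , 0 , 0))) ⟩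
        ⟦_⟧ y ((2 , 0 , 0) ∷ []) * ⟦_⟧ y p
          ≡⟨ sym (*ₚ-hom y ((2 , 0 , 0) ∷ []) p) ⟩
        ⟦_⟧ y (((2 , 0 , 0) ∷ []) *ₚ p)
          ≡⟨ ==-sound y (((2 , 0 , 0) ∷ []) *ₚ p) ((r ∷ []) +ₚ ((s ∷ []) *ₚ p₁₆)) t ⟩
        ⟦_⟧ y ((r ∷ []) +ₚ ((s ∷ []) *ₚ p₁₆))
          ≡⟨ +ₚ-hom y (r ∷ []) ((s ∷ []) *ₚ p₁₆) ⟩
        ⟦_⟧ y (r ∷ []) + ⟦_⟧ y ((s ∷ []) *ₚ p₁₆)
          ≡⟨ cong₂ _+_ (⟦const⟧ X R y r) (trans (*ₚ-hom y (s ∷ []) p₁₆) (trans (cong (⟦_⟧ y (s ∷ []) *_) e) (zeroʳ _))) ⟩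
        ⟦ r ⟧ₑ + 0#
          ≡⟨ +-identityʳ _ ⟩
        ⟦ r ⟧ₑ ∎
        where open ≡-Reasoning

      compare : ∀ {x r d} → HasColor X x (just 0F) → two * x ≡ r → HasColor X r (just d) → c ≡ d
      compare {x} (x≢0 , χx) e (_ , χr) = trans (sym (⊕-identityʳ c))
        (trans (cong₂ _⊕_ (sym (proj₂ h2)) (sym χx)) (trans (sym (χ-* two≢0 x≢0)) (trans (cong χ e) χr)))

      -- If 2 y = 1, then 2 (1 - y) = 1 and 2 (1 - ω y) = 2 - ω = 3 + ω². Since 1 - y and 1 - ω y
      -- have color 0, the color c of 2 would be both 0 and 1.
      nonvanishing : ∀ y → Small y → ⟦_⟧ y p₁₆ ≢ 0#
      nonvanishing y (a , _ , b , _) e = clash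
          (compare a (twice y (nth [] units 0) 1ₑ 1ₑ tt e) (colored X R ⟦1⟧ₑ (1≢0 , χ-1)))
          (compare b (twice y (nth [] units 2) (3 , 0 , 1) (0 , 1 , 0) tt e) hπ̄)
        where
        clash : ∀ {c} → c ≡ 0F → c ≡ 1F → ⊥
        clash refl ()

    rainbowPlaneA : RainbowPlane K X
    rainbowPlaneA = finish (decide X table₁-consistent (λ t κ R y r → R , y , r) R y (among (4 ∷ 9 ∷ 16 ∷ []))
        (members (λ d → ⟦_⟧ y (nth [] gens₁ d) ≢ 0#) {4 ∷ 9 ∷ 16 ∷ []} ((λ e → two≢0 (trans (sym (⟦const⟧ X R y (2 , 0 , 0))) e)) ∷
          (λ e → y≢0 (trans (sym (⟦y⟧ X R y)) e)) ∷ nonvanishing y small ∷ []))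
        treeA startA treeA-branches treeA-valid (allColors X (⟦_⟧ y) gens₁ startA colors))
      where
      open Decision gens₁ table₁ act₁
      y = proj₁ witness
      y≢0 = proj₁ (proj₂ witness)
      small = proj₁ (proj₂ (proj₂ witness))
      not-zero = proj₂ (proj₂ (proj₂ witness))

      constant : ∀ c {m} → HasColor X ⟦ c ⟧ₑ m → HasColor X (⟦_⟧ y (c ∷ [])) m
      constant c h = colored X R (⟦const⟧ X R y c) h

      colors : AllColors X (⟦_⟧ y) gens₁ startA
      colors = constant 1ₑ (colored X R ⟦1⟧ₑ (1≢0 , χ-1)) , constant (0 , 1 , 1) h-1 , constant (0 , 1 , 0) hω ,
        constant (2 , 0 , 1) hθ , tt , constant (3 , 1 , 0) hπ , constant (3 , 0 , 1) hπ̄ , tt , tt , tt ,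
        proj₁ small , proj₁ (proj₂ small) , proj₁ (proj₂ (proj₂ small)) , proj₁ (proj₂ (proj₂ (proj₂ small))) ,
        proj₁ (proj₂ (proj₂ (proj₂ (proj₂ small)))) , proj₁ (proj₂ (proj₂ (proj₂ (proj₂ (proj₂ small))))) , tt , tt

      finish : RainbowPlane K X ⊎ (∃ λ κ → κ ∈ holes treeA startA × Respects X R y κ) → RainbowPlane K X
      finish (inj₁ P) = P
      -- The only coloring that `treeA` leaves open gives 1 - 2 y the color 0.
      finish (inj₂ (_ , here refl , r)) = ⊥-elim (not-zero (r 16))

-- Multiples of 13 get a junk value.
residueColor : ℕ → Fin 3
residueColor = nth 0F (0F ∷ 0F ∷ 2F ∷ 2F ∷ 1F ∷ 0F ∷ 1F ∷ 1F ∷ 0F ∷ 1F ∷ 2F ∷ 2F ∷ 0F ∷ [])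

-- This is the cubic character modulo 13 with the primitive root 2 of color 2. With ω ↦ 9, it gives
-- ω, 1 - ω, 3 + ω, 3 + ω² ↦ 9, 5, 12, 6 the colors 1, 0, 0, 1 assumed in `CaseB`.
χ₁₃ : ℕ → Fin 3
χ₁₃ n = residueColor (n % 13)

-- This is the predicted color of n - k for n of residue r. Adding 13 keeps the truncated
-- subtraction exact; for k = r the number is a multiple of 13 and nothing is predicted.
shiftColor : ℕ → ℕ → Maybe (Fin 3)
shiftColor r k = if k ≡ᵇ r then nothing else just (χ₁₃ (r ℕ.+ 13 ∸ k))

startN : ℕ → Coloring
startN r = (just 0F ∷ just 0F ∷ just 1F ∷ just 0F ∷ just 2F ∷ just 0F ∷ just 1F ∷ just 0F ∷ nothing ∷ nothing ∷
  nothing ∷ nothing ∷ nothing ∷ nothing ∷ nothing ∷ nothing ∷ nothing ∷ []) ++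
  map (shiftColor r) (1 ∷ 2 ∷ 3 ∷ 4 ∷ 5 ∷ 6 ∷ 7 ∷ 8 ∷ 9 ∷ 10 ∷ 11 ∷ 12 ∷ []) ++
  -- The entry for y + 1 is supplied for residue 6 only, where n + 1 has residue 7, of color 1.
  (if r ≡ᵇ 6 then just 1F else nothing) ∷ []

validN : Fin 12 → Bool
validN ρ = Decision.valid gens₁ table₁ act₁ (treeN ρ) (startN (suc (toℕ ρ)))

treeN-valid : Holds (all validN (allFin 12))
treeN-valid = holds tt

branchesN : Fin 12 → Bool
branchesN ρ = all (among (9 ∷ [])) (nodes (treeN ρ))

treeN-branches : Holds (all branchesN (allFin 12))
treeN-branches = holds tt

holds-all : ∀ {n} (f : Fin n → Bool) → Holds (all f (allFin n)) → ∀ i → Holds (f i)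
holds-all f (holds t) i = holds (All.lookup (all⁺ f (allFin _) t) (∈-allFin i))

treeN-holes : ∀ ρ → holes (treeN ρ) (startN (suc (toℕ ρ))) ≡
  set 9 (χ₁₃ (suc (toℕ ρ))) (startN (suc (toℕ ρ))) ∷ []
treeN-holes 0F = refl
treeN-holes 1F = refl
treeN-holes 2F = refl
treeN-holes 3F = refl
treeN-holes 4F = refl
treeN-holes 5F = refl
treeN-holes 6F = refl
treeN-holes 7F = refl
treeN-holes 8F = refl
treeN-holes 9F = refl
treeN-holes (suc 9F) = refl
treeN-holes (suc (suc 9F)) = refl

-- This shows that an n of nonzero residue r, all of whose predecessors follow the pattern, is
-- nonzero in K: otherwise n - k = -k would have the color of k as well as that of r - k.
reflection : ∀ (ρ : Fin 12) → ∃ λ (κ : Fin 12) → κ ≢ ρ ×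
  χ₁₃ (suc (toℕ ρ) ℕ.+ 13 ∸ suc (toℕ κ)) ≢ χ₁₃ (suc (toℕ κ))
reflection = from-yes (Fin.all? λ (ρ : Fin 12) → Fin.any? λ (κ : Fin 12) → ¬? (κ Fin.≟ ρ) ×-dec
  ¬? (χ₁₃ (suc (toℕ ρ) ℕ.+ 13 ∸ suc (toℕ κ)) Fin.≟ χ₁₃ (suc (toℕ κ))))

coprime-difference : ∀ (ρ κ : Fin 12) → κ ≢ ρ → (suc (toℕ ρ) ℕ.+ 13 ∸ suc (toℕ κ)) % 13 ≢ 0
coprime-difference = from-yes (Fin.all? λ (ρ : Fin 12) → Fin.all? λ (κ : Fin 12) → ¬? (κ Fin.≟ ρ) →-dec
  ¬? ((suc (toℕ ρ) ℕ.+ 13 ∸ suc (toℕ κ)) % 13 ℕ.≟ 0))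

χ₁₃-residue : ∀ {m n} → m % 13 ≡ n % 13 → χ₁₃ m ≡ χ₁₃ n
χ₁₃-residue e = cong residueColor e

double-residue : ∀ m → (2 ℕ.* m) % 13 ≡ (2 ℕ.* (m % 13)) % 13
double-residue m = trans (%-distribˡ-* 2 m 13) (sym (trans (%-distribˡ-* 2 (m % 13) 13)
  (cong (λ t → (2 ℕ.* t) % 13) (m%n%n≡m%n m 13))))

χ₁₃-double : ∀ m → m % 13 ≢ 0 → χ₁₃ (2 ℕ.* m) ≡ 2F ⊕ χ₁₃ m
χ₁₃-double m nz = trans (χ₁₃-residue {2 ℕ.* m} {2 ℕ.* (m % 13)} (double-residue m))
    (trans (subst (λ t → t ≢ 0 → χ₁₃ (2 ℕ.* t) ≡ 2F ⊕ χ₁₃ t) (Fin.toℕ-fromℕ< (m%n<n m 13)) (finite (fromℕ< (m%n<n m 13))) nz)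
      (cong (2F ⊕_) (χ₁₃-residue {m % 13} {m} (m%n%n≡m%n m 13))))
  where
  finite : ∀ (i : Fin 13) → toℕ i ≢ 0 → χ₁₃ (2 ℕ.* toℕ i) ≡ 2F ⊕ χ₁₃ (toℕ i)
  finite = from-yes (Fin.all? λ (i : Fin 13) → ¬? (toℕ i ℕ.≟ 0) →-dec (χ₁₃ (2 ℕ.* toℕ i) Fin.≟ 2F ⊕ χ₁₃ (toℕ i)))

subtract-residue : ∀ n k → 13 ≤ n → k ≤ 13 → (n ∸ k) % 13 ≡ (n % 13 ℕ.+ 13 ∸ k) % 13
subtract-residue n k 13≤n k≤13 = trans (cong (_% 13) split) ([m+kn]%n≡m%n (n % 13 ℕ.+ 13 ∸ k) s 13)
  where
  s = (n ∸ 13) / 13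
  n≡ : n ≡ (n % 13 ℕ.+ 13) ℕ.+ s ℕ.* 13
  n≡ = trans (sym (ℕ.m∸n+n≡m 13≤n)) (trans (cong (ℕ._+ 13) (m≡m%n+[m/n]*n (n ∸ 13) 13))
    (trans (cong (λ t → t ℕ.+ s ℕ.* 13 ℕ.+ 13) residue) (trans (ℕ.+-assoc (n % 13) (s ℕ.* 13) 13)
      (trans (cong (n % 13 ℕ.+_) (ℕ.+-comm (s ℕ.* 13) 13)) (sym (ℕ.+-assoc (n % 13) 13 (s ℕ.* 13)))))))
    where
    residue : (n ∸ 13) % 13 ≡ n % 13
    residue = trans (sym ([m+kn]%n≡m%n (n ∸ 13) 1 13)) (cong (_% 13) (ℕ.m∸n+n≡m 13≤n))
  split : n ∸ k ≡ (n % 13 ℕ.+ 13 ∸ k) ℕ.+ s ℕ.* 13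
  split = trans (cong (_∸ k) n≡) (ℕ.+-∸-comm (s ℕ.* 13) (ℕ.≤-trans k≤13 (ℕ.m≤n+m 13 (n % 13))))

-- Characters that look like the cubic character modulo 13

module CaseB {q} {K : FiniteField q} (X : CubicCharacter K) (R : CubeRoot K) where
  open FiniteField K
  open CubicCharacter X
  open CubeRoot R
  open Evaluation K R
  open Symbolic gens₁ using (Respects)
  open Decision gens₁ table₁ act₁
  open Solver K using (solve; _:*_; _:-_; _:+_; :-_; _:=_; con)

  Numeral : ℕ → Fin 3 → Set
  Numeral n c = HasColor X (n ⋆ 1#) (just c)

  numeral-* : ∀ m n {a b} → Numeral m a → Numeral n b → Numeral (m ℕ.* n) (a ⊕ b)
  numeral-* m n (m≢0 , χm) (n≢0 , χn) = colored X R (×1-homo-* m n)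
    (*-nonzero m≢0 n≢0 , trans (χ-* m≢0 n≢0) (cong₂ _⊕_ χm χn))

  numeral : ∀ n {c} → HasColor X ⟦ n , 0 , 0 ⟧ₑ (just c) → Numeral n c
  numeral n h = colored X R (sym (⟦n⟧ₑ X R n)) h

  ⟦-n⟧ₑ : ∀ k → ⟦ 0 , k , k ⟧ₑ ≡ - (k ⋆ 1#)
  ⟦-n⟧ₑ k = +-cancelˡ (k ⋆ 1#) _ _ (trans (solve 3 (λ k w v → k :+ (con (0 , 0) :+ k :* w :+ k :* v) := k :* (con (1 , 0) :+ w :+ v)) refl (k ⋆ 1#) ω (ω * ω))
    (trans (cong ((k ⋆ 1#) *_) 1+ω+ω²) (trans (zeroʳ _) (sym (-‿inverseʳ _)))))

  numeral-∸ : ∀ n k → k ≤ n → (n ∸ k) ⋆ 1# ≡ n ⋆ 1# - k ⋆ 1#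
  numeral-∸ n k k≤n = trans (solve 2 (λ a b → a := a :+ b :- b) refl ((n ∸ k) ⋆ 1#) (k ⋆ 1#))
    (cong (_- k ⋆ 1#) (trans (sym (×-homo-+ 1# (n ∸ k) k)) (cong (_⋆ 1#) (ℕ.m∸n+n≡m k≤n))))

  -- Multiples of 13 have no color modulo 13 and are exempt. Any other number that vanishes in K is
  -- not right, so the pattern must break if the characteristic is not 13.
  Right : ℕ → Set
  Right n = n % 13 ≡ 0 ⊎ Numeral n (χ₁₃ n)

  right? : ∀ n → Dec (Right n)
  right? n = (n % 13 ℕ.≟ 0) ⊎-dec (¬? (n ⋆ 1# ≟ 0#) ×-dec (χ (n ⋆ 1#) Fin.≟ χ₁₃ n))

  module _ (χω : χ ω ≡ 1F)
           (hθ : HasColor X ⟦ 2 , 0 , 1 ⟧ₑ (just 0F)) (h2 : HasColor X ⟦ 2 , 0 , 0 ⟧ₑ (just 2F))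
           (hπ : HasColor X ⟦ 3 , 1 , 0 ⟧ₑ (just 0F)) (hπ̄ : HasColor X ⟦ 3 , 0 , 1 ⟧ₑ (just 1F))
           (N : ℕ) (N≡0 : N ⋆ 1# ≡ 0#) (13∤N : N % 13 ≢ 0) where
    private
      hω : HasColor X ⟦ 0 , 1 , 0 ⟧ₑ (just 1F)
      hω = colored X R (⟦ω⟧ₑ X R) (ω≢0 R , χω)
      h-1 : HasColor X ⟦ 0 , 1 , 1 ⟧ₑ (just 0F)
      h-1 = neg-one X R
      h-ω² : HasColor X ⟦ 1 , 1 , 0 ⟧ₑ (just 2F)
      h-ω² = ⟦⟧ₑ-* X R (0 , 1 , 1) (0 , 0 , 1) h-1 (⟦⟧ₑ-* X R (0 , 1 , 0) (0 , 1 , 0) hω hω)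

      n1 : Numeral 1 0F
      n1 = colored X R (+-identityʳ 1#) (1≢0 , χ-1)
      n2 : Numeral 2 2F
      n2 = numeral 2 h2
      n3 : Numeral 3 2F
      n3 = numeral 3 (colored X R (same-sound (3 , 0 , 0) ((1 , 1 , 0) *ₑ ((2 , 0 , 1) *ₑ (2 , 0 , 1))) tt)
        (⟦⟧ₑ-* X R (1 , 1 , 0) ((2 , 0 , 1) *ₑ (2 , 0 , 1)) h-ω² (⟦⟧ₑ-* X R (2 , 0 , 1) (2 , 0 , 1) hθ hθ)))
      n7 : Numeral 7 1F
      n7 = numeral 7 (colored X R (same-sound (7 , 0 , 0) ((3 , 1 , 0) *ₑ (3 , 0 , 1)) tt) (⟦⟧ₑ-* X R (3 , 1 , 0) (3 , 0 , 1) hπ hπ̄))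

      1≢2 : _≢_ {A = Fin 3} 1F 2F
      1≢2 ()
      2≢0 : _≢_ {A = Fin 3} 2F 0F
      2≢0 ()

      -- Otherwise 7 = 2, although 7 has color 1 and 2 has color 2.
      5≢0 : 5 ⋆ 1# ≢ 0#
      5≢0 e = 1≢2 (trans (sym (proj₂ n7)) (trans (cong χ (trans (×-homo-+ 1# 5 2) (trans (cong (_+ 2 ⋆ 1#) e) (+-identityˡ _)))) (proj₂ n2)))

      constant : ∀ y c {m} → HasColor X ⟦ c ⟧ₑ m → HasColor X (⟦_⟧ y (c ∷ [])) m
      constant y c h = colored X R (⟦const⟧ X R y c) h

      constant⁻ : ∀ y c {m} → HasColor X (⟦_⟧ y (c ∷ [])) m → HasColor X ⟦ c ⟧ₑ m
      constant⁻ y c h = colored X R (sym (⟦const⟧ X R y c)) h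

      generator≢0 : ∀ y n → n ⋆ 1# ≢ 0# → ⟦_⟧ y ((n , 0 , 0) ∷ []) ≢ 0#
      generator≢0 y n n≢0 e = n≢0 (trans (sym (⟦n⟧ₑ X R n)) (trans (sym (⟦const⟧ X R y (n , 0 , 0))) e))

      one : HasColor X ⟦ 1ₑ ⟧ₑ (just 0F)
      one = colored X R ⟦1⟧ₑ (1≢0 , χ-1)

      Right-below : (n5 : Numeral 5 0F) (n11 : Numeral 11 2F) → ∀ m → m < 14 → Right m
      Right-below n5 n11 0  _ = inj₁ refl
      Right-below n5 n11 1  _ = inj₂ n1
      Right-below n5 n11 2  _ = inj₂ n2
      Right-below n5 n11 3  _ = inj₂ n3
      Right-below n5 n11 4  _ = inj₂ (numeral-* 2 2 n2 n2)
      Right-below n5 n11 5  _ = inj₂ n5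
      Right-below n5 n11 6  _ = inj₂ (numeral-* 2 3 n2 n3)
      Right-below n5 n11 7  _ = inj₂ n7
      Right-below n5 n11 8  _ = inj₂ (numeral-* 2 4 n2 (numeral-* 2 2 n2 n2))
      Right-below n5 n11 9  _ = inj₂ (numeral-* 3 3 n3 n3)
      Right-below n5 n11 10 _ = inj₂ (numeral-* 2 5 n2 n5)
      Right-below n5 n11 11 _ = inj₂ n11
      Right-below n5 n11 12 _ = inj₂ (numeral-* 3 4 n3 (numeral-* 2 2 n2 n2))
      Right-below n5 n11 13 _ = inj₁ refl
      Right-below n5 n11 (suc (suc (suc (suc (suc (suc (suc (suc (suc (suc (suc (suc (suc (suc _))))))))))))))
        (s≤s (s≤s (s≤s (s≤s (s≤s (s≤s (s≤s (s≤s (s≤s (s≤s (s≤s (s≤s (s≤s (s≤s ()))))))))))))))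

    module _ (n5 : Numeral 5 0F) (n11 : Numeral 11 2F) (n : ℕ) (¬right : ¬ Right n) (below : ∀ m → m < n → Right m) where
      private
        14≤n : 14 ≤ n
        14≤n = ℕ.≮⇒≥ λ n<14 → ¬right (Right-below n5 n11 n n<14)

        13≤n : 13 ≤ n
        13≤n = ℕ.≤-trans (ℕ.n≤1+n 13) 14≤n

        numeral-below : ∀ m → m < n → m % 13 ≢ 0 → Numeral m (χ₁₃ m)
        numeral-below m m<n nz = [ (λ e → ⊥-elim (nz e)) , (λ h → h) ]′ (below m m<n)

        r = n % 13

        residue : ∃ λ (ρ : Fin 12) → suc (toℕ ρ) ≡ r
        residue = go r refl (m%n<n n 13)
          where
          go : ∀ t → t ≡ r → t < 13 → ∃ λ (ρ : Fin 12) → suc (toℕ ρ) ≡ r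
          go zero    e _         = ⊥-elim (¬right (inj₁ (sym e)))
          go (suc t) e (s≤s t<12) = fromℕ< t<12 , trans (cong suc (Fin.toℕ-fromℕ< t<12)) e

        ρ = proj₁ residue
        r≡ = proj₂ residue

        k≤13 : ∀ (κ : Fin 12) → suc (toℕ κ) ≤ 13
        k≤13 κ = s≤s (ℕ.<⇒≤ (Fin.toℕ<n κ))

        k≤n : ∀ (κ : Fin 12) → suc (toℕ κ) ≤ n
        k≤n κ = ℕ.≤-trans (k≤13 κ) 13≤n

        shifted-residue : ∀ κ → (n ∸ suc (toℕ κ)) % 13 ≡ (suc (toℕ ρ) ℕ.+ 13 ∸ suc (toℕ κ)) % 13
        shifted-residue κ = trans (subtract-residue n (suc (toℕ κ)) 13≤n (k≤13 κ))
          (cong (λ t → (t ℕ.+ 13 ∸ suc (toℕ κ)) % 13) (sym r≡))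

        shifted : ∀ κ → κ ≢ ρ → Numeral (n ∸ suc (toℕ κ)) (χ₁₃ (suc (toℕ ρ) ℕ.+ 13 ∸ suc (toℕ κ)))
        shifted κ κ≢ρ = subst (Numeral (n ∸ suc (toℕ κ))) (χ₁₃-residue {n ∸ suc (toℕ κ)} {suc (toℕ ρ) ℕ.+ 13 ∸ suc (toℕ κ)} (shifted-residue κ))
          (numeral-below (n ∸ suc (toℕ κ)) (ℕ.∸-monoʳ-< (s≤s z≤n) (k≤n κ))
            λ e → coprime-difference ρ κ κ≢ρ (trans (sym (shifted-residue κ)) e))

        small : ∀ (κ : Fin 12) → Numeral (suc (toℕ κ)) (χ₁₃ (suc (toℕ κ)))
        small κ = numeral-below (suc (toℕ κ)) (ℕ.≤-trans (s≤s (k≤13 κ)) 14≤n) (nz κ)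
          where
          nz : ∀ (κ : Fin 12) → suc (toℕ κ) % 13 ≢ 0
          nz = from-yes (Fin.all? λ (κ : Fin 12) → ¬? (suc (toℕ κ) % 13 ℕ.≟ 0))

        y = n ⋆ 1#

        y≢0 : y ≢ 0#
        y≢0 e = let κ , κ≢ρ , χ≢ = reflection ρ in χ≢ (begin
          χ₁₃ (suc (toℕ ρ) ℕ.+ 13 ∸ suc (toℕ κ)) ≡⟨ sym (proj₂ (shifted κ κ≢ρ)) ⟩
          χ ((n ∸ suc (toℕ κ)) ⋆ 1#)             ≡⟨ cong χ (trans (numeral-∸ n (suc (toℕ κ)) (k≤n κ)) (trans (cong (_- suc (toℕ κ) ⋆ 1#) e) (+-identityˡ _))) ⟩
          χ (- (suc (toℕ κ) ⋆ 1#))               ≡⟨ χ-neg (proj₁ (small κ)) ⟩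
          χ (suc (toℕ κ) ⋆ 1#)                   ≡⟨ proj₂ (small κ) ⟩
          χ₁₃ (suc (toℕ κ))                      ∎)
          where open ≡-Reasoning

        halves : ∀ m → (2 ℕ.* m) % 13 ≢ 0 → m < n → Numeral (2 ℕ.* m) (χ₁₃ (2 ℕ.* m))
        halves m nz m<n = subst (Numeral (2 ℕ.* m)) (sym (χ₁₃-double m m%)) (numeral-* 2 m n2 (numeral-below m m<n m%))
          where
          m% : m % 13 ≢ 0
          m% e = nz (trans (double-residue m) (cong (λ t → (2 ℕ.* t) % 13) e))

        -- An even n = 2 h would inherit the right color from h. So n is odd, and n + 1 inherits its
        -- color from its half, which is still below n.
        successor : (n ℕ.+ 1) % 13 ≢ 0 → Numeral (n ℕ.+ 1) (χ₁₃ (n ℕ.+ 1))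
        successor nz = go (n % 2) refl (m%n<n n 2)
          where
          h = n / 2
          n≡ : n ≡ n % 2 ℕ.+ 2 ℕ.* h
          n≡ = trans (m≡m%n+[m/n]*n n 2) (cong (n % 2 ℕ.+_) (ℕ.*-comm h 2))
          go : ∀ t → t ≡ n % 2 → t < 2 → Numeral (n ℕ.+ 1) (χ₁₃ (n ℕ.+ 1))
          go 0 e _ = ⊥-elim (¬right (inj₂ (subst (λ m → Numeral m (χ₁₃ m)) (sym even)
              (halves h (λ z → ¬right (inj₁ (trans (cong (_% 13) even) z))) (subst (h <_) (sym even) (h<2h h (subst (0 <_) even (ℕ.≤-trans (s≤s z≤n) 14≤n))))))))
            where
            even : n ≡ 2 ℕ.* h
            even = trans n≡ (cong (ℕ._+ 2 ℕ.* h) (sym e))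
            h<2h : ∀ h → 0 < 2 ℕ.* h → h < 2 ℕ.* h
            h<2h (suc h) _ = ℕ.m<m+n (suc h) (s≤s z≤n)
          go 1 e _ = subst (λ m → Numeral m (χ₁₃ m)) (sym odd)
              (halves (suc h) (λ z → nz (trans (cong (_% 13) odd) z)) such<n)
            where
            n≡1 : n ≡ 1 ℕ.+ 2 ℕ.* h
            n≡1 = trans n≡ (cong (ℕ._+ 2 ℕ.* h) (sym e))
            odd : n ℕ.+ 1 ≡ 2 ℕ.* suc h
            odd = trans (ℕ.+-comm n 1) (trans (cong suc n≡1) (sym (ℕ.*-suc 2 h)))
            pos : ∀ h → 14 ≤ 1 ℕ.+ 2 ℕ.* h → suc h < 1 ℕ.+ 2 ℕ.* h
            pos zero (s≤s ())
            pos (suc h) _ = s≤s (ℕ.m<m+n (suc h) (s≤s z≤n))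
            such<n : suc h < n
            such<n = subst (suc h <_) (sym n≡1) (pos h (subst (14 ≤_) n≡1 14≤n))
          go (suc (suc _)) _ (s≤s (s≤s ()))

        shift-color : ∀ (κ : Fin 12) → HasColor X (⟦_⟧ y ((0 , suc (toℕ κ) , suc (toℕ κ)) ∷ 1ₑ ∷ [])) (shiftColor (suc (toℕ ρ)) (suc (toℕ κ)))
        shift-color κ = go (toℕ κ ≡ᵇ toℕ ρ) refl
          where
          go : ∀ b → (toℕ κ ≡ᵇ toℕ ρ) ≡ b →
            HasColor X (⟦_⟧ y ((0 , suc (toℕ κ) , suc (toℕ κ)) ∷ 1ₑ ∷ []))
              (if b then nothing else just (χ₁₃ (suc (toℕ ρ) ℕ.+ 13 ∸ suc (toℕ κ))))
          go true  e = tt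
          go false e = colored X R (trans (⟦linear⟧ X R y (0 , suc (toℕ κ) , suc (toℕ κ))) (trans (cong (_+ y) (⟦-n⟧ₑ (suc (toℕ κ))))
              (trans (+-comm _ y) (sym (numeral-∸ n (suc (toℕ κ)) (k≤n κ))))))
            (shifted κ λ { refl → subst T e (ℕ.≡⇒≡ᵇ (toℕ κ) (toℕ κ) refl) })

        next-color : HasColor X (⟦_⟧ y (1ₑ ∷ 1ₑ ∷ [])) (if suc (toℕ ρ) ≡ᵇ 6 then just 1F else nothing)
        next-color = go (suc (toℕ ρ) ≡ᵇ 6) refl
          where
          go : ∀ b → (suc (toℕ ρ) ≡ᵇ 6) ≡ b → HasColor X (⟦_⟧ y (1ₑ ∷ 1ₑ ∷ [])) (if b then just 1F else nothing)
          go false e = tt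
          go true  e = colored X R (trans (⟦linear⟧ X R y 1ₑ) (trans (cong (_+ y) ⟦1⟧ₑ) (sym n+1)))
              (subst (Numeral (n ℕ.+ 1)) (χ₁₃-residue {n ℕ.+ 1} {7} n+1%) (successor λ z → 7≢0 (trans (sym n+1%) z)))
            where
            7≢0 : 7 ≢ 0
            7≢0 ()
            n+1 : (n ℕ.+ 1) ⋆ 1# ≡ 1# + y
            n+1 = cong (_⋆ 1#) (ℕ.+-comm n 1)
            n+1% : (n ℕ.+ 1) % 13 ≡ 7
            n+1% = trans (cong (_% 13) (trans (cong (ℕ._+ 1) (m≡m%n+[m/n]*n n 13))
                (trans (ℕ.+-assoc (n % 13) ((n / 13) ℕ.* 13) 1) (trans (cong (n % 13 ℕ.+_) (ℕ.+-comm ((n / 13) ℕ.* 13) 1))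
                  (sym (ℕ.+-assoc (n % 13) 1 ((n / 13) ℕ.* 13)))))))
              (trans ([m+kn]%n≡m%n (n % 13 ℕ.+ 1) (n / 13) 13)
                (cong (λ t → (t ℕ.+ 1) % 13) (trans (sym r≡) (ℕ.≡ᵇ⇒≡ (suc (toℕ ρ)) 6 (subst T (sym e) tt)))))

        colors : AllColors X (⟦_⟧ y) gens₁ (startN (suc (toℕ ρ)))
        colors = constant y 1ₑ one , constant y (0 , 1 , 1) h-1 , constant y (0 , 1 , 0) hω , constant y (2 , 0 , 1) hθ ,
          constant y (2 , 0 , 0) h2 , constant y (3 , 1 , 0) hπ , constant y (3 , 0 , 1) hπ̄ ,
          constant y (5 , 0 , 0) (colored X R (⟦n⟧ₑ X R 5) n5) , tt , tt , tt , tt , tt , tt , tt , tt , tt ,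
          shift-color 0F , shift-color 1F , shift-color 2F , shift-color 3F , shift-color 4F , shift-color 5F ,
          shift-color 6F , shift-color 7F , shift-color 8F , shift-color 9F , shift-color (suc 9F) , shift-color (suc (suc 9F)) ,
          next-color , tt

        finish : RainbowPlane K X ⊎ (∃ λ κ → κ ∈ holes (treeN ρ) (startN (suc (toℕ ρ))) × Respects X R y κ) → RainbowPlane K X
        finish (inj₁ P) = P
        finish (inj₂ (κ , κ∈ , r)) = ⊥-elim (open-case (subst (κ ∈_) (treeN-holes ρ) κ∈) r)
          where
          -- In the coloring left open, y has the predicted color, against the choice of n as a
          -- number with the wrong one.
          open-case : ∀ {κ} → κ ∈ (set 9 (χ₁₃ (suc (toℕ ρ))) (startN (suc (toℕ ρ))) ∷ []) → ¬ Respects X R y κ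
          open-case (here refl) r = ¬right (inj₂ (subst (Numeral n)
            (trans (cong χ₁₃ r≡) (χ₁₃-residue {n % 13} {n} (m%n%n≡m%n n 13)))
            (colored X R (sym (⟦y⟧ X R y)) (r 9))))

      rainbowPlaneN : RainbowPlane K X
      rainbowPlaneN = finish (decide X table₁-consistent (λ t κ R y r → R , y , r) R y (among (9 ∷ []))
        (members (λ d → ⟦_⟧ y (nth [] gens₁ d) ≢ 0#) {9 ∷ []} ((λ e → y≢0 (trans (sym (⟦y⟧ X R y)) e)) ∷ []))
        (treeN ρ) (startN (suc (toℕ ρ))) (holds-all branchesN treeN-branches ρ) (holds-all validN treeN-valid ρ)
        (allColors X (⟦_⟧ y) gens₁ (startN (suc (toℕ ρ))) colors))

    private
      constants : AllColors X (⟦_⟧ 0#) gens₁ startB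
      constants = constant 0# 1ₑ one , constant 0# (0 , 1 , 1) h-1 , constant 0# (0 , 1 , 0) hω , constant 0# (2 , 0 , 1) hθ ,
          constant 0# (2 , 0 , 0) h2 , constant 0# (3 , 1 , 0) hπ , constant 0# (3 , 0 , 1) hπ̄ , tt , tt

      constantsC : Numeral 5 0F → AllColors X (⟦_⟧ 0#) gens₁ startC
      constantsC n5 = constant 0# 1ₑ one , constant 0# (0 , 1 , 1) h-1 , constant 0# (0 , 1 , 0) hω , constant 0# (2 , 0 , 1) hθ ,
          constant 0# (2 , 0 , 0) h2 , constant 0# (3 , 1 , 0) hπ , constant 0# (3 , 0 , 1) hπ̄ ,
          constant 0# (5 , 0 , 0) (colored X R (⟦n⟧ₑ X R 5) n5) , tt , tt

      least : Numeral 5 0F → Numeral 11 2F → RainbowPlane K X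
      -- `N` is not a multiple of 13 but zero in K; this starts the search for the least number that
      -- is not right.
      least n5 n11 = let n , ¬right , below = least-false Right right? N λ { (inj₁ e) → 13∤N e ; (inj₂ (nz , _)) → nz N≡0 } in
        rainbowPlaneN n5 n11 n ¬right below

      finishC : Numeral 5 0F → RainbowPlane K X ⊎ (∃ λ κ → κ ∈ holes treeC startC × Respects X R 0# κ) → RainbowPlane K X
      finishC n5 (inj₁ P) = P
      finishC n5 (inj₂ (_ , here refl , r)) = least n5 (numeral 11 (constant⁻ 0# (11 , 0 , 0) (r 8)))

      -- Otherwise 10 = -1 would have color 0, while 2 and 5 give it color 2.
      11≢0 : Numeral 5 0F → 11 ⋆ 1# ≢ 0#
      11≢0 n5 e = 2≢0 (trans (sym (proj₂ (numeral-* 2 5 n2 n5))) (trans (cong χ (+-cancelˡ 1# _ _ (trans e (sym (-‿inverseʳ 1#)))))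
        (trans (χ-neg 1≢0) χ-1)))

      stepC : Numeral 5 0F → RainbowPlane K X
      stepC n5 = finishC n5 (decide X table₁-consistent (λ t κ R y r → R , y , r) R 0# (among (8 ∷ []))
        (members (λ d → ⟦_⟧ 0# (nth [] gens₁ d) ≢ 0#) {8 ∷ []} (generator≢0 0# 11 (11≢0 n5) ∷ []))
        treeC startC treeC-branches treeC-valid (allColors X (⟦_⟧ 0#) gens₁ startC (constantsC n5)))

      finishB : RainbowPlane K X ⊎ (∃ λ κ → κ ∈ holes treeB startB × Respects X R 0# κ) → RainbowPlane K X
      finishB (inj₁ P) = P
      finishB (inj₂ (_ , here refl , r)) = stepC (numeral 5 (constant⁻ 0# (5 , 0 , 0) (r 7)))

    -- Unless 5, and then 11, has its color modulo 13, there is a plane with constant vertices. With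
    -- both colors known, all numbers below 14 are right, so the first failure lies beyond every k
    -- subtracted from it.
    rainbowPlaneB : RainbowPlane K X
    rainbowPlaneB = finishB (decide X table₁-consistent (λ t κ R y r → R , y , r) R 0# (among (7 ∷ []))
      (members (λ d → ⟦_⟧ 0# (nth [] gens₁ d) ≢ 0#) {7 ∷ []} (generator≢0 0# 5 5≢0 ∷ []))
      treeB startB treeB-branches treeB-valid (allColors X (⟦_⟧ 0#) gens₁ startB constants))

-- This is the conjugate character: it exchanges the colors 1 and 2. It turns χ(ω) = 2 into χ(ω) = 1
-- and, together with ω ↦ ω², preserves χ(ω) = 1.
doubleCharacter : ∀ {q} {K : FiniteField q} → CubicCharacter K → CubicCharacter K
doubleCharacter {K = K} X = record
  { χ          = λ x → χ x ⊕ χ x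
  ; χ-*        = λ {x} {y} x≢0 y≢0 → trans (cong (λ t → t ⊕ t) (χ-* x≢0 y≢0)) (interchange (χ x) (χ y))
  ; nontrivial = let g , g≢0 , χg = nontrivial in
      g * g , *-nonzero g≢0 g≢0 , cong (λ t → t ⊕ t) (trans (χ-* g≢0 g≢0) (cong (λ t → t ⊕ t) χg))
  }
  where
  open FiniteField K
  open CubicCharacter X
  interchange : ∀ a b → (a ⊕ b) ⊕ (a ⊕ b) ≡ (a ⊕ a) ⊕ (b ⊕ b)
  interchange = from-yes (Fin.all? λ a → Fin.all? λ b → (a ⊕ b) ⊕ (a ⊕ b) Fin.≟ (a ⊕ a) ⊕ (b ⊕ b))

-- All characters with χ(ω) = 1

module _ {q} {K : FiniteField q} (X : CubicCharacter K) (R : CubeRoot K) where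
  open FiniteField K
  open CubicCharacter X
  open CubeRoot R
  open Evaluation K R
  open Symbolic gens₁ using (Respects)
  open Decision gens₁ table₁ act₁

  private
    R̄ = conjugateRoot R
    X̄ = doubleCharacter X
    module R̄ = Evaluation K R̄

    conjugate-value : ∀ a b c → R̄.⟦ a , b , c ⟧ₑ ≡ ⟦ a , c , b ⟧ₑ
    conjugate-value a b c = trans (sym (⟦const⟧ X R̄ 0# (a , b , c)))
      (trans (sym (conjugate-sound R 0# ((a , b , c) ∷ []))) (⟦const⟧ X R 0# (a , c , b)))

    conjugated : ∀ a b c {d} → HasColor X ⟦ a , c , b ⟧ₑ (just d) → HasColor X̄ R̄.⟦ a , b , c ⟧ₑ (just (d ⊕ d))
    conjugated a b c (nz , χd) = (λ e → nz (trans (sym (conjugate-value a b c)) e)) ,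
      cong (λ t → t ⊕ t) (trans (cong χ (conjugate-value a b c)) χd)

  -- The condition on 7 makes 3 + ω and 3 + ω² nonzero, so that `tree₁` may branch on them. `N`
  -- witnesses a characteristic other than 13. The character is part of the conclusion because one
  -- hole is treated with the conjugate of the given one.
  rainbowPlane₁ : χ ω ≡ 1F → 2 ⋆ 1# ≢ 0# → 3 ⋆ 1# ≢ 0# → 7 ⋆ 1# ≢ 0# →
    ∀ N → N ⋆ 1# ≡ 0# → N % 13 ≢ 0 → ∃ (RainbowPlane K)
  rainbowPlane₁ χω 2≢0 3≢0 7≢0 N N≡0 13∤N =
    -- Only constants are colored here, so any point could stand in place of `0#`.
    finish (decide X table₁-consistent (λ t κ R y r → R , y , r) R 0# (among (3 ∷ 4 ∷ 5 ∷ 6 ∷ []))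
      (members (λ d → ⟦_⟧ 0# (nth [] gens₁ d) ≢ 0#) {3 ∷ 4 ∷ 5 ∷ 6 ∷ []}
        (generator (2 , 0 , 1) (θ≢0 X R 3≢0) ∷ generator (2 , 0 , 0) (λ e → 2≢0 (trans (sym (⟦n⟧ₑ X R 2)) e)) ∷
         generator (3 , 1 , 0) π≢0 ∷ generator (3 , 0 , 1) π̄≢0 ∷ []))
      tree₁ start₁ tree₁-branches tree₁-valid (allColors X (⟦_⟧ 0#) gens₁ start₁ colors))
    where
    generator : ∀ c → ⟦ c ⟧ₑ ≢ 0# → ⟦_⟧ 0# (c ∷ []) ≢ 0#
    generator c c≢0 e = c≢0 (trans (sym (⟦const⟧ X R 0# c)) e)

    7≡ : 7 ⋆ 1# ≡ ⟦ 3 , 1 , 0 ⟧ₑ * ⟦ 3 , 0 , 1 ⟧ₑ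
    7≡ = trans (sym (⟦n⟧ₑ X R 7)) (trans (same-sound (7 , 0 , 0) ((3 , 1 , 0) *ₑ (3 , 0 , 1)) tt) (*ₑ-hom (3 , 1 , 0) (3 , 0 , 1)))
    π≢0 : ⟦ 3 , 1 , 0 ⟧ₑ ≢ 0#
    π≢0 e = 7≢0 (trans 7≡ (trans (cong (_* ⟦ 3 , 0 , 1 ⟧ₑ) e) (zeroˡ _)))
    π̄≢0 : ⟦ 3 , 0 , 1 ⟧ₑ ≢ 0#
    π̄≢0 e = 7≢0 (trans 7≡ (trans (cong (⟦ 3 , 1 , 0 ⟧ₑ *_) e) (zeroʳ _)))

    constant⁻ : ∀ c {m} → HasColor X (⟦_⟧ 0# (c ∷ [])) m → HasColor X ⟦ c ⟧ₑ m
    constant⁻ c h = colored X R (sym (⟦const⟧ X R 0# c)) h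

    colors : AllColors X (⟦_⟧ 0#) gens₁ start₁
    colors = colored X R (trans (⟦const⟧ X R 0# 1ₑ) ⟦1⟧ₑ) (1≢0 , χ-1) ,
      colored X R (⟦const⟧ X R 0# (0 , 1 , 1)) (neg-one X R) ,
      colored X R (trans (⟦const⟧ X R 0# (0 , 1 , 0)) (⟦ω⟧ₑ X R)) (ω≢0 R , χω) , tt , tt , tt , tt , tt

    χω² : χ (ω * ω) ⊕ χ (ω * ω) ≡ 1F
    χω² = cong (λ t → t ⊕ t) (trans (χ-* (ω≢0 R) (ω≢0 R)) (cong₂ _⊕_ χω χω))

    -- 1 - ω² = -ω² (1 - ω)
    θ̄ : HasColor X ⟦ 2 , 0 , 1 ⟧ₑ (just 1F) → HasColor X ⟦ 2 , 1 , 0 ⟧ₑ (just 0F)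
    θ̄ h = colored X R (same-sound (2 , 1 , 0) ((1 , 1 , 0) *ₑ (2 , 0 , 1)) tt)
      (⟦⟧ₑ-* X R (1 , 1 , 0) (2 , 0 , 1) (⟦⟧ₑ-* X R (0 , 1 , 1) (0 , 0 , 1) (neg-one X R)
        (⟦⟧ₑ-* X R (0 , 1 , 0) (0 , 1 , 0) hω hω)) h)
      where
      hω : HasColor X ⟦ 0 , 1 , 0 ⟧ₑ (just 1F)
      hω = colored X R (⟦ω⟧ₑ X R) (ω≢0 R , χω)

    finish : RainbowPlane K X ⊎ (∃ λ κ → κ ∈ holes tree₁ start₁ × Respects X R 0# κ) → ∃ (RainbowPlane K)
    finish (inj₁ P) = X , P
    finish (inj₂ (_ , here refl , r)) = X , CaseB.rainbowPlaneB X R χω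
      (constant⁻ (2 , 0 , 1) (r 3)) (constant⁻ (2 , 0 , 0) (r 4)) (constant⁻ (3 , 1 , 0) (r 5)) (constant⁻ (3 , 0 , 1) (r 6)) N N≡0 13∤N
    -- This is the pattern of the other prime above 13; passing to ω² and the conjugate character
    -- turns it into the first one.
    finish (inj₂ (_ , there (here refl) , r)) = X̄ , CaseB.rainbowPlaneB X̄ R̄ χω²
      (conjugated 2 0 1 (θ̄ (constant⁻ (2 , 0 , 1) (r 3)))) (conjugated 2 0 0 (constant⁻ (2 , 0 , 0) (r 4)))
      (conjugated 3 1 0 (constant⁻ (3 , 0 , 1) (r 6))) (conjugated 3 0 1 (constant⁻ (3 , 1 , 0) (r 5))) N N≡0 13∤N
    finish (inj₂ (_ , there (there (here refl)) , r)) = X , CaseA.rainbowPlaneA X R χω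
      (constant⁻ (2 , 0 , 1) (r 3)) (constant⁻ (2 , 0 , 0) (r 4)) (constant⁻ (3 , 1 , 0) (r 5)) (constant⁻ (3 , 0 , 1) (r 6))
    finish (inj₂ (_ , there (there (there (here refl))) , r)) = X , CaseA.rainbowPlaneA X R χω
      (constant⁻ (2 , 0 , 1) (r 3)) (constant⁻ (2 , 0 , 0) (r 4)) (constant⁻ (3 , 1 , 0) (r 5)) (constant⁻ (3 , 0 , 1) (r 6))
    finish (inj₂ (_ , there (there (there (there (here refl)))) , r)) = X , CaseA.rainbowPlaneA X R χω
      (constant⁻ (2 , 0 , 1) (r 3)) (constant⁻ (2 , 0 , 0) (r 4)) (constant⁻ (3 , 1 , 0) (r 5)) (constant⁻ (3 , 0 , 1) (r 6))

-- Cube roots of unity and cubic characters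

module _ {A : Set} where

  remove : ∀ {x : A} {xs} → Unique xs → x ∈ xs → ∃ λ ys →
    length xs ≡ suc (length ys) × Unique ys × (∀ {z} → z ∈ ys → z ∈ xs × z ≢ x) × (∀ {z} → z ∈ xs → z ≢ x → z ∈ ys)
  remove {x} {_ ∷ xs} (x∉ ∷ u) (here refl) = xs , refl , u ,
    (λ z∈ → there z∈ , λ { refl → All.lookup x∉ z∈ refl }) , λ { (here refl) z≢ → ⊥-elim (z≢ refl) ; (there z∈) _ → z∈ }
  remove {x} {a ∷ xs} (a∉ ∷ u) (there x∈) =
    let ys , l , u′ , f , g = remove u x∈ in
    a ∷ ys , cong suc l , All.tabulate (λ z∈ → All.lookup a∉ (proj₁ (f z∈))) ∷ u′ ,
    (λ { (here refl) → here refl , (λ { refl → All.lookup a∉ x∈ refl }) ; (there z∈) → there (proj₁ (f z∈)) , proj₂ (f z∈) }) ,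
    λ { (here refl) _ → here refl ; (there z∈) z≢ → there (g z∈ z≢) }

  -- The orbit x, f x, f (f x) consists of three different members; removing it leaves a shorter
  -- list that is still closed under f.
  three-cycles : (f : A → A) → ∀ n xs → length xs ≡ n → Unique xs → (∀ {x} → x ∈ xs → f x ∈ xs) →
    (∀ {x} → x ∈ xs → f (f (f x)) ≡ x × f x ≢ x) → 3 ∣ n
  three-cycles f = <-rec _ step
    where
    step : ∀ n → (∀ {m} → m < n → ∀ xs → length xs ≡ m → Unique xs → (∀ {x} → x ∈ xs → f x ∈ xs) →
      (∀ {x} → x ∈ xs → f (f (f x)) ≡ x × f x ≢ x) → 3 ∣ m) →
      ∀ xs → length xs ≡ n → Unique xs → (∀ {x} → x ∈ xs → f x ∈ xs) →
      (∀ {x} → x ∈ xs → f (f (f x)) ≡ x × f x ≢ x) → 3 ∣ n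
    step n rec []       refl u closed cycle = divides 0 refl
    step n rec (x ∷ xs) refl u closed cycle = conclude (rec (subst (length zs <_) (sym size) (ℕ.m<n+m (length zs) (s≤s z≤n)))
        zs refl (proj₁ (proj₂ (proj₂ Z))) closed′ λ z∈ → cycle (back z∈))
      where
      x∈ : x ∈ x ∷ xs
      x∈ = here refl
      y = f x
      w = f y
      fw≡x : f w ≡ x
      fw≡x = proj₁ (cycle x∈)
      X = remove u x∈
      y∈ = proj₂ (proj₂ (proj₂ (proj₂ X))) (closed x∈) (proj₂ (cycle x∈))
      Y = remove (proj₁ (proj₂ (proj₂ X))) y∈
      w≢x : w ≢ x
      w≢x e = proj₂ (cycle x∈) (trans (cong f (sym e)) fw≡x)
      w≢y : w ≢ y
      w≢y = proj₂ (cycle (closed x∈))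
      w∈ = proj₂ (proj₂ (proj₂ (proj₂ Y))) (proj₂ (proj₂ (proj₂ (proj₂ X))) (closed (closed x∈)) w≢x) w≢y
      Z = remove (proj₁ (proj₂ (proj₂ Y))) w∈
      zs = proj₁ Z
      size : suc (length xs) ≡ 3 ℕ.+ length zs
      size = trans (proj₁ (proj₂ X)) (cong suc (trans (proj₁ (proj₂ Y)) (cong suc (proj₁ (proj₂ Z)))))
      conclude : 3 ∣ length zs → 3 ∣ suc (length xs)
      conclude (divides k e) = divides (suc k) (trans size (cong (3 ℕ.+_) e))
      downZ : ∀ {z} → z ∈ zs → z ∈ proj₁ Y × z ≢ w
      downZ = proj₁ (proj₂ (proj₂ (proj₂ Z)))
      downY : ∀ {z} → z ∈ proj₁ Y → z ∈ proj₁ X × z ≢ y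
      downY = proj₁ (proj₂ (proj₂ (proj₂ Y)))
      downX : ∀ {z} → z ∈ proj₁ X → z ∈ x ∷ xs × z ≢ x
      downX = proj₁ (proj₂ (proj₂ (proj₂ X)))
      back : ∀ {z} → z ∈ zs → z ∈ x ∷ xs
      back z∈ = proj₁ (downX (proj₁ (downY (proj₁ (downZ z∈)))))
      up : ∀ {z} → z ∈ x ∷ xs → z ≢ x → z ≢ y → z ≢ w → z ∈ zs
      up z∈ z≢x z≢y z≢w = proj₂ (proj₂ (proj₂ (proj₂ Z))) (proj₂ (proj₂ (proj₂ (proj₂ Y))) (proj₂ (proj₂ (proj₂ (proj₂ X))) z∈ z≢x) z≢y) z≢w
      closed′ : ∀ {z} → z ∈ zs → f z ∈ zs
      closed′ {z} z∈ = up (closed (back z∈))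
        (λ e → proj₂ (downZ z∈) (trans (sym (proj₁ (cycle (back z∈)))) (cong (λ t → f (f t)) e)))
        (λ e → proj₂ (downX (proj₁ (downY (proj₁ (downZ z∈))))) (trans (sym (proj₁ (cycle (back z∈)))) (trans (cong (λ t → f (f t)) e) fw≡x)))
        (λ e → proj₂ (downY (proj₁ (downZ z∈))) (trans (sym (proj₁ (cycle (back z∈)))) (trans (cong (λ t → f (f t)) e) (cong f fw≡x))))

module _ {q} (K : FiniteField q) where
  open FiniteField K
  open Solver K using (solve; _:*_; _:-_; _:+_; :-_; _:=_; con)

  elements : List Carrier
  elements = map element (allFin q)

  elements-unique : Unique elements
  elements-unique = map⁺ element-injective (allFin⁺ q)

  ∈-elements : ∀ x → x ∈ elements
  ∈-elements x = subst (_∈ elements) (element-code x) (∈-map⁺ element (∈-allFin (code x)))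

  length-elements : length elements ≡ q
  length-elements = trans (length-map element (allFin q)) (length-tabulate (λ (i : Fin q) → i))

  -- Multiplication by w permutes the q - 1 nonzero elements in cycles of length three.
  cube-root⇒3∣ : ∀ w → w ≢ 1# → w * (w * w) ≡ 1# → 3 ∣ (q ℕ.∸ 1)
  cube-root⇒3∣ w w≢1 w³ =
    let ys , l , u , down , up = remove elements-unique (∈-elements 0#)
    in three-cycles (w *_) (q ℕ.∸ 1) ys (sym (cong (ℕ._∸ 1) (trans (sym length-elements) l))) u
      (λ {x} x∈ → up (∈-elements _) (*-nonzero w≢0 (proj₂ (down x∈))))
      (λ {x} x∈ → trans (solve 2 (λ w x → w :* (w :* (w :* x)) := w :* (w :* w) :* x) refl w x)
          (trans (cong (_* x) w³) (*-identityˡ x)) ,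
        λ e → w≢1 (*-cancelˡ (proj₂ (down x∈)) (trans (*-comm x w) (trans e (sym (*-identityʳ x))))))
    where
    w≢0 : w ≢ 0#
    w≢0 e = 1≢0 (trans (sym w³) (trans (cong (_* (w * w)) e) (zeroˡ _)))

  -- x ↦ 1 / (1 - x) permutes the elements other than 0 and 1 in cycles of
  -- length three, apart from the roots of x² - x + 1.
  cube-root-exists : ¬ (3 ∣ (q ℕ.∸ 2)) → CubeRoot K
  cube-root-exists 3∤ = decide (Fin.any? λ i → element i * element i - element i + 1# ≟ 0#)
    where
    f : Carrier → Carrier
    f x with 1# - x ≟ 0#
    ... | yes _ = x
    ... | no nz = proj₁ (divide (1# - x) 1# nz)

    f-value : ∀ x → 1# - x ≢ 0# → (1# - x) * f x ≡ 1#
    f-value x nz with 1# - x ≟ 0#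
    ... | yes e = ⊥-elim (nz e)
    ... | no nz′ = proj₂ (divide (1# - x) 1# nz′)

    1-x≢0 : ∀ {x} → x ≢ 1# → 1# - x ≢ 0#
    1-x≢0 x≢1 e = x≢1 (sym (x∙y⁻¹≈ε⇒x≈y _ _ e))

    f≢0 : ∀ {x} → x ≢ 1# → f x ≢ 0#
    f≢0 {x} x≢1 e = 1≢0 (trans (sym (f-value x (1-x≢0 x≢1))) (trans (cong ((1# - x) *_) e) (zeroʳ _)))

    f≢1 : ∀ {x} → x ≢ 0# → x ≢ 1# → f x ≢ 1#
    f≢1 {x} x≢0 x≢1 e = x≢0 (trans (solve 1 (λ x → x := con (1 , 0) :- (con (1 , 0) :- x) :* con (1 , 0)) refl x)
      (trans (cong (λ t → 1# - (1# - x) * t) (sym e)) (trans (cong (λ t → 1# - t) (f-value x (1-x≢0 x≢1))) (-‿inverseʳ 1#))))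

    cycle : ∀ {x y z t} → x ≢ 0# → (1# - x) * y ≡ 1# → (1# - y) * z ≡ 1# → (1# - z) * t ≡ 1# → t ≡ x
    cycle {x} {y} {z} {t} x≢0 e₁ e₂ e₃ = sym (begin
      x                        ≡⟨ sym (*-identityʳ x) ⟩
      x * 1#                   ≡⟨ cong (x *_) (sym e₃) ⟩
      x * ((1# - z) * t)       ≡⟨ solve 3 (λ x z t → x :* ((con (1 , 0) :- z) :* t) := (x :- x :* z) :* t) refl x z t ⟩
      (x - x * z) * t          ≡⟨ cong (λ s → (x - s) * t) xz ⟩
      (x - (x - 1#)) * t       ≡⟨ solve 2 (λ x t → (x :- (x :- con (1 , 0))) :* t := t) refl x t ⟩
      t                        ∎)
      where
      open ≡-Reasoning
      -- y - 1 = x y, hence -x y z = 1 and x z = x - 1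
      xy : x * y ≡ y - 1#
      xy = trans (solve 2 (λ x y → x :* y := y :- (con (1 , 0) :- x) :* y) refl x y) (cong (λ s → y - s) e₁)
      xyz : x * y * z ≡ - 1#
      xyz = trans (cong (_* z) xy) (trans (solve 2 (λ y z → (y :- con (1 , 0)) :* z := :- ((con (1 , 0) :- y) :* z)) refl y z) (cong -_ e₂))
      xz : x * z ≡ x - 1#
      xz = begin
        x * z                         ≡⟨ solve 2 (λ x z → x :* z := x :* z :* con (1 , 0)) refl x z ⟩
        x * z * 1#                    ≡⟨ cong (x * z *_) (sym e₁) ⟩
        x * z * ((1# - x) * y)        ≡⟨ solve 3 (λ x y z → x :* z :* ((con (1 , 0) :- x) :* y) := (con (1 , 0) :- x) :* (x :* y :* z)) refl x y z ⟩
        (1# - x) * (x * y * z)        ≡⟨ cong ((1# - x) *_) xyz ⟩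
        (1# - x) * - 1#               ≡⟨ solve 1 (λ x → (con (1 , 0) :- x) :* :- con (1 , 0) := x :- con (1 , 0)) refl x ⟩
        x - 1#                        ∎

    decide : Dec (∃ λ i → element i * element i - element i + 1# ≡ 0#) → CubeRoot K
    decide (yes (i , e)) = record
      { ω = - element i
      ; 1+ω+ω² = trans (solve 1 (λ x → con (1 , 0) :+ :- x :+ :- x :* :- x := x :* x :- x :+ con (1 , 0)) refl (element i)) e
      }
    decide (no none) = ⊥-elim (3∤ divisible)
      where
      fixed-free : ∀ {x} → x ≢ 1# → f x ≢ x
      fixed-free {x} x≢1 e = none (code x , subst (λ t → t * t - t + 1# ≡ 0#) (sym (element-code x))
        (trans (solve 1 (λ x → x :* x :- x :+ con (1 , 0) := con (1 , 0) :- (con (1 , 0) :- x) :* x) refl x)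
          (trans (cong (λ t → 1# - (1# - x) * t) (sym e)) (trans (cong (λ t → 1# - t) (f-value x (1-x≢0 x≢1))) (-‿inverseʳ 1#)))))
      divisible : 3 ∣ (q ℕ.∸ 2)
      divisible =
        let ys , l , u , down , up = remove elements-unique (∈-elements 0#)
            zs , l′ , u′ , down′ , up′ = remove u (up (∈-elements 1#) 1≢0)
            ≢0 : ∀ {x} → x ∈ zs → x ≢ 0#
            ≢0 x∈ = proj₂ (down (proj₁ (down′ x∈)))
            ≢1 : ∀ {x} → x ∈ zs → x ≢ 1#
            ≢1 x∈ = proj₂ (down′ x∈)
        in three-cycles f (q ℕ.∸ 2) zs
          (sym (cong (ℕ._∸ 2) (trans (sym length-elements) (trans l (cong suc l′))))) u′
          (λ x∈ → up′ (up (∈-elements _) (f≢0 (≢1 x∈))) (f≢1 (≢0 x∈) (≢1 x∈)))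
          (λ {x} x∈ →
            let y≢0 = f≢0 (≢1 x∈)
                y≢1 = f≢1 (≢0 x∈) (≢1 x∈)
                z≢1 = f≢1 y≢0 y≢1
            in cycle (≢0 x∈) (f-value x (1-x≢0 (≢1 x∈))) (f-value (f x) (1-x≢0 y≢1)) (f-value (f (f x)) (1-x≢0 z≢1)) ,
               fixed-free (≢1 x∈))

  1^n : ∀ n → 1# ^ n ≡ 1#
  1^n zero    = refl
  1^n (suc n) = trans (*-identityˡ _) (1^n n)

  common-exponent : ∀ (xs : List Carrier) → ∃ λ n → ∀ {x} → x ∈ xs → x ≢ 0# → x ^ suc n ≡ 1#
  common-exponent []       = 0 , λ ()
  common-exponent (a ∷ xs) = combine (a ≟ 0#) (common-exponent xs)
    where
    combine : Dec (a ≡ 0#) → (∃ λ n → ∀ {x} → x ∈ xs → x ≢ 0# → x ^ suc n ≡ 1#) →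
      ∃ λ n → ∀ {x} → x ∈ a ∷ xs → x ≢ 0# → x ^ suc n ≡ 1#
    combine (yes a≡0) (n , e) = n , λ { (here refl) x≢0 → ⊥-elim (x≢0 a≡0) ; (there x∈) x≢0 → e x∈ x≢0 }
    combine (no a≢0) (n , e) =
      let m , f = finite-order K a a≢0
      in n ℕ.+ m ℕ.* suc n , λ
        { (here refl) _ → trans (sym (^-assocʳ a (suc m) (suc n))) (trans (cong (_^ suc n) f) (1^n (suc n)))
        ; {x} (there x∈) x≢0 → trans (cong (x ^_) (ℕ.*-comm (suc m) (suc n)))
            (trans (sym (^-assocʳ x (suc n) (suc m))) (trans (cong (_^ suc m) (e x∈ x≢0)) (1^n (suc m)))) }

  module _ (R : CubeRoot K) (3≢0 : 3 ⋆ 1# ≢ 0#) where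
    open CubeRoot R

    ω≢1 : ω ≢ 1#
    ω≢1 e = 3≢0 (trans (solve 0 (con (1 , 0) :+ (con (1 , 0) :+ (con (1 , 0) :+ con (0 , 0))) := con (1 , 0) :+ con (1 , 0) :+ con (1 , 0) :* con (1 , 0)) refl)
      (trans (cong (λ w → 1# + w + w * w) (sym e)) 1+ω+ω²))

    ω²≢1 : ω * ω ≢ 1#
    ω²≢1 e = ω≢1 (trans (sym (*-identityʳ ω)) (trans (cong (ω *_) (sym e)) ω³))

    private
      root : Fin 3 → Carrier
      root 0F = 1#
      root 1F = ω
      root 2F = ω * ω

      root-injective : ∀ a b → root a ≡ root b → a ≡ b
      root-injective 0F 0F _ = refl
      root-injective 1F 1F _ = refl
      root-injective 2F 2F _ = refl
      root-injective 0F 1F e = ⊥-elim (ω≢1 (sym e))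
      root-injective 1F 0F e = ⊥-elim (ω≢1 e)
      root-injective 0F 2F e = ⊥-elim (ω²≢1 (sym e))
      root-injective 2F 0F e = ⊥-elim (ω²≢1 e)
      root-injective 1F 2F e = ⊥-elim (ω≢1 (*-cancelˡ (ω≢0 R) (trans (sym e) (sym (*-identityʳ ω)))))
      root-injective 2F 1F e = ⊥-elim (ω≢1 (*-cancelˡ (ω≢0 R) (trans e (sym (*-identityʳ ω)))))

      ω⁴ : ω * ω * (ω * ω) ≡ ω
      ω⁴ = trans (solve 1 (λ w → w :* w :* (w :* w) := w :* (w :* (w :* w))) refl ω) (trans (cong (ω *_) ω³) (*-identityʳ ω))

      root-⊕ : ∀ a b → root (a ⊕ b) ≡ root a * root b
      root-⊕ 0F b  = sym (*-identityˡ _)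
      root-⊕ 1F 0F = sym (*-identityʳ _)
      root-⊕ 1F 1F = refl
      root-⊕ 1F 2F = sym ω³
      root-⊕ 2F 0F = sym (*-identityʳ _)
      root-⊕ 2F 1F = sym (trans (*-comm _ _) ω³)
      root-⊕ 2F 2F = sym ω⁴

      cube-roots : ∀ z → z ^ 3 ≡ 1# → ∃ λ a → root a ≡ z
      cube-roots z z³ = cases (integral (z - 1#) ((z - ω) * (z - ω * ω)) product≡0)
        where
        open ≡-Reasoning
        product≡0 : (z - 1#) * ((z - ω) * (z - ω * ω)) ≡ 0#
        product≡0 = begin
          (z - 1#) * ((z - ω) * (z - ω * ω))
            ≡⟨ solve 2 (λ z w → (z :- con (1 , 0)) :* ((z :- w) :* (z :- w :* w)) :=
                 z :* (z :* z) :- w :* (w :* w) :- (con (1 , 0) :+ w :+ w :* w) :* (z :* z :- w :* z)) refl z ω ⟩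
          z * (z * z) - ω * (ω * ω) - (1# + ω + ω * ω) * (z * z - ω * z)
            ≡⟨ cong₂ (λ s t → z * (z * z) - s - t * (z * z - ω * z)) ω³ 1+ω+ω² ⟩
          z * (z * z) - 1# - 0# * (z * z - ω * z)
            ≡⟨ cong (λ s → s - 1# - 0# * (z * z - ω * z)) (trans (cong (λ t → z * (z * t)) (sym (*-identityʳ z))) z³) ⟩
          1# - 1# - 0# * (z * z - ω * z)
            ≡⟨ solve 1 (λ t → con (1 , 0) :- con (1 , 0) :- con (0 , 0) :* t := con (0 , 0)) refl (z * z - ω * z) ⟩
          0# ∎
        cases : z - 1# ≡ 0# ⊎ (z - ω) * (z - ω * ω) ≡ 0# → ∃ λ a → root a ≡ z
        cases (inj₁ e) = 0F , sym (x∙y⁻¹≈ε⇒x≈y _ _ e)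
        cases (inj₂ e) = [ (λ e → 1F , sym (x∙y⁻¹≈ε⇒x≈y _ _ e)) , (λ e → 2F , sym (x∙y⁻¹≈ε⇒x≈y _ _ e)) ]′ (integral _ _ e)

      Exponent : ℕ → Set
      Exponent n = ∀ x → x ≢ 0# → x ^ n ≡ 1#

      exponent? : ∀ n → Dec (∀ i → element i ≢ 0# → element i ^ n ≡ 1#)
      exponent? n = Fin.all? λ i → ¬? (element i ≟ 0#) →-dec (element i ^ n ≟ 1#)

      ω^3k : ∀ k → ω ^ (k ℕ.* 3) ≡ 1#
      ω^3k k = trans (cong (ω ^_) (ℕ.*-comm k 3)) (trans (sym (^-assocʳ ω 3 k)) (trans (cong (_^ k) (trans (cong (λ t → ω * (ω * t)) (*-identityʳ ω)) ω³)) (1^n k)))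

      -- Since ω has order three and its n-th power is 1, the exponent n is a multiple of 3.
      third-of : ∀ n → Exponent n → n ≡ (n / 3) ℕ.* 3
      third-of n ex = trans n≡ (cong (ℕ._+ (n / 3) ℕ.* 3) (residue (n % 3) refl (m%n<n n 3)))
        where
        n≡ = m≡m%n+[m/n]*n n 3
        ω^r : ω ^ (n % 3) ≡ 1#
        ω^r = trans (sym (*-identityʳ _)) (trans (cong (ω ^ (n % 3) *_) (sym (ω^3k (n / 3))))
          (trans (sym (^-homo-* ω (n % 3) ((n / 3) ℕ.* 3))) (trans (cong (ω ^_) (sym n≡)) (ex ω (ω≢0 R)))))
        residue : ∀ t → t ≡ n % 3 → t < 3 → n % 3 ≡ 0
        residue 0 e _ = sym e
        residue 1 e _ = ⊥-elim (ω≢1 (trans (sym (*-identityʳ ω)) (trans (cong (ω ^_) e) ω^r)))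
        residue 2 e _ = ⊥-elim (ω²≢1 (trans (sym (cong (ω *_) (*-identityʳ ω))) (trans (cong (ω ^_) e) ω^r)))
        residue (suc (suc (suc _))) _ (s≤s (s≤s (s≤s ())))

      -- For such an m, the power map x ↦ xᵐ takes values among the cube roots of unity and is not
      -- constant, so its exponent of ω is a cubic character. Dividing a common exponent of all
      -- nonzero elements by 3 as long as it remains one leads to such an m.
      Depth : Set
      Depth = ∃ λ m → Exponent (m ℕ.* 3) × ∃ λ g → g ≢ 0# × g ^ m ≢ 1#

      descend : ∀ n → 0 < n → Exponent n → Depth
      descend = <-rec _ step
        where
        step : ∀ n → (∀ {m} → m < n → 0 < m → Exponent m → Depth) → 0 < n → Exponent n → Depth
        step n rec 0<n ex = cases (exponent? m)
          where
          m = n / 3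
          n≡ : n ≡ m ℕ.* 3
          n≡ = third-of n ex
          0<m : ∀ k → n ≡ k ℕ.* 3 → 0 < k
          0<m zero    e = ⊥-elim (ℕ.n≮0 (subst (0 <_) e 0<n))
          0<m (suc k) e = s≤s z≤n
          m<n : ∀ k → 0 < k → n ≡ k ℕ.* 3 → k < n
          m<n (suc k) _ e = subst (suc k <_) (sym e) (ℕ.m<m*n (suc k) 3 (s≤s (s≤s z≤n)))
          cases : Dec (∀ i → element i ≢ 0# → element i ^ m ≡ 1#) → Depth
          cases (yes all) = rec (m<n m (0<m m n≡) n≡) (0<m m n≡)
            λ x x≢0 → subst (λ t → t ≢ 0# → t ^ m ≡ 1#) (element-code x) (all (code x)) x≢0
          cases (no some) =
            let i , ¬p = Fin.¬∀⟶∃¬ q _ (λ i → ¬? (element i ≟ 0#) →-dec (element i ^ m ≟ 1#)) some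
            in m , subst Exponent n≡ ex , element i ,
               (λ e → ¬p λ nz → ⊥-elim (nz e)) , λ e → ¬p λ _ → e

      depth : Depth
      depth = let n , e = common-exponent elements in descend (suc n) (s≤s z≤n) λ x x≢0 → e (∈-elements x) x≢0

      m = proj₁ depth

      power-root : ∀ x → x ≢ 0# → ∃ λ a → root a ≡ x ^ m
      power-root x x≢0 = cube-roots (x ^ m) (trans (^-assocʳ x m 3) (proj₁ (proj₂ depth) x x≢0))

      χ′ : ∀ x → Dec (x ≡ 0#) → Fin 3
      χ′ x (yes _)  = 0F
      χ′ x (no x≢0) = proj₁ (power-root x x≢0)

      root-χ : ∀ x (d : Dec (x ≡ 0#)) → x ≢ 0# → root (χ′ x d) ≡ x ^ m
      root-χ x (yes e)  x≢0 = ⊥-elim (x≢0 e)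
      root-χ x (no nz)  _   = proj₂ (power-root x nz)

      χ″ : Carrier → Fin 3
      χ″ x = χ′ x (x ≟ 0#)

      multiplicative : ∀ {x y} → x ≢ 0# → y ≢ 0# → χ″ (x * y) ≡ χ″ x ⊕ χ″ y
      multiplicative {x} {y} x≢0 y≢0 = root-injective (χ″ (x * y)) (χ″ x ⊕ χ″ y) (begin
        root (χ″ (x * y))          ≡⟨ root-χ (x * y) (x * y ≟ 0#) (*-nonzero x≢0 y≢0) ⟩
        (x * y) ^ m                ≡⟨ Exp.^-distrib-* (CommutativeRing.commutativeSemiring commutativeRing) x y m ⟩
        x ^ m * y ^ m              ≡⟨ cong₂ _*_ (sym (root-χ x (x ≟ 0#) x≢0)) (sym (root-χ y (y ≟ 0#) y≢0)) ⟩
        root (χ″ x) * root (χ″ y)  ≡⟨ sym (root-⊕ (χ″ x) (χ″ y)) ⟩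
        root (χ″ x ⊕ χ″ y)         ∎)
        where open ≡-Reasoning

    cubicCharacter : CubicCharacter K
    cubicCharacter = record { χ = χ″ ; χ-* = multiplicative ; nontrivial = find (χ″ g) refl }
      where
      g = proj₁ (proj₂ (proj₂ depth))
      g≢0 = proj₁ (proj₂ (proj₂ (proj₂ depth)))
      find : ∀ a → χ″ g ≡ a → ∃ λ g → g ≢ 0# × χ″ g ≡ 1F
      find 0F e = ⊥-elim (proj₂ (proj₂ (proj₂ (proj₂ depth))) (trans (sym (root-χ g (g ≟ 0#) g≢0)) (cong root e)))
      find 1F e = g , g≢0 , e
      find 2F e = g * g , *-nonzero g≢0 g≢0 , trans (multiplicative g≢0 g≢0) (cong₂ _⊕_ e e)

-- Construction of the fields

module Modular (n : ℕ) .{{_ : NonZero n}} where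

  [_] : ℕ → Fin n
  [ m ] = fromℕ< (m%n<n m n)

  toℕ-[] : ∀ m → toℕ [ m ] ≡ m % n
  toℕ-[] m = Fin.toℕ-fromℕ< (m%n<n m n)

  0%n≡0 : 0 % n ≡ 0
  0%n≡0 = m<n⇒m%n≡m (ℕ.>-nonZero⁻¹ n)

  []-cong : ∀ {a b} → a % n ≡ b % n → [ a ] ≡ [ b ]
  []-cong {a} {b} e = Fin.toℕ-injective (trans (toℕ-[] a) (trans e (sym (toℕ-[] b))))

  []-toℕ : ∀ x → [ toℕ x ] ≡ x
  []-toℕ x = Fin.toℕ-injective (trans (toℕ-[] (toℕ x)) (m<n⇒m%n≡m (Fin.toℕ<n x)))

  infixl 6 _+_
  infixl 7 _*_
  infix 8 -_
  _+_ _*_ : Fin n → Fin n → Fin n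
  x + y = [ toℕ x ℕ.+ toℕ y ]
  x * y = [ toℕ x ℕ.* toℕ y ]

  -_ : Fin n → Fin n
  - x = [ n ∸ toℕ x ]

  []-+ : ∀ a b → [ a ] + [ b ] ≡ [ a ℕ.+ b ]
  []-+ a b = []-cong (trans (cong₂ (λ s t → (s ℕ.+ t) % n) (toℕ-[] a) (toℕ-[] b)) (sym (%-distribˡ-+ a b n)))

  []-* : ∀ a b → [ a ] * [ b ] ≡ [ a ℕ.* b ]
  []-* a b = []-cong (trans (cong₂ (λ s t → (s ℕ.* t) % n) (toℕ-[] a) (toℕ-[] b)) (sym (%-distribˡ-* a b n)))

  private
    -- Since x ≡ [ toℕ x ], the ring laws are those of ℕ.
    +-right : ∀ x b → x + [ b ] ≡ [ toℕ x ℕ.+ b ]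
    +-right x b = trans (cong (_+ [ b ]) (sym ([]-toℕ x))) ([]-+ (toℕ x) b)
    +-left : ∀ a y → [ a ] + y ≡ [ a ℕ.+ toℕ y ]
    +-left a y = trans (cong ([ a ] +_) (sym ([]-toℕ y))) ([]-+ a (toℕ y))
    *-right : ∀ x b → x * [ b ] ≡ [ toℕ x ℕ.* b ]
    *-right x b = trans (cong (_* [ b ]) (sym ([]-toℕ x))) ([]-* (toℕ x) b)
    *-left : ∀ a y → [ a ] * y ≡ [ a ℕ.* toℕ y ]
    *-left a y = trans (cong ([ a ] *_) (sym ([]-toℕ y))) ([]-* a (toℕ y))

    +-comm : ∀ x y → x + y ≡ y + x
    +-comm x y = cong [_] (ℕ.+-comm (toℕ x) (toℕ y))
    *-comm : ∀ x y → x * y ≡ y * x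
    *-comm x y = cong [_] (ℕ.*-comm (toℕ x) (toℕ y))
    +-assoc : ∀ x y z → (x + y) + z ≡ x + (y + z)
    +-assoc x y z = trans (+-left _ z) (trans (cong [_] (ℕ.+-assoc (toℕ x) (toℕ y) (toℕ z))) (sym (+-right x _)))
    *-assoc : ∀ x y z → (x * y) * z ≡ x * (y * z)
    *-assoc x y z = trans (*-left _ z) (trans (cong [_] (ℕ.*-assoc (toℕ x) (toℕ y) (toℕ z))) (sym (*-right x _)))
    +-identityˡ : ∀ x → [ 0 ] + x ≡ x
    +-identityˡ x = trans (+-left 0 x) ([]-toℕ x)
    *-identityˡ : ∀ x → [ 1 ] * x ≡ x
    *-identityˡ x = trans (*-left 1 x) (trans (cong [_] (ℕ.*-identityˡ (toℕ x))) ([]-toℕ x))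
    -‿inverseʳ : ∀ x → x + (- x) ≡ [ 0 ]
    -‿inverseʳ x = trans (+-right x _) ([]-cong (trans (cong (_% n) (ℕ.m+[n∸m]≡n (ℕ.<⇒≤ (Fin.toℕ<n x)))) (trans (n%n≡0 n) (sym 0%n≡0))))
    distribˡ : ∀ x y z → x * (y + z) ≡ x * y + x * z
    distribˡ x y z = trans (*-right x _) (trans (cong [_] (ℕ.*-distribˡ-+ (toℕ x) (toℕ y) (toℕ z))) (sym ([]-+ _ _)))

  isCommutativeRing : IsCommutativeRing _≡_ _+_ _*_ -_ [ 0 ] [ 1 ]
  isCommutativeRing = record
    { isRing = record
      { +-isAbelianGroup = record
        { isGroup = record
          { isMonoid = record
            { isSemigroup = record
              { isMagma = record { isEquivalence = isEquivalence ; ∙-cong = cong₂ _+_ }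
              ; assoc = +-assoc
              }
            ; identity = +-identityˡ , λ x → trans (+-comm x _) (+-identityˡ x)
            }
          ; inverse = (λ x → trans (+-comm _ x) (-‿inverseʳ x)) , -‿inverseʳ
          ; ⁻¹-cong = cong -_
          }
        ; comm = +-comm
        }
      ; *-cong = cong₂ _*_
      ; *-assoc = *-assoc
      ; *-identity = *-identityˡ , λ x → trans (*-comm x _) (*-identityˡ x)
      ; distrib = distribˡ , λ x y z → trans (*-comm _ x) (trans (distribˡ x y z) (cong₂ _+_ (*-comm x y) (*-comm x z)))
      }
    ; *-comm = *-comm
    }

primeField : ∀ {p} → Prime p → FiniteField p
primeField {p} pr = record
  { isCommutativeRing = isCommutativeRing
  ; 1≢0 = λ e → 1≢0 (trans (sym (m<n⇒m%n≡m (ℕ.nonTrivial⇒n>1 p {{prime⇒nonTrivial pr}}))) (trans (sym (toℕ-[] 1)) (trans (cong toℕ e) (trans (toℕ-[] 0) 0%n≡0))))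
  ; integral = λ x y e → Sum.map (zero-divisor x) (zero-divisor y)
      (euclidsLemma (toℕ x) (toℕ y) pr (m%n≡0⇒n∣m _ p (trans (sym (toℕ-[] _)) (trans (cong toℕ e) (trans (toℕ-[] 0) 0%n≡0)))))
  ; enumeration = ↔-id _
  }
  where
  instance
    nonZero : NonZero p
    nonZero = prime⇒nonZero pr
  open Modular p
  1≢0 : 1 ≢ 0
  1≢0 ()
  small : ∀ {m} → p ∣ m → m < p → m ≡ 0
  small {zero}  d m<p = refl
  small {suc m} d m<p = ⊥-elim (ℕ.<⇒≱ m<p (∣⇒≤ d))
  zero-divisor : ∀ x → p ∣ toℕ x → x ≡ [ 0 ]
  zero-divisor x d = trans (sym ([]-toℕ x)) (cong [_] (small d (Fin.toℕ<n x)))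

primeField-numeral : ∀ {p} (pr : Prime p) m →
  let open FiniteField (primeField pr); instance _ = prime⇒nonZero pr in m ⋆ 1# ≡ Modular.[_] p m
primeField-numeral pr zero    = refl
primeField-numeral {p} pr (suc m) = trans (cong (Modular._+_ p (Modular.[_] p 1)) (primeField-numeral pr m)) (Modular.[]-+ p 1 m)
  where instance _ = prime⇒nonZero pr

-- K[t] / (t² - a t - b)
module _ {q} (K : FiniteField q) (a b : FiniteField.Carrier K) where
  open FiniteField K
  open Solver K using (solve; _:*_; _:-_; _:+_; :-_; _:=_; con)

  quadraticExtension : (∀ x → x * x ≢ a * x + b) → FiniteField (q ℕ.* q)
  quadraticExtension irreducible = record
    { Carrier = Carrier × Carrier
    ; _+_ = λ (x , y) (z , w) → x + z , y + w
    ; _*_ = _·_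
    ; -_ = λ (x , y) → - x , - y
    ; 0# = 0# , 0#
    ; 1# = 1# , 0#
    ; isCommutativeRing = record
      { isRing = record
        { +-isAbelianGroup = FiniteAbelianGroup.isAbelianGroup (additiveGroup ⊗ additiveGroup)
        ; *-cong = cong₂ _·_
        ; *-assoc = λ (x , y) (z , w) (u , v) → cong₂ _,_ (assoc₁ x y z w u v a b) (assoc₂ x y z w u v a b)
        ; *-identity = (λ (x , y) → cong₂ _,_ (idˡ₁ x y) (idˡ₂ x y))
                     , (λ (x , y) → cong₂ _,_ (idʳ₁ x y) (idʳ₂ x y))
        ; distrib = (λ (x , y) (z , w) (u , v) → cong₂ _,_ (distˡ₁ x y z w u v) (distˡ₂ x y z w u v))
                  , (λ (x , y) (z , w) (u , v) → cong₂ _,_ (distʳ₁ x y z w u v) (distʳ₂ x y z w u v))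
        }
      ; *-comm = λ (x , y) (z , w) → cong₂ _,_ (comm₁ x y z w) (comm₂ x y z w)
      }
    ; 1≢0 = λ e → 1≢0 (cong proj₁ e)
    ; integral = integral′
    ; enumeration = (enumeration ×-↔ enumeration) ↔-∘ Fin.*↔×
    }
    where
    infixl 7 _·_
    _·_ : Carrier × Carrier → Carrier × Carrier → Carrier × Carrier
    (x , y) · (z , w) = x * z + b * (y * w) , x * w + y * z + a * (y * w)

    assoc₁ : ∀ x y z w u v a b →
      (x * z + b * (y * w)) * u + b * ((x * w + y * z + a * (y * w)) * v) ≡
      x * (z * u + b * (w * v)) + b * (y * (z * v + w * u + a * (w * v)))
    assoc₁ = solve 8 (λ x y z w u v a b →
      (x :* z :+ b :* (y :* w)) :* u :+ b :* ((x :* w :+ y :* z :+ a :* (y :* w)) :* v) :=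
      x :* (z :* u :+ b :* (w :* v)) :+ b :* (y :* (z :* v :+ w :* u :+ a :* (w :* v)))) refl
    assoc₂ : ∀ x y z w u v a b →
      (x * z + b * (y * w)) * v + (x * w + y * z + a * (y * w)) * u + a * ((x * w + y * z + a * (y * w)) * v) ≡
      x * (z * v + w * u + a * (w * v)) + y * (z * u + b * (w * v)) + a * (y * (z * v + w * u + a * (w * v)))
    assoc₂ = solve 8 (λ x y z w u v a b →
      (x :* z :+ b :* (y :* w)) :* v :+ (x :* w :+ y :* z :+ a :* (y :* w)) :* u :+ a :* ((x :* w :+ y :* z :+ a :* (y :* w)) :* v) :=
      x :* (z :* v :+ w :* u :+ a :* (w :* v)) :+ y :* (z :* u :+ b :* (w :* v)) :+ a :* (y :* (z :* v :+ w :* u :+ a :* (w :* v)))) refl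
    idˡ₁ : ∀ x y → 1# * x + b * (0# * y) ≡ x
    idˡ₁ x y = solve 3 (λ x y b → con (1 , 0) :* x :+ b :* (con (0 , 0) :* y) := x) refl x y b
    idˡ₂ : ∀ x y → 1# * y + 0# * x + a * (0# * y) ≡ y
    idˡ₂ x y = solve 3 (λ x y a → con (1 , 0) :* y :+ con (0 , 0) :* x :+ a :* (con (0 , 0) :* y) := y) refl x y a
    comm₁ : ∀ x y z w → x * z + b * (y * w) ≡ z * x + b * (w * y)
    comm₁ x y z w = solve 5 (λ x y z w b → x :* z :+ b :* (y :* w) := z :* x :+ b :* (w :* y)) refl x y z w b
    comm₂ : ∀ x y z w → x * w + y * z + a * (y * w) ≡ z * y + w * x + a * (w * y)
    comm₂ x y z w = solve 5 (λ x y z w a → x :* w :+ y :* z :+ a :* (y :* w) := z :* y :+ w :* x :+ a :* (w :* y)) refl x y z w a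
    idʳ₁ : ∀ x y → x * 1# + b * (y * 0#) ≡ x
    idʳ₁ x y = trans (comm₁ x y 1# 0#) (idˡ₁ x y)
    idʳ₂ : ∀ x y → x * 0# + y * 1# + a * (y * 0#) ≡ y
    idʳ₂ x y = trans (comm₂ x y 1# 0#) (idˡ₂ x y)
    distˡ₁ : ∀ x y z w u v → x * (z + u) + b * (y * (w + v)) ≡ x * z + b * (y * w) + (x * u + b * (y * v))
    distˡ₁ x y z w u v = solve 7 (λ x y z w u v b → x :* (z :+ u) :+ b :* (y :* (w :+ v)) :=
      x :* z :+ b :* (y :* w) :+ (x :* u :+ b :* (y :* v))) refl x y z w u v b
    distˡ₂ : ∀ x y z w u v → x * (w + v) + y * (z + u) + a * (y * (w + v)) ≡
      x * w + y * z + a * (y * w) + (x * v + y * u + a * (y * v))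
    distˡ₂ x y z w u v = solve 7 (λ x y z w u v a → x :* (w :+ v) :+ y :* (z :+ u) :+ a :* (y :* (w :+ v)) :=
      x :* w :+ y :* z :+ a :* (y :* w) :+ (x :* v :+ y :* u :+ a :* (y :* v))) refl x y z w u v a
    distʳ₁ : ∀ x y z w u v → (z + u) * x + b * ((w + v) * y) ≡ z * x + b * (w * y) + (u * x + b * (v * y))
    distʳ₁ x y z w u v = solve 7 (λ x y z w u v b → (z :+ u) :* x :+ b :* ((w :+ v) :* y) :=
      z :* x :+ b :* (w :* y) :+ (u :* x :+ b :* (v :* y))) refl x y z w u v b
    distʳ₂ : ∀ x y z w u v → (z + u) * y + (w + v) * x + a * ((w + v) * y) ≡
      z * y + w * x + a * (w * y) + (u * y + v * x + a * (v * y))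
    distʳ₂ x y z w u v = solve 7 (λ x y z w u v a → (z :+ u) :* y :+ (w :+ v) :* x :+ a :* ((w :+ v) :* y) :=
      z :* y :+ w :* x :+ a :* (w :* y) :+ (u :* y :+ v :* x :+ a :* (v :* y))) refl x y z w u v a

    -- The norm of x + y t. If it vanishes and y ≠ 0, then -x / y is a root of t² - a t - b; hence
    -- only zero has norm zero, and multiplicativity excludes zero divisors.
    norm : Carrier × Carrier → Carrier
    norm (x , y) = x * x + a * (x * y) - b * (y * y)

    norm-zero : ∀ x → norm x ≡ 0# → x ≡ (0# , 0#)
    norm-zero (x , y) e = cases (y ≟ 0#)
      where
      cases : Dec (y ≡ 0#) → (x , y) ≡ (0# , 0#)
      cases (yes refl) = cong (_, 0#) ([ (λ x≡0 → x≡0) , (λ x≡0 → x≡0) ]′ (integral x x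
        (trans (solve 3 (λ x a b → x :* x := x :* x :+ a :* (x :* con (0 , 0)) :- b :* (con (0 , 0) :* con (0 , 0))) refl x a b) e)))
      cases (no y≢0) = ⊥-elim (irreducible s (*-cancelˡ (*-nonzero y≢0 y≢0) (begin
        y * y * (s * s)         ≡⟨ solve 2 (λ y s → y :* y :* (s :* s) := y :* s :* (y :* s)) refl y s ⟩
        y * s * (y * s)         ≡⟨ cong₂ _*_ es es ⟩
        - x * - x               ≡⟨ solve 4 (λ x y a b → :- x :* :- x := a :* (y :* :- x) :+ b :* (y :* y) :+ (x :* x :+ a :* (x :* y) :- b :* (y :* y))) refl x y a b ⟩
        a * (y * - x) + b * (y * y) + norm (x , y) ≡⟨ cong (a * (y * - x) + b * (y * y) +_) e ⟩
        a * (y * - x) + b * (y * y) + 0# ≡⟨ +-identityʳ _ ⟩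
        a * (y * - x) + b * (y * y) ≡⟨ cong (λ t → a * (y * t) + b * (y * y)) (sym es) ⟩
        a * (y * (y * s)) + b * (y * y) ≡⟨ solve 4 (λ y s a b → a :* (y :* (y :* s)) :+ b :* (y :* y) := y :* y :* (a :* s :+ b)) refl y s a b ⟩
        y * y * (a * s + b)     ∎)))
        where
        open ≡-Reasoning
        s = proj₁ (divide y (- x) y≢0)
        es = proj₂ (divide y (- x) y≢0)

    norm-* : ∀ x y z w → norm ((x , y) · (z , w)) ≡ norm (x , y) * norm (z , w)
    norm-* x y z w = solve 6 (λ x y z w a b →
      let r = x :* z :+ b :* (y :* w) ; s = x :* w :+ y :* z :+ a :* (y :* w) in
      r :* r :+ a :* (r :* s) :- b :* (s :* s) :=
      (x :* x :+ a :* (x :* y) :- b :* (y :* y)) :* (z :* z :+ a :* (z :* w) :- b :* (w :* w))) refl x y z w a b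

    integral′ : ∀ x y → x · y ≡ (0# , 0#) → x ≡ (0# , 0#) ⊎ y ≡ (0# , 0#)
    integral′ x y e = Sum.map (norm-zero x) (norm-zero y) (integral (norm x) (norm y)
      (trans (sym (norm-* (proj₁ x) (proj₂ x) (proj₁ y) (proj₂ y))) (trans (cong norm e)
        (solve 2 (λ a b → con (0 , 0) :* con (0 , 0) :+ a :* (con (0 , 0) :* con (0 , 0)) :- b :* (con (0 , 0) :* con (0 , 0)) := con (0 , 0)) refl a b))))

-- K[t] / (t³ - b)
module _ {q} (K : FiniteField q) (b : FiniteField.Carrier K) where
  open FiniteField K
  open Solver K using (solve; _:*_; _:-_; _:+_; :-_; _:=_; con)

  -- This is x³ + b y³ + b² z³ - 3 b x y z, the norm of x + y t + z t², grouped by the coordinates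
  -- of the adjugate element.
  norm₃ : Carrier → Carrier → Carrier → Carrier
  norm₃ x y z = x * (x * x - b * (y * z)) + b * (y * (y * y - x * z)) + b * (z * (b * (z * z) - x * y))

  cubicExtension : (∀ x y z → norm₃ x y z ≡ 0# → x ≡ 0# × y ≡ 0# × z ≡ 0#) → FiniteField (q ℕ.* (q ℕ.* q))
  cubicExtension anisotropic = record
    { Carrier = Carrier × Carrier × Carrier
    ; _+_ = λ (x , y , z) (u , v , w) → x + u , y + v , z + w
    ; _*_ = _·_
    ; -_ = λ (x , y , z) → - x , - y , - z
    ; 0# = 0# , 0# , 0#
    ; 1# = 1# , 0# , 0#
    ; isCommutativeRing = record
      { isRing = record
        { +-isAbelianGroup = FiniteAbelianGroup.isAbelianGroup (additiveGroup ⊗ (additiveGroup ⊗ additiveGroup))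
        ; *-cong = cong₂ _·_
        ; *-assoc = λ (x , y , z) (u , v , w) (r , s , t) → triple
            (solve 10 (λ x y z u v w r s t b →
              let l = x :* u :+ b :* (y :* w :+ z :* v) ; m = x :* v :+ y :* u :+ b :* (z :* w) ; n = x :* w :+ y :* v :+ z :* u
                  l′ = u :* r :+ b :* (v :* t :+ w :* s) ; m′ = u :* s :+ v :* r :+ b :* (w :* t) ; n′ = u :* t :+ v :* s :+ w :* r in
              l :* r :+ b :* (m :* t :+ n :* s) := x :* l′ :+ b :* (y :* n′ :+ z :* m′)) refl x y z u v w r s t b)
            (solve 10 (λ x y z u v w r s t b →
              let l = x :* u :+ b :* (y :* w :+ z :* v) ; m = x :* v :+ y :* u :+ b :* (z :* w) ; n = x :* w :+ y :* v :+ z :* u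
                  l′ = u :* r :+ b :* (v :* t :+ w :* s) ; m′ = u :* s :+ v :* r :+ b :* (w :* t) ; n′ = u :* t :+ v :* s :+ w :* r in
              l :* s :+ m :* r :+ b :* (n :* t) := x :* m′ :+ y :* l′ :+ b :* (z :* n′)) refl x y z u v w r s t b)
            (solve 10 (λ x y z u v w r s t b →
              let l = x :* u :+ b :* (y :* w :+ z :* v) ; m = x :* v :+ y :* u :+ b :* (z :* w) ; n = x :* w :+ y :* v :+ z :* u
                  l′ = u :* r :+ b :* (v :* t :+ w :* s) ; m′ = u :* s :+ v :* r :+ b :* (w :* t) ; n′ = u :* t :+ v :* s :+ w :* r in
              l :* t :+ m :* s :+ n :* r := x :* n′ :+ y :* m′ :+ z :* l′) refl x y z u v w r s t b)
        ; *-identity = one·_ , λ x → trans (commutes x one) (one· x)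
        ; distrib = distributes , λ x y z → trans (commutes (y ⊞′ z) x) (trans (distributes x y z)
            (cong₂ _⊞′_ (commutes x y) (commutes x z)))
        }
      ; *-comm = commutes
      }
    ; 1≢0 = λ e → 1≢0 (cong proj₁ e)
    ; integral = integral′
    ; enumeration = (enumeration ×-↔ ((enumeration ×-↔ enumeration) ↔-∘ Fin.*↔×)) ↔-∘ Fin.*↔×
    }
    where
    L : Set
    L = Carrier × Carrier × Carrier
    triple : ∀ {x y z u v w : Carrier} → x ≡ u → y ≡ v → z ≡ w → (x , y , z) ≡ (u , v , w)
    triple refl refl refl = refl
    infixl 7 _·_
    _·_ _⊞′_ : L → L → L
    (x , y , z) · (u , v , w) = x * u + b * (y * w + z * v) , x * v + y * u + b * (z * w) , x * w + y * v + z * u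
    (x , y , z) ⊞′ (u , v , w) = x + u , y + v , z + w
    one : L
    one = 1# , 0# , 0#
    commutes : ∀ x y → x · y ≡ y · x
    commutes (x , y , z) (u , v , w) = triple
      (solve 7 (λ x y z u v w b → x :* u :+ b :* (y :* w :+ z :* v) := u :* x :+ b :* (v :* z :+ w :* y)) refl x y z u v w b)
      (solve 7 (λ x y z u v w b → x :* v :+ y :* u :+ b :* (z :* w) := u :* y :+ v :* x :+ b :* (w :* z)) refl x y z u v w b)
      (solve 6 (λ x y z u v w → x :* w :+ y :* v :+ z :* u := u :* z :+ v :* y :+ w :* x) refl x y z u v w)
    one·_ : ∀ x → one · x ≡ x
    one· (u , v , w) = triple
      (solve 4 (λ u v w b → con (1 , 0) :* u :+ b :* (con (0 , 0) :* w :+ con (0 , 0) :* v) := u) refl u v w b)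
      (solve 4 (λ u v w b → con (1 , 0) :* v :+ con (0 , 0) :* u :+ b :* (con (0 , 0) :* w) := v) refl u v w b)
      (solve 3 (λ u v w → con (1 , 0) :* w :+ con (0 , 0) :* v :+ con (0 , 0) :* u := w) refl u v w)
    distributes : ∀ x y z → x · (y ⊞′ z) ≡ (x · y) ⊞′ (x · z)
    distributes (x , y , z) (u , v , w) (r , s , t) = triple
      (solve 10 (λ x y z u v w r s t b → x :* (u :+ r) :+ b :* (y :* (w :+ t) :+ z :* (v :+ s)) :=
        x :* u :+ b :* (y :* w :+ z :* v) :+ (x :* r :+ b :* (y :* t :+ z :* s))) refl x y z u v w r s t b)
      (solve 10 (λ x y z u v w r s t b → x :* (v :+ s) :+ y :* (u :+ r) :+ b :* (z :* (w :+ t)) :=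
        x :* v :+ y :* u :+ b :* (z :* w) :+ (x :* s :+ y :* r :+ b :* (z :* t))) refl x y z u v w r s t b)
      (solve 9 (λ x y z u v w r s t → x :* (w :+ t) :+ y :* (v :+ s) :+ z :* (u :+ r) :=
        x :* w :+ y :* v :+ z :* u :+ (x :* t :+ y :* s :+ z :* r)) refl x y z u v w r s t)

    -- norm₃ x times y is the product of the adjugate of x with x · y.
    scaled : ∀ x y z u v w → (x , y , z) · (u , v , w) ≡ (0# , 0# , 0#) →
      norm₃ x y z * u ≡ 0# × norm₃ x y z * v ≡ 0# × norm₃ x y z * w ≡ 0#
    scaled x y z u v w e =
      trans (solve 7 (λ x y z u v w b → N x y z b :* u := F x y z u v w b) refl x y z u v w b) (vanish F′ e zeroF) ,
      trans (solve 7 (λ x y z u v w b → N x y z b :* v := G x y z u v w b) refl x y z u v w b) (vanish G′ e zeroG) ,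
      trans (solve 7 (λ x y z u v w b → N x y z b :* w := H x y z u v w b) refl x y z u v w b) (vanish H′ e zeroH)
      where
      -- As solver expressions: `N` is the norm, `A`, `B`, `C` are the coordinates of the adjugate,
      -- `P`, `Q`, `S` those of the given product, and `F`, `G`, `H` those of the adjugate times
      -- this product.
      N = λ x y z b → x :* (x :* x :- b :* (y :* z)) :+ b :* (y :* (y :* y :- x :* z)) :+ b :* (z :* (b :* (z :* z) :- x :* y))
      A = λ x y z b → x :* x :- b :* (y :* z)
      B = λ x y z b → b :* (z :* z) :- x :* y
      C = λ x y z b → y :* y :- x :* z
      P = λ x y z u v w b → x :* u :+ b :* (y :* w :+ z :* v)
      Q = λ x y z u v w b → x :* v :+ y :* u :+ b :* (z :* w)
      S = λ x y z u v w b → x :* w :+ y :* v :+ z :* u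
      F = λ x y z u v w b → A x y z b :* P x y z u v w b :+ b :* (B x y z b :* S x y z u v w b :+ C x y z b :* Q x y z u v w b)
      G = λ x y z u v w b → A x y z b :* Q x y z u v w b :+ B x y z b :* P x y z u v w b :+ b :* (C x y z b :* S x y z u v w b)
      H = λ x y z u v w b → A x y z b :* S x y z u v w b :+ B x y z b :* Q x y z u v w b :+ C x y z b :* P x y z u v w b
      α = x * x - b * (y * z)
      β = b * (z * z) - x * y
      γ = y * y - x * z
      F′ G′ H′ : L → Carrier
      F′ (p , q , s) = α * p + b * (β * s + γ * q)
      G′ (p , q , s) = α * q + β * p + b * (γ * s)
      H′ (p , q , s) = α * s + β * q + γ * p
      zeroF : F′ (0# , 0# , 0#) ≡ 0#
      zeroF = solve 4 (λ α β γ b → α :* con (0 , 0) :+ b :* (β :* con (0 , 0) :+ γ :* con (0 , 0)) := con (0 , 0)) refl α β γ b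
      zeroG : G′ (0# , 0# , 0#) ≡ 0#
      zeroG = solve 4 (λ α β γ b → α :* con (0 , 0) :+ β :* con (0 , 0) :+ b :* (γ :* con (0 , 0)) := con (0 , 0)) refl α β γ b
      zeroH : H′ (0# , 0# , 0#) ≡ 0#
      zeroH = solve 3 (λ α β γ → α :* con (0 , 0) :+ β :* con (0 , 0) :+ γ :* con (0 , 0) := con (0 , 0)) refl α β γ
      vanish : ∀ (f : L → Carrier) → (x , y , z) · (u , v , w) ≡ (0# , 0# , 0#) → f (0# , 0# , 0#) ≡ 0# → f ((x , y , z) · (u , v , w)) ≡ 0#
      vanish f e zf = trans (cong f e) zf

    integral′ : ∀ x y → x · y ≡ (0# , 0# , 0#) → x ≡ (0# , 0# , 0#) ⊎ y ≡ (0# , 0# , 0#)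
    integral′ (x , y , z) (u , v , w) e = cases (norm₃ x y z ≟ 0#)
      where
      cases : Dec (norm₃ x y z ≡ 0#) → (x , y , z) ≡ (0# , 0# , 0#) ⊎ (u , v , w) ≡ (0# , 0# , 0#)
      cases (yes n≡0) = let x≡0 , y≡0 , z≡0 = anisotropic x y z n≡0 in inj₁ (triple x≡0 y≡0 z≡0)
      cases (no n≢0) = let eu , ev , ew = scaled x y z u v w e in inj₂ (triple (cancel eu) (cancel ev) (cancel ew))
        where
        cancel : ∀ {t} → norm₃ x y z * t ≡ 0# → t ≡ 0#
        cancel et = [ (λ n≡0 → ⊥-elim (n≢0 n≡0)) , (λ t≡0 → t≡0) ]′ (integral _ _ et)

-- The families

module _ {q} (K : FiniteField q) (R : CubeRoot K) where
  open FiniteField K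
  open CubeRoot R

  unitPower : Fin 3 → Carrier
  unitPower 0F = 1#
  unitPower 1F = ω
  unitPower 2F = ω * ω

  -- Each edge is written as a power of ω times a cube. Its color is then the exponent of ω for
  -- every χ with χ(ω) = 1, and no character has to be evaluated.
  record ExplicitPlane : Set where
    field
      vertex   : Fin 7 → Carrier
      exponent : Fin 7 → Fin 3 → Fin 3
      root     : Fin 7 → Fin 3 → Carrier
      root≢0   : ∀ i c → root i c ≢ 0#
      edges    : ∀ i c → vertex (point i (next c)) - vertex (point i (next (next c))) ≡
                         unitPower (exponent i c) * (root i c * (root i c * root i c))
      exponent-injective : ∀ i c d → exponent i c ≡ exponent i d → c ≡ d

  explicit⇒rainbow : ExplicitPlane → (X : CubicCharacter K) → CubicCharacter.χ X ω ≡ 1F → RainbowPlane K X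
  explicit⇒rainbow P X χω = record
    { vertex  = vertex
    ; edge≢0  = λ i c e → *-nonzero (unit≢0 (exponent i c)) (cube≢0 i c) (trans (sym (edges i c)) e)
    ; rainbow = λ i {c} {d} e → exponent-injective i c d (trans (sym (color i c)) (trans e (color i d)))
    }
    where
    open ExplicitPlane P
    open CubicCharacter X
    unit≢0 : ∀ a → unitPower a ≢ 0#
    unit≢0 0F = 1≢0
    unit≢0 1F = ω≢0 R
    unit≢0 2F = *-nonzero (ω≢0 R) (ω≢0 R)
    χ-unit : ∀ a → χ (unitPower a) ≡ a
    χ-unit 0F = χ-1
    χ-unit 1F = χω
    χ-unit 2F = trans (χ-* (ω≢0 R) (ω≢0 R)) (cong₂ _⊕_ χω χω)
    cube≢0 : ∀ i c → root i c * (root i c * root i c) ≢ 0#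
    cube≢0 i c = *-nonzero (root≢0 i c) (*-nonzero (root≢0 i c) (root≢0 i c))
    triple : ∀ a → a ⊕ (a ⊕ a) ≡ 0F
    triple = from-yes (Fin.all? λ a → a ⊕ (a ⊕ a) Fin.≟ 0F)
    χ-cube : ∀ {z} → z ≢ 0# → χ (z * (z * z)) ≡ 0F
    χ-cube {z} z≢0 = trans (χ-* z≢0 (*-nonzero z≢0 z≢0)) (trans (cong (χ z ⊕_) (χ-* z≢0 z≢0)) (triple (χ z)))
    color : ∀ i c → χ (vertex (point i (next c)) - vertex (point i (next (next c)))) ≡ exponent i c
    color i c = trans (cong χ (edges i c)) (trans (χ-* (unit≢0 (exponent i c)) (cube≢0 i c))
      (trans (cong₂ _⊕_ (χ-unit (exponent i c)) (χ-cube (root≢0 i c))) (⊕-identityʳ _)))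

-- Families over fields and their products

FamilyOn : ℕ → Set₁
FamilyOn v = Σ (FiniteAbelianGroup v) DifferenceFamily

FieldFamily : ℕ → Set₁
FieldFamily q = Σ (FiniteField q) λ K → DifferenceFamily (FiniteField.additiveGroup K)

module _ {q} {K : FiniteField q} (R : CubeRoot K) where
  open FiniteField K
  open CubeRoot R

  -- Any cubic character of K is good enough for a difference family, so χ(ω) = 2 can be turned into
  -- χ(ω) = 1 by doubling.
  fieldFamily : 2 ⋆ 1# ≢ 0# → 3 ⋆ 1# ≢ 0# →
    ((X : CubicCharacter K) → CubicCharacter.χ X ω ≡ 1F → ∃ (RainbowPlane K)) → FieldFamily q
  fieldFamily 2≢0 3≢0 plane = K , differenceFamily (proj₂ planes)
      (λ e → 2≢0 (trans (cong (1# +_) (+-identityʳ 1#)) e))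
    where
    X = cubicCharacter K R 3≢0
    open CubicCharacter X
    cases : ∀ a → χ ω ≡ a → ∃ (RainbowPlane K)
    cases 0F e = X , rainbowPlane₂ X R e 2≢0 3≢0
    cases 1F e = plane X e
    cases 2F e = plane (doubleCharacter X) (cong (λ t → t ⊕ t) e)
    planes : ∃ (RainbowPlane K)
    planes = cases (χ ω) refl

open FiniteField using (_⋆_; 1#; 0#)

-- A field with at least seven elements provides the seven distinct multipliers μᵢ.
product : ∀ {m n} → FamilyOn m → FieldFamily n → 7 ≤ n → FamilyOn (m ℕ.* n)
product (G , D) (K , E) 7≤n = _ , productFamily K (λ i → element (inject≤ i 7≤n))
    (λ e → Fin.inject≤-injective 7≤n 7≤n _ _ (element-injective e)) D E
  where open FiniteField K

power : ∀ {q} → FieldFamily q → 7 ≤ q → ∀ k → FamilyOn (q ℕ.^ suc k)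
power {q} (K , D) 7≤q zero    = subst FamilyOn (sym (ℕ.*-identityʳ q)) (FiniteField.additiveGroup K , D)
power {q} F       7≤q (suc k) = subst FamilyOn (ℕ.*-comm (q ℕ.^ suc k) q) (product (power F 7≤q k) F 7≤q)

numeral≢0 : ∀ {p} (pr : Prime p) m → ¬ (p ∣ m) → _⋆_ (primeField pr) m (1# (primeField pr)) ≢ 0# (primeField pr)
numeral≢0 {p} pr m p∤m e = p∤m (m%n≡0⇒n∣m m p (trans (sym (Modular.toℕ-[] p m))
    (trans (cong toℕ (trans (sym (primeField-numeral pr m)) e)) (trans (Modular.toℕ-[] p 0) (Modular.0%n≡0 p)))))
  where instance _ = prime⇒nonZero pr

numeral-p : ∀ {p} (pr : Prime p) → _⋆_ (primeField pr) p (1# (primeField pr)) ≡ 0# (primeField pr)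
numeral-p {p} pr = trans (primeField-numeral pr p) (Modular.[]-cong p (trans (n%n≡0 p) (sym (Modular.0%n≡0 p))))
  where instance _ = prime⇒nonZero pr

small-numeral : ∀ {p} (pr : Prime p) m → suc m < p → _⋆_ (primeField pr) (suc m) (1# (primeField pr)) ≢ 0# (primeField pr)
small-numeral pr m m<p = numeral≢0 pr (suc m) λ p∣m → ℕ.<⇒≱ m<p (∣⇒≤ p∣m)

prime-divisor : ∀ {p n} → Prime p → n ≢ 1 → n ∣ p → n ≡ p
prime-divisor pr n≢1 n∣p = [ (λ e → ⊥-elim (n≢1 e)) , (λ e → e) ]′ (prime⇒irreducible pr n∣p)

-- Here 7 = (3 + ω)(3 + ω²) vanishes, so `rainbowPlane₁` does not apply. The vertices are all
-- elements of the field; with ω = 2, every line has the edges -ω, -ω², -1, and 6 = -1 is its own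
-- cube.
F₇ : FieldFamily 7
F₇ = fieldFamily R (small-numeral pr 1 (s≤s (s≤s (s≤s z≤n)))) (small-numeral pr 2 (s≤s (s≤s (s≤s (s≤s z≤n)))))
    λ X χω → X , explicit⇒rainbow K R P X χω
  where
  pr : Prime 7
  pr = from-yes (prime? 7)
  K = primeField pr
  open FiniteField K using (_-_; _*_)
  R : CubeRoot K
  R = record { ω = 2F ; 1+ω+ω² = refl }
  P : ExplicitPlane K R
  P = record
    { vertex = λ i → i
    ; exponent = λ i → next
    ; root = λ i c → 6F
    ; root≢0 = λ i c ()
    ; edges = from-yes (Fin.all? λ (i : Fin 7) → Fin.all? λ (c : Fin 3) →
        point i (next c) - point i (next (next c)) Fin.≟ unitPower K R (next c) * (6F * (6F * 6F)))
    ; exponent-injective = λ i → from-yes (Fin.all? λ (c : Fin 3) → Fin.all? λ (d : Fin 3) → (next c Fin.≟ next d) →-dec (c Fin.≟ d))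
    }

prime₁₃ : Prime 13
prime₁₃ = from-yes (prime? 13)

-- In F₁₃[t] / (t² - 2), where a pair stands for x + y t, the root ω = 3 is not a cube. The pattern
-- modulo 13 cannot break in this characteristic, so a plane is given explicitly.
F₁₆₉ : FieldFamily 169
F₁₆₉ = fieldFamily R (λ ()) (λ ()) λ X χω → X , explicit⇒rainbow K R P X χω
  where
  K₁₃ = primeField prime₁₃
  module K₁₃ = FiniteField K₁₃
  [_] : ℕ → Fin 13
  [_] = Modular.[_] 13
  K = quadraticExtension K₁₃ [ 0 ] [ 2 ] (from-yes (Fin.all? λ (x : Fin 13) → ¬? (x K₁₃.* x Fin.≟ [ 0 ] K₁₃.* x K₁₃.+ [ 2 ])))
  open FiniteField K using (_-_; _*_; Carrier)
  R : CubeRoot K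
  R = record { ω = [ 3 ] , [ 0 ] ; 1+ω+ω² = refl }
  at : List (ℕ × ℕ) → ℕ → Carrier
  at xs n = let x , y = nth (0 , 0) xs n in [ x ] , [ y ]
  vertex : Fin 7 → Carrier
  vertex i = at ((0 , 0) ∷ (1 , 0) ∷ (9 , 9) ∷ (3 , 5) ∷ (0 , 12) ∷ (1 , 1) ∷ (0 , 2) ∷ []) (toℕ i)
  exponent : Fin 7 → Fin 3 → Fin 3
  exponent i c = nth 0F (1F ∷ 2F ∷ 0F ∷ 2F ∷ 0F ∷ 1F ∷ 2F ∷ 0F ∷ 1F ∷ 0F ∷ 1F ∷ 2F ∷ 0F ∷ 2F ∷ 1F ∷ 1F ∷ 2F ∷ 0F ∷ 2F ∷ 1F ∷ 0F ∷ [])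
    (3 ℕ.* toℕ i ℕ.+ toℕ c)
  root : Fin 7 → Fin 3 → Carrier
  root i c = at ((7 , 12) ∷ (2 , 8) ∷ (4 , 0) ∷ (4 , 8) ∷ (2 , 3) ∷ (1 , 4) ∷ (7 , 10) ∷ (4 , 6) ∷ (7 , 5) ∷ (0 , 7) ∷ (2 , 3) ∷
    (1 , 7) ∷ (7 , 4) ∷ (0 , 2) ∷ (4 , 2) ∷ (4 , 11) ∷ (0 , 7) ∷ (7 , 9) ∷ (2 , 3) ∷ (1 , 3) ∷ (0 , 1) ∷ [])
    (3 ℕ.* toℕ i ℕ.+ toℕ c)
  _≟_ : (x y : Carrier) → Dec (x ≡ y)
  _≟_ = ≡-dec Fin._≟_ Fin._≟_
  P : ExplicitPlane K R
  P = record
    { vertex = vertex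
    ; exponent = exponent
    ; root = root
    ; root≢0 = from-yes (Fin.all? λ (i : Fin 7) → Fin.all? λ (c : Fin 3) → ¬? (root i c ≟ ([ 0 ] , [ 0 ])))
    ; edges = from-yes (Fin.all? λ (i : Fin 7) → Fin.all? λ (c : Fin 3) →
        (vertex (point i (next c)) - vertex (point i (next (next c)))) ≟ (unitPower K R (exponent i c) * (root i c * (root i c * root i c))))
    ; exponent-injective = from-yes (Fin.all? λ (i : Fin 7) → Fin.all? λ (c : Fin 3) → Fin.all? λ (d : Fin 3) →
        (exponent i c Fin.≟ exponent i d) →-dec (c Fin.≟ d))
    }

-- In F₁₃[t] / (t³ - 2) one has (2 t)³ = 16 = 3 = ω. Thus ω is a cube, and only the case χ(ω) = 0
-- occurs.
F₂₁₉₇ : FieldFamily 2197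
F₂₁₉₇ = fieldFamily R (λ ()) (λ ()) λ X χω → ⊥-elim (cube X χω)
  where
  K₁₃ = primeField prime₁₃
  module K₁₃ = FiniteField K₁₃
  [_] : ℕ → Fin 13
  [_] = Modular.[_] 13
  anisotropic : ∀ x y z → norm₃ K₁₃ [ 2 ] x y z ≡ [ 0 ] → x ≡ [ 0 ] × y ≡ [ 0 ] × z ≡ [ 0 ]
  anisotropic = from-yes (Fin.all? λ (x : Fin 13) → Fin.all? λ (y : Fin 13) → Fin.all? λ (z : Fin 13) →
    (norm₃ K₁₃ [ 2 ] x y z Fin.≟ [ 0 ]) →-dec ((x Fin.≟ [ 0 ]) ×-dec (y Fin.≟ [ 0 ]) ×-dec (z Fin.≟ [ 0 ])))
  K = cubicExtension K₁₃ [ 2 ] anisotropic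
  open FiniteField K using (_*_; *-nonzero)
  R : CubeRoot K
  R = record { ω = [ 3 ] , [ 0 ] , [ 0 ] ; 1+ω+ω² = refl }
  cube : (X : CubicCharacter K) → CubicCharacter.χ X (CubeRoot.ω R) ≢ 1F
  cube X χω = impossible (trans (sym χω) (trans (χ-* {c} {c * c} c≢0 (*-nonzero {c} {c} c≢0 c≢0))
      (trans (cong (χ c ⊕_) (χ-* {c} {c} c≢0 c≢0)) (triple (χ c)))))
    where
    open CubicCharacter X
    c = [ 0 ] , [ 2 ] , [ 0 ]
    c≢0 : c ≢ ([ 0 ] , [ 0 ] , [ 0 ])
    c≢0 ()
    impossible : _≢_ {A = Fin 3} 1F 0F
    impossible ()
    triple : ∀ a → a ⊕ (a ⊕ a) ≡ 0F
    triple = from-yes (Fin.all? λ a → a ⊕ (a ⊕ a) Fin.≟ 0F)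

remainder : ∀ n {r} → n % 6 ≡ r → n ≡ r ℕ.+ (n / 6) ℕ.* 6
remainder n e = trans (m≡m%n+[m/n]*n n 6) (cong (ℕ._+ (n / 6) ℕ.* 6) e)

no-divisor : ∀ {d n r} → d ∣ 6 → n % 6 ≡ r → ¬ (d ∣ r) → ¬ (d ∣ n)
no-divisor {d} {n} {r} d∣6 e d∤r d∣n = d∤r (∣m+n∣m⇒∣n
  (subst (d ∣_) (trans (remainder n e) (ℕ.+-comm r _)) d∣n) (∣n⇒∣m*n (n / 6) d∣6))

3∣6 : 3 ∣ 6
3∣6 = divides 2 refl

2∣6 : 2 ∣ 6
2∣6 = divides 3 refl

3∤ : ∀ {r} → r % 3 ≢ 0 → ¬ (3 ∣ r)
3∤ {r} r%3 d = r%3 (n∣m⇒m%n≡0 r 3 d)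

primeFamily : ∀ {p} → Prime p → p % 6 ≡ 1 → p ≢ 7 → p ≢ 13 → FieldFamily p
primeFamily {p} pr p%6 p≢7 p≢13 = fieldFamily R (small-numeral pr 1 (below 2)) (small-numeral pr 2 (below 3))
    λ X χω → rainbowPlane₁ X R χω (small-numeral pr 1 (below 2)) (small-numeral pr 2 (below 3)) (small-numeral pr 6 (below 7))
      p (numeral-p pr) (λ e → p≢13 (sym (prime-divisor pr (λ ()) (m%n≡0⇒n∣m p 13 e))))
  where
  K = primeField pr
  7<p : 7 < p
  7<p = subst (7 <_) (sym (remainder p p%6)) (large (p / 6) (remainder p p%6))
    where
    large : ∀ t → p ≡ 1 ℕ.+ t ℕ.* 6 → 7 < 1 ℕ.+ t ℕ.* 6
    large 0 e = ⊥-elim (ℕ.nonTrivial⇒≢1 {{subst ℕ.NonTrivial e (prime⇒nonTrivial pr)}} refl)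
    large 1 e = ⊥-elim (p≢7 e)
    large (suc (suc t)) _ = s≤s (ℕ.m≤m+n 7 (5 ℕ.+ t ℕ.* 6))
  below : ∀ m → {_ : True (m ℕ.≤? 7)} → m < p
  below m {m≤7} = ℕ.≤-<-trans (toWitness m≤7) 7<p
  R : CubeRoot K
  -- Since p is 1 modulo 6, adding 3 to p - 2 gives a multiple of 6 plus 2, which 3 does not divide.
  R = cube-root-exists K λ d → 3∤ {2} (λ ()) (∣m+n∣m⇒∣n {m = (p / 6) ℕ.* 6} (subst (3 ∣_) shift (∣m∣n⇒∣m+n d (divides 1 refl))) (∣n⇒∣m*n (p / 6) 3∣6))
    where
    shift : (p ∸ 2) ℕ.+ 3 ≡ (p / 6) ℕ.* 6 ℕ.+ 2
    shift = trans (ℕ.+-suc (p ∸ 2) 2) (trans (cong suc (ℕ.m∸n+n≡m (ℕ.<⇒≤ (below 2))))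
      (trans (cong suc (remainder p p%6)) (ℕ.+-comm 2 _)))

module _ {p} (pr : Prime p) (p%6 : p % 6 ≡ 5) where
  private
    K = primeField pr
    module K = FiniteField K
    open Solver K using (solve; _:*_; _:-_; _:+_; :-_; _:=_; con)

    4<p : 4 < p
    4<p = subst (4 <_) (sym (remainder p p%6)) (ℕ.m≤m+n 5 _)

    below : ∀ m → {_ : True (m ℕ.≤? 4)} → m < p
    below m {m≤4} = ℕ.≤-<-trans (toWitness m≤4) 4<p

    -- A root of t² + t + 1 is a cube root of unity other than 1 and would make p - 1 divisible by
    -- 3, but p - 1 is 4 modulo 6.
    irreducible : ∀ x → x K.* x ≢ K.- K.1# K.* x K.+ K.- K.1#
    irreducible x e = 3∤ {4} (λ ()) (∣m+n∣m⇒∣n {m = (p / 6) ℕ.* 6} (subst (3 ∣_) shift (cube-root⇒3∣ K x x≢1 ω³)) (∣n⇒∣m*n (p / 6) 3∣6))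
      where
      R : CubeRoot K
      R = record { ω = x ; 1+ω+ω² = trans (cong (K.1# K.+ x K.+_) e)
        (solve 1 (λ x → con (1 , 0) :+ x :+ (:- con (1 , 0) :* x :+ :- con (1 , 0)) := con (0 , 0)) refl x) }
      open CubeRoot R using (ω³)
      x≢1 = ω≢1 K R (small-numeral pr 2 (below 3))
      shift : p ∸ 1 ≡ (p / 6) ℕ.* 6 ℕ.+ 4
      shift = trans (cong (_∸ 1) (remainder p p%6)) (ℕ.+-comm 4 _)

    L = quadraticExtension K (K.- K.1#) (K.- K.1#) irreducible
    module L = FiniteField L

    R : CubeRoot L
    R = record { ω = K.0# , K.1# ; 1+ω+ω² = cong₂ _,_
      (solve 0 (con (1 , 0) :+ con (0 , 0) :+ (con (0 , 0) :* con (0 , 0) :+ :- con (1 , 0) :* (con (1 , 0) :* con (1 , 0))) := con (0 , 0)) refl)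
      (solve 0 (con (0 , 0) :+ con (1 , 0) :+ (con (0 , 0) :* con (1 , 0) :+ con (1 , 0) :* con (0 , 0) :+ :- con (1 , 0) :* (con (1 , 0) :* con (1 , 0))) := con (0 , 0)) refl) }

    numeral : ∀ m → m L.⋆ L.1# ≡ (m K.⋆ K.1# , K.0#)
    numeral zero    = refl
    numeral (suc m) = trans (cong (L.1# L.+_) (numeral m)) (cong (λ t → suc m K.⋆ K.1# , t) (K.+-identityˡ K.0#))

    nonzero : ∀ m → m K.⋆ K.1# ≢ K.0# → m L.⋆ L.1# ≢ L.0#
    nonzero m m≢0 e = m≢0 (cong proj₁ (trans (sym (numeral m)) e))

  -- The generator t of the extension serves as ω. The residue 5 modulo 6 keeps p apart from 7 and
  -- 13, which have residue 1, so 7 is nonzero and `p` is a valid choice for `N`.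
  quadraticFamily : FieldFamily (p ℕ.* p)
  quadraticFamily = fieldFamily R (nonzero 2 (small-numeral pr 1 (below 2))) (nonzero 3 (small-numeral pr 2 (below 3)))
    λ X χω → rainbowPlane₁ X R χω (nonzero 2 (small-numeral pr 1 (below 2))) (nonzero 3 (small-numeral pr 2 (below 3)))
      (nonzero 7 (numeral≢0 pr 7 λ d → 5≢1 (trans (sym p%6) (cong (_% 6) (prime-divisor prime₇ p≢1 d)))))
      p (trans (numeral p) (cong (_, K.0#) (numeral-p pr)))
      (λ e → 5≢1 (trans (sym p%6) (cong (_% 6) (sym (prime-divisor pr (λ ()) (m%n≡0⇒n∣m p 13 e))))))
    where
    prime₇ : Prime 7
    prime₇ = from-yes (prime? 7)
    p≢1 : p ≢ 1
    p≢1 e = 5≢1 (trans (sym p%6) (cong (_% 6) e))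
      where
      5≢1 : 5 ≢ 1
      5≢1 ()
    5≢1 : 5 ≢ 1
    5≢1 ()

  7≤p² : 7 ≤ p ℕ.* p
  7≤p² = ℕ.≤-trans (ℕ.m≤m+n 7 18) (ℕ.*-mono-≤ 4<p 4<p)

-- Starting from the exponents 2 and 3, steps of 2 reach every larger exponent, so no family of
-- order 13 is ever called for.
powers-of-13 : ∀ n → FamilyOn (13 ℕ.^ (2 ℕ.+ n))
powers-of-13 0 = _ , proj₂ F₁₆₉
powers-of-13 1 = _ , proj₂ F₂₁₉₇
powers-of-13 (suc (suc n)) = subst FamilyOn (trans (ℕ.*-comm (13 ℕ.^ (2 ℕ.+ n)) 169) (ℕ.*-assoc 13 13 (13 ℕ.^ (2 ℕ.+ n))))
  (product (powers-of-13 n) F₁₆₉ (ℕ.m≤m+n 7 162))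

∣-power : ∀ {d p} k → d ∣ p → d ∣ p ℕ.^ suc k
∣-power {p = p} k d∣p = ∣m⇒∣m*n (p ℕ.^ k) d∣p

-- As 25 is 1 modulo 6, odd powers keep the residue 5. So for such p only even exponents give q of
-- residue 1, and q is a power of p².
power-residue : ∀ p → p % 6 ≡ 5 → ∀ j → (p ℕ.^ suc (2 ℕ.* j)) % 6 ≡ 5
power-residue p e zero    = trans (cong (_% 6) (ℕ.*-identityʳ p)) e
power-residue p e (suc j) = begin
  (p ℕ.^ suc (2 ℕ.* suc j)) % 6               ≡⟨ cong (λ k → (p ℕ.^ suc k) % 6) (ℕ.*-suc 2 j) ⟩
  (p ℕ.* (p ℕ.* r)) % 6                       ≡⟨ %-distribˡ-* p (p ℕ.* r) 6 ⟩
  ((p % 6) ℕ.* ((p ℕ.* r) % 6)) % 6           ≡⟨ cong (λ t → ((p % 6) ℕ.* t) % 6) (%-distribˡ-* p r 6) ⟩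
  ((p % 6) ℕ.* (((p % 6) ℕ.* (r % 6)) % 6)) % 6 ≡⟨ cong₂ (λ s t → (s ℕ.* ((s ℕ.* t) % 6)) % 6) e (power-residue p e j) ⟩
  5 ∎
  where
  open ≡-Reasoning
  r = p ℕ.^ suc (2 ℕ.* j)

even-or-odd : ∀ n → ∃ λ j → n ≡ 2 ℕ.* j ⊎ n ≡ suc (2 ℕ.* j)
even-or-odd zero    = 0 , inj₁ refl
even-or-odd (suc n) with even-or-odd n
... | j , inj₁ e = j , inj₂ (cong suc e)
... | j , inj₂ e = suc j , inj₁ (trans (cong suc e) (sym (ℕ.*-suc 2 j)))

family : ∀ {p} k → Prime p → (p ℕ.^ suc k) % 6 ≡ 1 → p ℕ.^ suc k ≢ 13 → FamilyOn (p ℕ.^ suc k)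
family {p} k pr q%6 q≢13 = cases (p % 6) refl (m%n<n p 6)
  where
  2∤p : ¬ (2 ∣ p)
  2∤p d = no-divisor 2∣6 q%6 (λ d → ℕ.<⇒≱ (s≤s (s≤s z≤n)) (∣⇒≤ d)) (∣-power k d)
  3∤p : ¬ (3 ∣ p)
  3∤p d = no-divisor 3∣6 q%6 (λ d → ℕ.<⇒≱ (s≤s (s≤s z≤n)) (∣⇒≤ d)) (∣-power k d)
  divisible : ∀ d r → d ∣ 6 → d ∣ r → r ≡ p % 6 → d ∣ p
  divisible d r d∣6 d∣r e = subst (d ∣_) (sym (remainder p (sym e))) (∣m∣n⇒∣m+n d∣r (∣n⇒∣m*n (p / 6) d∣6))
  one : p % 6 ≡ 1 → FamilyOn (p ℕ.^ suc k)
  one e with p ℕ.≟ 7 | p ℕ.≟ 13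
  ... | yes refl | _ = power F₇ ℕ.≤-refl k
  ... | no _ | yes refl = thirteen k q≢13
    where
    thirteen : ∀ k → 13 ℕ.^ suc k ≢ 13 → FamilyOn (13 ℕ.^ suc k)
    thirteen zero    ≢13 = ⊥-elim (≢13 refl)
    thirteen (suc k) _   = powers-of-13 k
  ... | no p≢7 | no p≢13 = power (primeFamily pr e p≢7 p≢13) 7≤p k
    where
    7≤p : 7 ≤ p
    7≤p = subst (7 ≤_) (sym (remainder p e)) (large (p / 6) (remainder p e))
      where
      large : ∀ t → p ≡ 1 ℕ.+ t ℕ.* 6 → 7 ≤ 1 ℕ.+ t ℕ.* 6
      large 0 e = ⊥-elim (ℕ.nonTrivial⇒≢1 {{subst ℕ.NonTrivial e (prime⇒nonTrivial pr)}} refl)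
      large (suc t) _ = s≤s (ℕ.m≤m+n 6 (t ℕ.* 6))
  five : p % 6 ≡ 5 → FamilyOn (p ℕ.^ suc k)
  five e with even-or-odd k
  ... | j , inj₁ k≡ = ⊥-elim (5≢1 (trans (sym (power-residue p e j)) (trans (cong (λ k → (p ℕ.^ suc k) % 6) (sym k≡)) q%6)))
    where
    5≢1 : 5 ≢ 1
    5≢1 ()
  ... | j , inj₂ k≡ = subst FamilyOn size (power (quadraticFamily pr e) (7≤p² pr e) j)
    where
    size : (p ℕ.* p) ℕ.^ suc j ≡ p ℕ.^ suc k
    size = trans (cong (λ t → (p ℕ.* t) ℕ.^ suc j) (sym (ℕ.*-identityʳ p))) (trans (ℕ.^-*-assoc p 2 (suc j))
      (cong (p ℕ.^_) (trans (ℕ.*-suc 2 j) (cong suc (sym k≡)))))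
  cases : ∀ r → r ≡ p % 6 → r < 6 → FamilyOn (p ℕ.^ suc k)
  cases 0 e _ = ⊥-elim (2∤p (divisible 2 0 2∣6 (divides 0 refl) e))
  cases 1 e _ = one (sym e)
  cases 2 e _ = ⊥-elim (2∤p (divisible 2 2 2∣6 (divides 1 refl) e))
  cases 3 e _ = ⊥-elim (3∤p (divisible 3 3 3∣6 (divides 1 refl) e))
  cases 4 e _ = ⊥-elim (2∤p (divisible 2 4 2∣6 (divides 2 refl) e))
  cases 5 e _ = five (sym e)
  cases (suc (suc (suc (suc (suc (suc _)))))) _ (s≤s (s≤s (s≤s (s≤s (s≤s (s≤s ()))))))

theorem13 : (q : ℕ) → IsPrimePower q → q % 6 ≡ 1 → ¬ (q ≡ 13) → RegularFK q
theorem13 q (p , k , pr , refl) q%6 q≢13 = regularFK (proj₂ (family k pr q%6 q≢13))
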